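{- If $G$ is an $n$-vertex graph with minimum degree at least $0.999n$, then $G$ is total weight $(1,4)$-choosable.
   Context: Graphs are finite and simple. For a graph $G=(V,E)$ and a vertex $i\in V$, let $E(i)$ denote the set of edges incident to $i$. A total weighting of $G$ is a mapping $\phi: V\cup E\to\mathbb{R}$; it is proper if for every edge $\{i,j\}\in E$, $\sum_{e\in E(i)}\phi(e)+\phi(i)\neq \sum_{e\in E(j)}\phi(e)+\phi(j)$. For positive integers $k,k'$, $G$ is total weight $(k,k')$-choosable if for every assignment $L$ of a set $L(v)$ of $k$ real numbers to each vertex $v\in V$ and a set $L(e)$ of $k'$ real numbers to each edge $e\in E$, there is a proper total weighting $\phi$ of $G$ with $\phi(z)\in L(z)$ for all $z\in V\cup E$. -}

module Defs where

open import Data.Nat as ℕ using (ℕ; suc)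
import Data.Nat.Solver as ℕSolver
open import Data.Integer as ℤ using (+_)
import Data.Integer.Properties as ℤₚ
open import Data.Rational as ℚ using (ℚ; 0ℚ; _/_; ∣_∣)
import Data.Rational.Properties as ℚₚ
import Data.Rational.Solver as ℚSolver
import Data.Rational.Unnormalised as ℚᵘ
import Data.Rational.Unnormalised.Properties as ℚᵘₚ
open import Data.Fin as Fin using (Fin)
open import Data.List using (List; length; map; foldr; filter; allFin)
open import Data.Product using (∃; _×_; _,_; proj₁; proj₂)
open import Data.Sum using (_⊎_; inj₁; inj₂)
open import Function using (Injective; _∘_)
open import Relation.Nullary using (Dec)
open import Relation.Nullary.Decidable using (_⊎-dec_)
open import Relation.Binary.PropositionalEquality

-- Real numbers: Bishop's regular sequences of rationals, in which the
-- n-th term is within 1/(n+1) of the limit.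

inv : ℕ → ℚ
inv n = + 1 / suc n

record ℝ : Set where
  constructor mkℝ
  field
    seq     : ℕ → ℚ
    regular : ∀ m n → ∣ seq m ℚ.- seq n ∣ ℚ.≤ inv m ℚ.+ inv n

open ℝ public

infix 4 _≃_ _#_

_≃_ : ℝ → ℝ → Set
x ≃ y = ∀ n → ∣ seq x n ℚ.- seq y n ∣ ℚ.≤ inv n ℚ.+ inv n

-- "x ≠ y" for real numbers, in its usual constructive form (apartness):
-- some approximation witnesses the failure of x ≃ y.  The negation of
-- x # y is x ≃ y, so classically x # y is the negation of x ≃ y.
_#_ : ℝ → ℝ → Set
x # y = ∃ λ n → inv n ℚ.+ inv n ℚ.< ∣ seq x n ℚ.- seq y n ∣

0ℝ : ℝ
0ℝ = mkℝ (λ _ → 0ℚ) λ m n → ℚₚ.+-mono-≤ (inv≥0 m) (inv≥0 n)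
  where
  inv≥0 : ∀ n → 0ℚ ℚ.≤ inv n
  inv≥0 n = ℚₚ.nonNegative⁻¹ (inv n) {{ℚₚ.normalize-nonNeg 1 (suc n)}}

inv-double : ∀ n → inv (suc (n ℕ.+ n)) ℚ.+ inv (suc (n ℕ.+ n)) ≡ inv n
inv-double n = ℚₚ.toℚᵘ-injective
  (ℚᵘₚ.≃-trans (ℚₚ.toℚᵘ-homo-+ (inv k) (inv k))
  (ℚᵘₚ.≃-trans (ℚᵘₚ.+-cong (unnorm k) (unnorm k))
  (ℚᵘₚ.≃-trans (ℚᵘ.*≡* cross) (ℚᵘₚ.≃-sym (unnorm n)))))
  where
  k = suc (n ℕ.+ n)

  unnorm : ∀ j → ℚ.toℚᵘ (inv j) ℚᵘ.≃ ℚᵘ.mkℚᵘ (+ 1) j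
  unnorm j = ℚₚ.toℚᵘ-fromℚᵘ (ℚᵘ.mkℚᵘ (+ 1) j)

  crossℕ : (suc k ℕ.+ suc k) ℕ.* suc n ≡ suc k ℕ.* suc k
  crossℕ = solve 1 (λ a → let d = con 2 :+ (a :+ a) in
    (d :+ d) :* (con 1 :+ a) := d :* d) refl n
    where open ℕSolver.+-*-Solver

  cross : (+ 1 ℤ.* + suc k ℤ.+ + 1 ℤ.* + suc k) ℤ.* + suc n
        ≡ + 1 ℤ.* + (suc k ℕ.* suc k)
  cross = begin
    (+ 1 ℤ.* + suc k ℤ.+ + 1 ℤ.* + suc k) ℤ.* + suc n
      ≡⟨ cong (λ d → (d ℤ.+ d) ℤ.* + suc n) (ℤₚ.*-identityˡ (+ suc k)) ⟩
    + (suc k ℕ.+ suc k) ℤ.* + suc n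
      ≡⟨ ℤₚ.pos-* (suc k ℕ.+ suc k) (suc n) ⟨
    + ((suc k ℕ.+ suc k) ℕ.* suc n)
      ≡⟨ cong +_ crossℕ ⟩
    + (suc k ℕ.* suc k)
      ≡⟨ ℤₚ.*-identityˡ _ ⟨
    + 1 ℤ.* + (suc k ℕ.* suc k) ∎
    where open ≡-Reasoning

infixl 6 _+ℝ_

-- The (2n+1)-st terms are within 1/(2n+2) of their limits, so their sum is
-- within 1/(n+1) of the limit of the sums.
_+ℝ_ : ℝ → ℝ → ℝ
seq (x +ℝ y) n = seq x (suc (n ℕ.+ n)) ℚ.+ seq y (suc (n ℕ.+ n))
regular (x +ℝ y) m n = begin
  ∣ (a ℚ.+ b) ℚ.- (c ℚ.+ d) ∣
    ≡⟨ cong ∣_∣ (solve 4 (λ a b c d →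
         (a :+ b) :- (c :+ d) := (a :- c) :+ (b :- d)) refl a b c d) ⟩
  ∣ (a ℚ.- c) ℚ.+ (b ℚ.- d) ∣
    ≤⟨ ℚₚ.∣p+q∣≤∣p∣+∣q∣ (a ℚ.- c) (b ℚ.- d) ⟩
  ∣ a ℚ.- c ∣ ℚ.+ ∣ b ℚ.- d ∣
    ≤⟨ ℚₚ.+-mono-≤ (regular x m′ n′) (regular y m′ n′) ⟩
  (inv m′ ℚ.+ inv n′) ℚ.+ (inv m′ ℚ.+ inv n′)
    ≡⟨ solve 2 (λ p q → (p :+ q) :+ (p :+ q) := (p :+ p) :+ (q :+ q))
         refl (inv m′) (inv n′) ⟩
  (inv m′ ℚ.+ inv m′) ℚ.+ (inv n′ ℚ.+ inv n′)
    ≡⟨ cong₂ ℚ._+_ (inv-double m) (inv-double n) ⟩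
  inv m ℚ.+ inv n ∎
  where
  open ℚₚ.≤-Reasoning
  open ℚSolver.+-*-Solver
  m′ = suc (m ℕ.+ m)
  n′ = suc (n ℕ.+ n)
  a = seq x m′
  b = seq y m′
  c = seq x n′
  d = seq y n′

sumℝ : List ℝ → ℝ
sumℝ = foldr _+ℝ_ 0ℝ

record RealSet (k : ℕ) : Set where
  field
    elem     : Fin k → ℝ
    distinct : ∀ {a b} → a ≢ b → elem a # elem b

open RealSet public

infix 4 _∈_

_∈_ : ∀ {k} → ℝ → RealSet k → Set
x ∈ S = ∃ λ a → x ≃ elem S a

-- The edge set is enumerated by Fin size.  An edge {i , j} is recorded as
-- the pair (i , j) with i < j, which excludes loops; injectivity of ends
-- excludes multiple edges.
record Graph (n : ℕ) : Set where
  field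
    size      : ℕ
    ends      : Fin size → Fin n × Fin n
    ordered   : ∀ e → proj₁ (ends e) Fin.< proj₂ (ends e)
    injective : Injective _≡_ _≡_ ends

module _ {n : ℕ} (G : Graph n) where

  open Graph G

  Vertex : Set
  Vertex = Fin n

  Edge : Set
  Edge = Fin size

  Incident : Vertex → Edge → Set
  Incident i e = proj₁ (ends e) ≡ i ⊎ proj₂ (ends e) ≡ i

  incident? : ∀ i e → Dec (Incident i e)
  incident? i e = (proj₁ (ends e) Fin.≟ i) ⊎-dec (proj₂ (ends e) Fin.≟ i)

  incidentEdges : Vertex → List Edge
  incidentEdges i = filter (incident? i) (allFin size)

  degree : Vertex → ℕ
  degree i = length (incidentEdges i)

  MinDegreeAtLeast : ℚ → Set
  MinDegreeAtLeast d = ∀ i → d ℚ.≤ + degree i / 1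

  TotalWeighting : Set
  TotalWeighting = Vertex ⊎ Edge → ℝ

  weightAt : TotalWeighting → Vertex → ℝ
  weightAt φ i = sumℝ (map (φ ∘ inj₂) (incidentEdges i)) +ℝ φ (inj₁ i)

  Proper : TotalWeighting → Set
  Proper φ = ∀ e → weightAt φ (proj₁ (ends e)) # weightAt φ (proj₂ (ends e))

  TotalWeightChoosable : ℕ → ℕ → Set
  TotalWeightChoosable k k′ =
    (LV : Vertex → RealSet k) (LE : Edge → RealSet k′) →
    ∃ λ (φ : TotalWeighting) →
      Proper φ × (∀ v → φ (inj₁ v) ∈ LV v) × (∀ e → φ (inj₂ e) ∈ LE e)

{-# OPTIONS --safe #-}
-- Let Q = ∏_{uv} (y_u - y_v) over the edges, so that the product to be made
-- non-zero is Q with y_u replaced by the sum of the weights at u.  Suppose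
-- every edge uv gets an apex w such that uw and vw are edges, and every edge
-- occurs at most three times among these legs.  Differentiating in the weight of
-- uw acts on functions of y as ∂_u + ∂_w, so the difference of the two leg
-- derivatives acts as ∂_u - ∂_v.  Their product over all edges turns Q into the
-- constant Q(∂)Q, which is the permanent of the Gram matrix of the edge
-- boundaries.  By Cauchy-Binet a positive multiple of it is
-- a sum of squares, not all zero, so it does not vanish.  Expanding the
-- product, some choice of one leg per edge gives a monomial of exponents at
-- most 3 with non-zero coefficient, and the Combinatorial Nullstellensatz
-- applies.  It is used quantitatively, on rational approximations: the lower
-- bound for the factors does not depend on the precision.
--
-- The apexes: identify the vertices with ℤ/n and give uv the apex -(u + v)
-- whenever this is a triangle of G.  The edges of such triangles are then
-- legs exactly twice, and the remaining edges are not legs at all.  The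
-- remaining edges are treated greedily, first those between the few vertices
-- that meet many of them.
module Submission where

open import Defs
open import Algebra.Structures using (IsCommutativeSemiring; IsCommutativeRing)
open import Data.Bool using (if_then_else_)
open import Data.Fin as Fin using (Fin; zero; suc; toℕ)
import Data.Fin.Properties as Finₚ
import Data.Integer as ℤ
import Data.Integer.Properties as ℤₚ
open import Data.List using (List; []; _∷_; map; _++_; length; allFin; tabulate; filter)
import Data.List.Membership.Propositional as L
import Data.List.Membership.Propositional.Properties as Lₚ
import Data.List.Properties as Listₚ
open import Data.List.Relation.Binary.Pointwise as Pointwise using (Pointwise; []; _∷_)
open import Data.List.Relation.Unary.All as All using (All; []; _∷_)
import Data.List.Relation.Unary.All.Properties as Allₚ
open import Data.List.Relation.Unary.Any using (here; there)
open import Data.Nat as ℕ using (ℕ; zero; suc)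
import Data.Nat.DivMod as DivMod
open import Data.Nat.Divisibility as ∣ using (_∣_)
import Data.Nat.Properties as ℕₚ
import Data.Nat.Solver as ℕSolver
open import Data.Product using (∃; ∃₂; _×_; _,_; proj₁; proj₂; map₂)
import Data.Rational as ℚ
import Data.Rational.Properties as ℚₚ
import Data.Rational.Solver as ℚSolver
import Data.Rational.Unnormalised as ℚᵘ
import Data.Rational.Unnormalised.Properties as ℚᵘₚ
open import Data.Sum using (_⊎_; inj₁; inj₂)
open import Data.Vec as Vec using (Vec; []; _∷_; lookup; _[_]%=_)
import Data.Vec.Properties as Vecₚ
open import Function using (_∘_; flip; id; const)
open import Relation.Binary.PropositionalEquality
open import Relation.Nullary using (¬_; Dec; yes; no; does; ¬?; contradiction)
open import Relation.Nullary.Decidable using (_×-dec_)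

-- An apex for an edge uv must avoid the non-neighbours of u and v, the vertices that have been an
-- apex too often, and those joined to u or v by a pair with no room for another use. The last kind
-- is the obstacle, since a single vertex may meet almost only remaining edges. With m of them at a
-- vertex and few apexes there, its pairs receive about m uses. A pair in a triangle of the cyclic
-- system has room for one use, but each of the m remaining edges has room for three; balancing the
-- two leaves at most about n/2 full pairs, whatever m is. Two such ends could still block every
-- apex, whereas an end with m < n/4 has little more than n/4 full pairs. So the critical edges join
-- two vertices with m at least n/4. These vertices are few, because at most n²/1000 edges remain;
-- treated before all others, such edges make few pairs full.
--
-- The weights have to be found by search, and it is not decidable whether real sums differ. The
-- search therefore takes place among rationals at one precision, which is fixed after the constant
-- of the Nullstellensatz.

picks : ∀ {A : Set} → List A → List (A × List A)
picks []       = []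
picks (x ∷ xs) = (x , xs) ∷ map (map₂ (x ∷_)) (picks xs)

picks-length : ∀ {A : Set} (xs : List A) →
  All (λ p → suc (length (proj₂ p)) ≡ length xs) (picks xs)
picks-length []       = []
picks-length (x ∷ xs) = refl ∷ Allₚ.map⁺ (All.map (cong suc) (picks-length xs))

-- Finite sums in a commutative semiring

module Sums {R : Set} {_⊕_ _⊗_ : R → R → R} {0# 1# : R}
            (isCS : IsCommutativeSemiring _≡_ _⊕_ _⊗_ 0# 1#) where

  open IsCommutativeSemiring isCS hiding (refl; sym; trans; reflexive; zero)
  open ≡-Reasoning

  ∑ : ∀ {A : Set} → List A → (A → R) → R
  ∑ []       f = 0#
  ∑ (x ∷ xs) f = f x ⊕ ∑ xs f

  private variable
    A B : Set

  interchange : ∀ a b c d → (a ⊕ b) ⊕ (c ⊕ d) ≡ (a ⊕ c) ⊕ (b ⊕ d)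
  interchange a b c d = begin
    (a ⊕ b) ⊕ (c ⊕ d)  ≡⟨ +-assoc a b (c ⊕ d) ⟩
    a ⊕ (b ⊕ (c ⊕ d))  ≡⟨ cong (a ⊕_) (sym (+-assoc b c d)) ⟩
    a ⊕ ((b ⊕ c) ⊕ d)  ≡⟨ cong (λ z → a ⊕ (z ⊕ d)) (+-comm b c) ⟩
    a ⊕ ((c ⊕ b) ⊕ d)  ≡⟨ cong (a ⊕_) (+-assoc c b d) ⟩
    a ⊕ (c ⊕ (b ⊕ d))  ≡⟨ sym (+-assoc a c (b ⊕ d)) ⟩
    (a ⊕ c) ⊕ (b ⊕ d)  ∎

  ∑-cong : ∀ (xs : List A) {f g : A → R} → (∀ x → f x ≡ g x) → ∑ xs f ≡ ∑ xs g
  ∑-cong []       f≗g = refl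
  ∑-cong (x ∷ xs) f≗g = cong₂ _⊕_ (f≗g x) (∑-cong xs f≗g)

  ∑-congᴬ : ∀ {xs : List A} {f g : A → R} → All (λ x → f x ≡ g x) xs → ∑ xs f ≡ ∑ xs g
  ∑-congᴬ []         = refl
  ∑-congᴬ (eq ∷ eqs) = cong₂ _⊕_ eq (∑-congᴬ eqs)

  ∑-zero : ∀ {xs : List A} {f : A → R} → All (λ x → f x ≡ 0#) xs → ∑ xs f ≡ 0#
  ∑-zero []         = refl
  ∑-zero (eq ∷ eqs) = trans (cong₂ _⊕_ eq (∑-zero eqs)) (+-identityˡ 0#)

  ∑-distrib-+ : ∀ (xs : List A) (f g : A → R) → ∑ xs (λ x → f x ⊕ g x) ≡ ∑ xs f ⊕ ∑ xs g
  ∑-distrib-+ []       f g = sym (+-identityˡ 0#)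
  ∑-distrib-+ (x ∷ xs) f g =
    trans (cong ((f x ⊕ g x) ⊕_) (∑-distrib-+ xs f g)) (interchange _ _ _ _)

  ∑-distribˡ-* : ∀ (xs : List A) c (f : A → R) → ∑ xs (λ x → c ⊗ f x) ≡ c ⊗ ∑ xs f
  ∑-distribˡ-* []       c f = sym (zeroʳ c)
  ∑-distribˡ-* (x ∷ xs) c f =
    trans (cong ((c ⊗ f x) ⊕_) (∑-distribˡ-* xs c f)) (sym (distribˡ c _ _))

  ∑-distribʳ-* : ∀ (xs : List A) c (f : A → R) → ∑ xs (λ x → f x ⊗ c) ≡ ∑ xs f ⊗ c
  ∑-distribʳ-* xs c f = begin
    ∑ xs (λ x → f x ⊗ c)  ≡⟨ ∑-cong xs (λ x → *-comm (f x) c) ⟩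
    ∑ xs (λ x → c ⊗ f x)  ≡⟨ ∑-distribˡ-* xs c f ⟩
    c ⊗ ∑ xs f            ≡⟨ *-comm c _ ⟩
    ∑ xs f ⊗ c            ∎

  ∑-swap : ∀ (xs : List A) (ys : List B) (f : A → B → R) →
    ∑ xs (λ x → ∑ ys (f x)) ≡ ∑ ys (λ y → ∑ xs (λ x → f x y))
  ∑-swap []       ys f = sym (∑-zero (All.universal (λ _ → refl) ys))
  ∑-swap (x ∷ xs) ys f = trans (cong (∑ ys (f x) ⊕_) (∑-swap xs ys f))
    (sym (∑-distrib-+ ys (f x) _))

  ∑-map : ∀ (h : A → B) (xs : List A) (f : B → R) → ∑ (map h xs) f ≡ ∑ xs (f ∘ h)
  ∑-map h []       f = refl
  ∑-map h (x ∷ xs) f = cong (f (h x) ⊕_) (∑-map h xs f)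

  ∑-++ : ∀ (xs ys : List A) (f : A → R) → ∑ (xs ++ ys) f ≡ ∑ xs f ⊕ ∑ ys f
  ∑-++ []       ys f = sym (+-identityˡ _)
  ∑-++ (x ∷ xs) ys f = trans (cong (f x ⊕_) (∑-++ xs ys f)) (sym (+-assoc _ _ _))

  ∑-×-∑ : ∀ (xs : List A) (ys : List B) (f : A → R) (g : B → R) →
    ∑ xs f ⊗ ∑ ys g ≡ ∑ xs (λ x → ∑ ys (λ y → f x ⊗ g y))
  ∑-×-∑ xs ys f g = begin
    ∑ xs f ⊗ ∑ ys g                      ≡⟨ sym (∑-distribʳ-* xs _ f) ⟩
    ∑ xs (λ x → f x ⊗ ∑ ys g)            ≡⟨ ∑-cong xs (λ x → sym (∑-distribˡ-* ys (f x) g)) ⟩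
    ∑ xs (λ x → ∑ ys (λ y → f x ⊗ g y))  ∎

  δ : ∀ {n} → Fin n → Fin n → R
  δ i j = if does (i Fin.≟ j) then 1# else 0#

  δ-refl : ∀ {n} (i : Fin n) → δ i i ≡ 1#
  δ-refl i with i Fin.≟ i
  ... | yes _   = refl
  ... | no  i≢i = contradiction refl i≢i

  δ-≢ : ∀ {n} {i j : Fin n} → i ≢ j → δ i j ≡ 0#
  δ-≢ {i = i} {j} i≢j with i Fin.≟ j
  ... | yes i≡j = contradiction i≡j i≢j
  ... | no  _   = refl

  δ-suc : ∀ {n} (i j : Fin n) → δ (suc i) (suc j) ≡ δ i j
  δ-suc i j with i Fin.≟ j
  ... | yes _ = refl
  ... | no  _ = refl

  ∑-allFin-suc : ∀ n (f : Fin (suc n) → R) →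
    ∑ (allFin (suc n)) f ≡ f zero ⊕ ∑ (allFin n) (f ∘ suc)
  ∑-allFin-suc n f = cong (f zero ⊕_) (begin
    ∑ (tabulate suc) f         ≡⟨ cong (λ l → ∑ l f) (sym (Listₚ.map-tabulate id suc)) ⟩
    ∑ (map suc (allFin n)) f   ≡⟨ ∑-map suc (allFin n) f ⟩
    ∑ (allFin n) (f ∘ suc)     ∎)

  ∑-δ : ∀ {n} (i : Fin n) (f : Fin n → R) → ∑ (allFin n) (λ j → δ i j ⊗ f j) ≡ f i
  ∑-δ {suc n} zero f = begin
    ∑ (allFin (suc n)) (λ j → δ zero j ⊗ f j)  ≡⟨ ∑-allFin-suc n _ ⟩
    (1# ⊗ f zero) ⊕ ∑ (allFin n) (λ j → 0# ⊗ f (suc j))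
      ≡⟨ cong₂ _⊕_ (*-identityˡ _) (∑-zero (All.universal (λ _ → zeroˡ _) (allFin n))) ⟩
    f zero ⊕ 0#                                ≡⟨ +-identityʳ _ ⟩
    f zero                                     ∎
  ∑-δ {suc n} (suc i) f = begin
    ∑ (allFin (suc n)) (λ j → δ (suc i) j ⊗ f j)  ≡⟨ ∑-allFin-suc n _ ⟩
    (0# ⊗ f zero) ⊕ ∑ (allFin n) (λ j → δ (suc i) (suc j) ⊗ f (suc j))
      ≡⟨ cong₂ _⊕_ (zeroˡ _) (∑-cong (allFin n) (λ j → cong (_⊗ f (suc j)) (δ-suc i j))) ⟩
    0# ⊕ ∑ (allFin n) (λ j → δ i j ⊗ f (suc j))   ≡⟨ +-identityˡ _ ⟩
    ∑ (allFin n) (λ j → δ i j ⊗ f (suc j))        ≡⟨ ∑-δ i (f ∘ suc) ⟩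
    f (suc i)                                     ∎

  -- Two successive picks enumerate the ordered pairs of positions, and exchanging the two members
  -- permutes these pairs. In `laplace` this interchanges the expansions along two rows.
  ∑-picks-picks : ∀ (xs : List A) (φ : A → A → List A → R) →
    ∑ (picks xs) (λ p → ∑ (picks (proj₂ p)) (λ q → φ (proj₁ p) (proj₁ q) (proj₂ q))) ≡
    ∑ (picks xs) (λ p → ∑ (picks (proj₂ p)) (λ q → φ (proj₁ q) (proj₁ p) (proj₂ q)))
  ∑-picks-picks []       φ = refl
  ∑-picks-picks (x ∷ xs) φ = begin
    ∑ (picks (x ∷ xs)) _  ≡⟨ expand φ ⟩
    a ⊕ (b ⊕ c)           ≡⟨ sym (+-assoc a b c) ⟩
    (a ⊕ b) ⊕ c           ≡⟨ cong₂ _⊕_ (+-comm a b) (∑-picks-picks xs (λ f g r → φ f g (x ∷ r))) ⟩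
    (b ⊕ a) ⊕ c′          ≡⟨ +-assoc b a c′ ⟩
    b ⊕ (a ⊕ c′)          ≡⟨ expand (flip φ) ⟨
    ∑ (picks (x ∷ xs)) _  ∎
    where
    S₂ : (φ : _ → _ → List _ → R) → R
    S₂ φ = ∑ (picks xs) (λ p → ∑ (picks (proj₂ p)) (λ q → φ (proj₁ p) (proj₁ q) (x ∷ proj₂ q)))
    a b c c′ : R
    a  = ∑ (picks xs) (λ p → φ x (proj₁ p) (proj₂ p))
    b  = ∑ (picks xs) (λ p → φ (proj₁ p) x (proj₂ p))
    c  = S₂ φ
    c′ = S₂ (flip φ)
    expand : ∀ φ → ∑ (picks (x ∷ xs))
        (λ p → ∑ (picks (proj₂ p)) (λ q → φ (proj₁ p) (proj₁ q) (proj₂ q)))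
      ≡ ∑ (picks xs) (λ p → φ x (proj₁ p) (proj₂ p)) ⊕
        (∑ (picks xs) (λ p → φ (proj₁ p) x (proj₂ p)) ⊕ S₂ φ)
    expand φ = cong (∑ (picks xs) (λ p → φ x (proj₁ p) (proj₂ p)) ⊕_) (begin
      ∑ (map (map₂ (x ∷_)) (picks xs)) _
        ≡⟨ ∑-map _ (picks xs) _ ⟩
      ∑ (picks xs) (λ p → φ (proj₁ p) x (proj₂ p) ⊕
        ∑ (map (map₂ (x ∷_)) (picks (proj₂ p))) (λ q → φ (proj₁ p) (proj₁ q) (proj₂ q)))
        ≡⟨ ∑-cong (picks xs) (λ p → cong (φ (proj₁ p) x (proj₂ p) ⊕_) (∑-map _ (picks (proj₂ p)) _)) ⟩
      ∑ (picks xs) (λ p → φ (proj₁ p) x (proj₂ p) ⊕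
        ∑ (picks (proj₂ p)) (λ q → φ (proj₁ p) (proj₁ q) (x ∷ proj₂ q)))
        ≡⟨ ∑-distrib-+ (picks xs) _ _ ⟩
      ∑ (picks xs) (λ p → φ (proj₁ p) x (proj₂ p)) ⊕ S₂ φ ∎)

module ℕΣ = Sums ℕₚ.+-*-isCommutativeSemiring
module ℚΣ = Sums (IsCommutativeRing.isCommutativeSemiring ℚₚ.+-*-isCommutativeRing)

module Algebraic where

  open import Data.Rational using (ℚ; mkℚ; 0ℚ; 1ℚ; _+_; _*_; _-_; -_; _/_; _≤_; _<_; ∣_∣; _⊔_)
  open ℚΣ

  private variable
    A B C : Set
    m     : ℕ

  -- Permanents

  -- Expansion along the first row. A repeated column, standing for a variable of higher exponent,
  -- is simply a repeated list entry; lists of different lengths have permanent 0.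
  perm : (A → B → ℚ) → List A → List B → ℚ
  perm p []       []       = 1ℚ
  perm p []       (_ ∷ _)  = 0ℚ
  perm p (a ∷ as) bs       = ∑ (picks bs) λ (b , bs′) → p a b * perm p as bs′

  module _ where
    open ≡-Reasoning
    *-swap : ∀ x y z → x * (y * z) ≡ y * (x * z)
    *-swap = solve 3 (λ x y z → x :* (y :* z) := y :* (x :* z)) refl
      where open ℚSolver.+-*-Solver

    -- Expanding along the first row and then the first column, or the other way round, gives the
    -- same corner term and the same double sum over the remaining rows and columns. The recursive
    -- calls concern lists like `a ∷ as′`, which are shorter without being sublists, so the
    -- recursion runs on a bound for the length.
    perm-transpose : ∀ (p : A → B → ℚ) as bs → perm p as bs ≡ perm (flip p) bs as
    perm-transpose p as bs = go (length as) as bs ℕₚ.≤-refl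
      where
      go : ∀ {A B : Set} {p : A → B → ℚ} n as bs → length as ℕ.≤ n → perm p as bs ≡ perm (flip p) bs as
      go n [] [] eq = refl
      go n [] (b ∷ bs) eq = refl
      go n (a ∷ as) [] eq = refl
      go {p = p} (suc n) (a ∷ as) (b ∷ bs) eq = begin
        p a b * perm p as bs + ∑ (map (map₂ (b ∷_)) (picks bs)) (λ (b′ , bs′) → p a b′ * perm p as bs′)
          ≡⟨ cong₂ _+_ (cong (p a b *_) (go n as bs as≤n)) (begin
            ∑ (map (map₂ (b ∷_)) (picks bs)) (λ (b′ , bs′) → p a b′ * perm p as bs′)
              ≡⟨ ∑-map (map₂ (b ∷_)) (picks bs) _ ⟩
            ∑ (picks bs) (λ (b′ , bs′) → p a b′ * perm p as (b ∷ bs′))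
              ≡⟨ ∑-cong (picks bs) (λ (b′ , bs′) → trans (cong (p a b′ *_) (go n as (b ∷ bs′) as≤n))
                   (sym (∑-distribˡ-* (picks as) (p a b′) _))) ⟩
            ∑ (picks bs) (λ (b′ , bs′) → ∑ (picks as) λ (a′ , as′) →
              p a b′ * (p a′ b * perm (flip p) bs′ as′))
              ≡⟨ ∑-swap (picks bs) (picks as) _ ⟩
            ∑ (picks as) (λ (a′ , as′) → ∑ (picks bs) λ (b′ , bs′) →
              p a b′ * (p a′ b * perm (flip p) bs′ as′))
              ≡⟨ ∑-congᴬ (All.map (λ {(a′ , as′)} len → begin
                  ∑ (picks bs) (λ (b′ , bs′) → p a b′ * (p a′ b * perm (flip p) bs′ as′))
                    ≡⟨ ∑-cong (picks bs) (λ (b′ , bs′) → trans (*-swap (p a b′) (p a′ b) _)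
                         (cong (λ z → p a′ b * (p a b′ * z))
                           (sym (go n as′ bs′ (ℕₚ.≤-trans (ℕₚ.n≤1+n _) (ℕₚ.≤-trans (ℕₚ.≤-reflexive len) as≤n)))))) ⟩
                  ∑ (picks bs) (λ (b′ , bs′) → p a′ b * (p a b′ * perm p as′ bs′))
                    ≡⟨ ∑-distribˡ-* (picks bs) (p a′ b) _ ⟩
                  p a′ b * perm p (a ∷ as′) bs
                    ≡⟨ cong (p a′ b *_) (go n (a ∷ as′) bs (ℕₚ.≤-trans (ℕₚ.≤-reflexive len) as≤n)) ⟩
                  p a′ b * perm (flip p) bs (a ∷ as′) ∎) (picks-length as)) ⟩
            ∑ (picks as) (λ (a′ , as′) → p a′ b * perm (flip p) bs (a ∷ as′))
              ≡⟨ ∑-map (map₂ (a ∷_)) (picks as) _ ⟨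
            ∑ (map (map₂ (a ∷_)) (picks as)) (λ (a′ , as′) → p a′ b * perm (flip p) bs as′) ∎) ⟩
        perm (flip p) (b ∷ bs) (a ∷ as) ∎
        where as≤n = ℕₚ.≤-pred eq

    lengthℚ : List A → ℚ
    lengthℚ xs = ∑ xs (λ _ → 1ℚ)

    lengthℚ-cong : (xs : List A) (ys : List B) → length xs ≡ length ys → lengthℚ xs ≡ lengthℚ ys
    lengthℚ-cong [] [] eq = refl
    lengthℚ-cong (_ ∷ xs) (_ ∷ ys) eq = cong (1ℚ +_) (lengthℚ-cong xs ys (ℕₚ.suc-injective eq))

    -- The expansion along each row gives the permanent once. For a row below the first, the minors
    -- are expanded along the first row and the two picks of columns are exchanged.
    laplace : ∀ (p : A → B → ℚ) as bs →
      ∑ (picks as) (λ (a , as′) → ∑ (picks bs) λ (b , bs′) → p a b * perm p as′ bs′)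
        ≡ lengthℚ as * perm p as bs
    laplace p []       bs = sym (ℚₚ.*-zeroˡ (perm p [] bs))
    laplace p (a ∷ as) bs = begin
      perm p (a ∷ as) bs + ∑ (map (map₂ (a ∷_)) (picks as)) expand
        ≡⟨ cong₂ _+_ (sym (ℚₚ.*-identityˡ (perm p (a ∷ as) bs))) (begin
          ∑ (map (map₂ (a ∷_)) (picks as)) expand
            ≡⟨ ∑-map (map₂ (a ∷_)) (picks as) expand ⟩
          ∑ (picks as) (λ (a′ , as′) → ∑ (picks bs) λ (b , bs′) → p a′ b * perm p (a ∷ as′) bs′)
            ≡⟨ ∑-cong (picks as) (λ (a′ , as′) → trans
                 (∑-cong (picks bs) (λ (b , bs′) → sym (∑-distribˡ-* (picks bs′) (p a′ b) _)))
                 (∑-picks-picks bs (λ b b′ r → p a′ b * (p a b′ * perm p as′ r)))) ⟩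
          ∑ (picks as) (λ (a′ , as′) → ∑ (picks bs) λ (b , bs′) → ∑ (picks bs′) λ (b′ , bs″) →
            p a′ b′ * (p a b * perm p as′ bs″))
            ≡⟨ ∑-swap (picks as) (picks bs) _ ⟩
          ∑ (picks bs) (λ (b , bs′) → ∑ (picks as) λ (a′ , as′) → ∑ (picks bs′) λ (b′ , bs″) →
            p a′ b′ * (p a b * perm p as′ bs″))
            ≡⟨ ∑-cong (picks bs) (λ (b , bs′) → begin
              ∑ (picks as) (λ (a′ , as′) → ∑ (picks bs′) λ (b′ , bs″) →
                p a′ b′ * (p a b * perm p as′ bs″))
                ≡⟨ ∑-cong (picks as) (λ (a′ , as′) → trans
                     (∑-cong (picks bs′) (λ (b′ , bs″) → *-swap (p a′ b′) (p a b) _))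
                     (∑-distribˡ-* (picks bs′) (p a b) _)) ⟩
              ∑ (picks as) (λ (a′ , as′) → p a b * ∑ (picks bs′) (λ (b′ , bs″) →
                p a′ b′ * perm p as′ bs″))
                ≡⟨ ∑-distribˡ-* (picks as) (p a b) _ ⟩
              p a b * ∑ (picks as) (λ (a′ , as′) → ∑ (picks bs′) (λ (b′ , bs″) →
                p a′ b′ * perm p as′ bs″))
                ≡⟨ cong (p a b *_) (laplace p as bs′) ⟩
              p a b * (lengthℚ as * perm p as bs′)
                ≡⟨ *-swap (p a b) (lengthℚ as) _ ⟩
              lengthℚ as * (p a b * perm p as bs′) ∎) ⟩
          ∑ (picks bs) (λ (b , bs′) → lengthℚ as * (p a b * perm p as bs′))
            ≡⟨ ∑-distribˡ-* (picks bs) (lengthℚ as) _ ⟩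
          lengthℚ as * perm p (a ∷ as) bs ∎) ⟩
      1ℚ * perm p (a ∷ as) bs + lengthℚ as * perm p (a ∷ as) bs
        ≡⟨ ℚₚ.*-distribʳ-+ (perm p (a ∷ as) bs) 1ℚ (lengthℚ as) ⟨
      (1ℚ + lengthℚ as) * perm p (a ∷ as) bs ∎
      where expand = λ (a , as′) → ∑ (picks bs) λ (b , bs′) → p a b * perm p as′ bs′

    ∑words : List C → ℕ → (List C → ℚ) → ℚ
    ∑words zs zero    f = f []
    ∑words zs (suc m) f = ∑ zs λ z → ∑words zs m (f ∘ (z ∷_))

    -- The factor m + 1 has the form of a `lengthℚ`, to be matched with the number of rows in
    -- `laplace`.
    factorial : ℕ → ℚ
    factorial zero    = 1ℚ
    factorial (suc m) = lengthℚ (tabulate {n = suc m} id) * factorial m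

    ∑words-cong : ∀ (zs : List C) m {f g : List C → ℚ} → (∀ w → f w ≡ g w) →
      ∑words zs m f ≡ ∑words zs m g
    ∑words-cong zs zero    f≗g = f≗g []
    ∑words-cong zs (suc m) f≗g = ∑-cong zs (λ z → ∑words-cong zs m (f≗g ∘ (z ∷_)))

    ∑words-∑ : ∀ (zs : List C) m (xs : List A) (f : A → List C → ℚ) →
      ∑words zs m (λ w → ∑ xs (λ x → f x w)) ≡ ∑ xs (λ x → ∑words zs m (f x))
    ∑words-∑ zs zero    xs f = refl
    ∑words-∑ zs (suc m) xs f = trans (∑-cong zs (λ z → ∑words-∑ zs m xs (λ x w → f x (z ∷ w))))
      (∑-swap zs xs _)

    ∑words-distribˡ-* : ∀ (zs : List C) m c (f : List C → ℚ) →
      ∑words zs m (λ w → c * f w) ≡ c * ∑words zs m f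
    ∑words-distribˡ-* zs zero    c f = refl
    ∑words-distribˡ-* zs (suc m) c f =
      trans (∑-cong zs (λ z → ∑words-distribˡ-* zs m c (f ∘ (z ∷_)))) (∑-distribˡ-* zs c _)

    -- For permanents the formula runs over multisets, weighted by inverse factorials of the
    -- multiplicities; a sum over all words absorbs these weights and yields m! instead. The
    -- induction removes the first letter, which meets an arbitrary row and an arbitrary column,
    -- whence `laplace`.
    cauchy-binet : ∀ (zs : List C) (u : C → A → ℚ) (v : C → B → ℚ) m as bs → length as ≡ m →
      ∑words zs m (λ w → perm u w as * perm v w bs)
        ≡ factorial m * perm (λ a b → ∑ zs (λ z → u z a * v z b)) as bs
    cauchy-binet zs u v zero    []       []      eq = refl
    cauchy-binet zs u v zero    []       (_ ∷ _) eq = refl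
    cauchy-binet zs u v (suc m) as bs eq = begin
      ∑ zs (λ z → ∑words zs m λ w →
          ∑ (picks as) (λ (a , as′) → u z a * perm u w as′) *
          ∑ (picks bs) (λ (b , bs′) → v z b * perm v w bs′))
        ≡⟨ ∑-cong zs (λ z → begin
          (∑words zs m λ w →
            ∑ (picks as) (λ (a , as′) → u z a * perm u w as′) *
            ∑ (picks bs) (λ (b , bs′) → v z b * perm v w bs′))
            ≡⟨ ∑words-cong zs m (λ w → trans (∑-×-∑ (picks as) (picks bs) _ _)
                 (∑-cong (picks as) λ (a , as′) → ∑-cong (picks bs) λ (b , bs′) →
                   *-interchange (u z a) (perm u w as′) (v z b) (perm v w bs′))) ⟩
          (∑words zs m λ w → ∑ (picks as) λ (a , as′) → ∑ (picks bs) λ (b , bs′) →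
            (u z a * v z b) * (perm u w as′ * perm v w bs′))
            ≡⟨ trans (∑words-∑ zs m (picks as) _)
                 (∑-cong (picks as) λ (a , as′) → trans (∑words-∑ zs m (picks bs) _)
                   (∑-cong (picks bs) λ (b , bs′) → ∑words-distribˡ-* zs m (u z a * v z b) _)) ⟩
          (∑ (picks as) λ (a , as′) → ∑ (picks bs) λ (b , bs′) →
            (u z a * v z b) * ∑words zs m (λ w → perm u w as′ * perm v w bs′)) ∎) ⟩
      ∑ zs (λ z → ∑ (picks as) λ (a , as′) → ∑ (picks bs) λ (b , bs′) →
        (u z a * v z b) * ∑words zs m (λ w → perm u w as′ * perm v w bs′))
        ≡⟨ trans (∑-swap zs (picks as) _) (∑-cong (picks as) λ (a , as′) →
             trans (∑-swap zs (picks bs) _) (∑-cong (picks bs) λ (b , bs′) →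
               ∑-distribʳ-* zs (∑words zs m (λ w → perm u w as′ * perm v w bs′)) _)) ⟩
      (∑ (picks as) λ (a , as′) → ∑ (picks bs) λ (b , bs′) →
        uv a b * ∑words zs m (λ w → perm u w as′ * perm v w bs′))
        ≡⟨ ∑-congᴬ (All.map (λ {(a , as′)} len → trans (∑-cong (picks bs) λ (b , bs′) → begin
             uv a b * ∑words zs m (λ w → perm u w as′ * perm v w bs′)
               ≡⟨ cong (uv a b *_)
                    (cauchy-binet zs u v m as′ bs′ (ℕₚ.suc-injective (trans len eq))) ⟩
             uv a b * (factorial m * perm uv as′ bs′)
               ≡⟨ *-swap (uv a b) (factorial m) _ ⟩
             factorial m * (uv a b * perm uv as′ bs′) ∎)
             (∑-distribˡ-* (picks bs) (factorial m) _)) (picks-length as)) ⟩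
      ∑ (picks as) (λ (a , as′) → factorial m * ∑ (picks bs) λ (b , bs′) → uv a b * perm uv as′ bs′)
        ≡⟨ ∑-distribˡ-* (picks as) (factorial m) _ ⟩
      factorial m * (∑ (picks as) λ (a , as′) → ∑ (picks bs) λ (b , bs′) → uv a b * perm uv as′ bs′)
        ≡⟨ cong (factorial m *_) (laplace uv as bs) ⟩
      factorial m * (lengthℚ as * perm uv as bs)
        ≡⟨ cong (λ s → factorial m * (s * perm uv as bs)) (lengthℚ-cong as (tabulate {n = suc m} id)
             (trans eq (sym (Listₚ.length-tabulate {n = suc m} id)))) ⟩
      factorial m * (lengthℚ (tabulate {n = suc m} id) * perm uv as bs)
        ≡⟨ *-swap (factorial m) (lengthℚ (tabulate {n = suc m} id)) _ ⟩
      lengthℚ (tabulate {n = suc m} id) * (factorial m * perm uv as bs)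
        ≡⟨ ℚₚ.*-assoc (lengthℚ (tabulate {n = suc m} id)) (factorial m) _ ⟨
      factorial (suc m) * perm uv as bs ∎
      where
      uv : _ → _ → ℚ
      uv a b = ∑ zs (λ z → u z a * v z b)
      *-interchange : ∀ a b c d → (a * b) * (c * d) ≡ (a * c) * (b * d)
      *-interchange = solve 4 (λ a b c d → (a :* b) :* (c :* d) := (a :* c) :* (b :* d)) refl
        where open ℚSolver.+-*-Solver

  -- The permanent of the Gram matrix of the edges

  picks-All : ∀ {P : A → Set} {xs} → All P xs → All (λ p → P (proj₁ p) × All P (proj₂ p)) (picks xs)
  picks-All []         = []
  picks-All (px ∷ pxs) = (px , pxs) ∷ Allₚ.map⁺ (All.map (map₂ (px ∷_)) (picks-All pxs))

  picks-∑ : ∀ (h : A → ℕ) xs →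
    All (λ p → ℕΣ.∑ xs h ≡ h (proj₁ p) ℕ.+ ℕΣ.∑ (proj₂ p) h) (picks xs)
  picks-∑ h []       = []
  picks-∑ h (x ∷ xs) = refl ∷ Allₚ.map⁺ (All.map (λ {(y , ys)} eq →
      trans (cong (h x ℕ.+_) eq) (swap (h x) (h y) (ℕΣ.∑ ys h))) (picks-∑ h xs))
    where
    swap : ∀ a b c → a ℕ.+ (b ℕ.+ c) ≡ b ℕ.+ (a ℕ.+ c)
    swap a b c = trans (sym (ℕₚ.+-assoc a b c)) (trans (cong (ℕ._+ c) (ℕₚ.+-comm a b)) (ℕₚ.+-assoc b a c))

  ∑-nonNeg : ∀ {xs : List A} {f : A → ℚ} → All (λ x → 0ℚ ≤ f x) xs → 0ℚ ≤ ∑ xs f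
  ∑-nonNeg []       = ℚₚ.≤-refl
  ∑-nonNeg (p ∷ ps) = ℚₚ.+-mono-≤ p (∑-nonNeg ps)

  p≤p+q : ∀ {p q} → 0ℚ ≤ q → p ≤ p + q
  p≤p+q {p} {q} 0≤q = subst (_≤ p + q) (ℚₚ.+-identityʳ p) (ℚₚ.+-monoʳ-≤ p 0≤q)

  p≤q+p : ∀ {p q} → 0ℚ ≤ q → p ≤ q + p
  p≤q+p {p} {q} 0≤q = subst (p ≤_) (ℚₚ.+-comm p q) (p≤p+q 0≤q)

  ∑-∈-≤ : ∀ {x : A} {xs} (f : A → ℚ) → (∀ x → 0ℚ ≤ f x) → x L.∈ xs → f x ≤ ∑ xs f
  ∑-∈-≤ {xs = _ ∷ xs} f 0≤f (here refl) = p≤p+q (∑-nonNeg (All.universal 0≤f xs))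
  ∑-∈-≤ {xs = y ∷ xs} f 0≤f (there x∈)  = ℚₚ.≤-trans (∑-∈-≤ f 0≤f x∈) (p≤q+p (0≤f y))

  ∑words-nonNeg : ∀ (zs : List C) m {f : List C → ℚ} → (∀ w → 0ℚ ≤ f w) → 0ℚ ≤ ∑words zs m f
  ∑words-nonNeg zs zero    0≤f = 0≤f []
  ∑words-nonNeg zs (suc m) 0≤f = ∑-nonNeg (All.universal (λ z → ∑words-nonNeg zs m (0≤f ∘ (z ∷_))) zs)

  ∑words-≥ : ∀ (zs : List C) {f : List C → ℚ} → (∀ w → 0ℚ ≤ f w) →
    ∀ {w} → All (L._∈ zs) w → f w ≤ ∑words zs (length w) f
  ∑words-≥ zs     0≤f []                   = ℚₚ.≤-refl
  ∑words-≥ zs {f} 0≤f {z ∷ w} (z∈zs ∷ w⊆zs) = ℚₚ.≤-trans (∑words-≥ zs (0≤f ∘ (z ∷_)) w⊆zs)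
    (∑-∈-≤ (λ z → ∑words zs (length w) (f ∘ (z ∷_)))
      (λ z → ∑words-nonNeg zs (length w) (0≤f ∘ (z ∷_))) z∈zs)

  0≤p² : ∀ p → 0ℚ ≤ p * p
  0≤p² p with ℚₚ.≤-total 0ℚ p
  ... | inj₁ 0≤p = subst (_≤ p * p) (ℚₚ.*-zeroˡ p)
    (ℚₚ.*-monoʳ-≤-nonNeg p {{ℚ.nonNegative 0≤p}} 0≤p)
  ... | inj₂ p≤0 = subst (_≤ p * p) (ℚₚ.*-zeroˡ p)
    (ℚₚ.*-monoʳ-≤-nonPos p {{ℚ.nonPositive p≤0}} p≤0)

  module _ {n : ℕ} where

    Pair = Fin n × Fin n

    boundary : Fin n → Pair → ℚ
    boundary z (u , v) = δ z u - δ z v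

    gram : Pair → Pair → ℚ
    gram e f = ∑ (allFin n) λ z → boundary z e * boundary z f

    Ordered : Pair → Set
    Ordered (u , v) = u Fin.< v

    private
      boundary-≢ : ∀ {z u v} → z ≢ u → z ≢ v → boundary z (u , v) ≡ 0ℚ
      boundary-≢ {z} {u} {v} z≢u z≢v = cong₂ _-_ (δ-≢ {i = z} {u} z≢u) (δ-≢ {i = z} {v} z≢v)

      boundary-fst : ∀ {u v} → u Fin.< v → boundary u (u , v) ≡ 1ℚ
      boundary-fst {u} {v} u<v = cong₂ _-_ (δ-refl u) (δ-≢ {i = u} {v} λ {refl → ℕₚ.<-irrefl refl u<v})

      cancel-< : ∀ {a b c d} → a ℕ.+ b ℕ.< c ℕ.+ d → c ℕ.≤ a → b ℕ.< d
      cancel-< {a} {b} {c} {d} lt c≤a = ℕₚ.+-cancelˡ-< c b d (ℕₚ.≤-<-trans (ℕₚ.+-monoˡ-≤ b c≤a) lt)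

      cancel-≤ : ∀ {a b c d} → a ℕ.+ b ≡ c ℕ.+ d → c ℕ.< a → b ℕ.< d
      cancel-≤ {a} {b} {c} {d} eq c<a = ℕₚ.+-cancelˡ-< c b d
        (ℕₚ.<-≤-trans (ℕₚ.+-monoˡ-< b c<a) (ℕₚ.≤-reflexive eq))

    -- In a non-zero term every letter is an end of the edge it is matched with, hence at least its
    -- smaller end; the letters would then sum to at least the sum of the smaller ends.
    perm-boundary-< : ∀ w fs → All Ordered fs → ℕΣ.∑ w toℕ ℕ.< ℕΣ.∑ fs (toℕ ∘ proj₁) →
      perm boundary w fs ≡ 0ℚ
    perm-boundary-< []      (f ∷ fs) ord lt = refl
    perm-boundary-< (z ∷ w) fs       ord lt = ∑-zero (All.zipWith step (picks-All ord , picks-∑ _ fs))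
      where
      step : ∀ {p} → (Ordered (proj₁ p) × All Ordered (proj₂ p)) ×
          ℕΣ.∑ fs (toℕ ∘ proj₁) ≡ toℕ (proj₁ (proj₁ p)) ℕ.+ ℕΣ.∑ (proj₂ p) (toℕ ∘ proj₁) →
        boundary z (proj₁ p) * perm boundary w (proj₂ p) ≡ 0ℚ
      step {(u , v) , fs′} ((u<v , ord′) , eq) = by-cases (toℕ u ℕₚ.≤? toℕ z)
        where
        by-cases : Dec (toℕ u ℕ.≤ toℕ z) → boundary z (u , v) * perm boundary w fs′ ≡ 0ℚ
        by-cases (yes u≤z) = trans (cong (boundary z (u , v) *_) (perm-boundary-< w fs′ ord′
          (cancel-< (subst (_ ℕ.<_) eq lt) u≤z))) (ℚₚ.*-zeroʳ (boundary z (u , v)))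
        by-cases (no  u≰z) = trans (cong (_* perm boundary w fs′) (boundary-≢ {z} {u} {v}
          (λ {refl → u≰z ℕₚ.≤-refl}) (λ {refl → u≰z (ℕₚ.<⇒≤ u<v)}))) (ℚₚ.*-zeroˡ (perm boundary w fs′))

    -- If the two sums agree, every letter of a non-zero term is the smaller end of its edge, where
    -- the boundary is 1. So no term is negative.
    perm-boundary-≡ : ∀ w fs → All Ordered fs → ℕΣ.∑ w toℕ ≡ ℕΣ.∑ fs (toℕ ∘ proj₁) →
      0ℚ ≤ perm boundary w fs
    perm-boundary-≡ []      []       ord eq = ℚₚ.nonNegative⁻¹ 1ℚ
    perm-boundary-≡ []      (_ ∷ _)  ord eq = ℚₚ.≤-refl
    perm-boundary-≡ (z ∷ w) fs       ord eq = ∑-nonNeg (All.zipWith step (picks-All ord , picks-∑ _ fs))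
      where
      step : ∀ {p} → (Ordered (proj₁ p) × All Ordered (proj₂ p)) ×
          ℕΣ.∑ fs (toℕ ∘ proj₁) ≡ toℕ (proj₁ (proj₁ p)) ℕ.+ ℕΣ.∑ (proj₂ p) (toℕ ∘ proj₁) →
        0ℚ ≤ boundary z (proj₁ p) * perm boundary w (proj₂ p)
      step {(u , v) , fs′} ((u<v , ord′) , eq′) = by-cases (z Fin.≟ u) (toℕ u ℕₚ.≤? toℕ z)
        where
        by-cases : Dec (z ≡ u) → Dec (toℕ u ℕ.≤ toℕ z) → 0ℚ ≤ boundary z (u , v) * perm boundary w fs′
        by-cases (yes refl) _ = subst (0ℚ ≤_)
          (sym (trans (cong (_* perm boundary w fs′) (boundary-fst u<v)) (ℚₚ.*-identityˡ _)))
          (perm-boundary-≡ w fs′ ord′ (ℕₚ.+-cancelˡ-≡ (toℕ u) _ _ (trans eq eq′)))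
        by-cases (no z≢u) (yes u≤z) = ℚₚ.≤-reflexive (sym (trans (cong (boundary z (u , v) *_)
          (perm-boundary-< w fs′ ord′ (cancel-≤ (trans eq eq′) (ℕₚ.≤∧≢⇒< u≤z λ u≡z →
            z≢u (sym (Finₚ.toℕ-injective u≡z)))))) (ℚₚ.*-zeroʳ (boundary z (u , v)))))
        by-cases (no z≢u) (no u≰z) = ℚₚ.≤-reflexive (sym (trans (cong (_* perm boundary w fs′)
          (boundary-≢ {z} {u} {v} z≢u (λ {refl → u≰z (ℕₚ.<⇒≤ u<v)}))) (ℚₚ.*-zeroˡ (perm boundary w fs′))))

    -- Matching each edge with its own smaller end contributes 1. The word of smaller ends has
    -- exactly the critical sum, so nothing negative is added.
    perm-boundary-fst : ∀ fs → All Ordered fs → 1ℚ ≤ perm boundary (map proj₁ fs) fs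
    perm-boundary-fst []             []          = ℚₚ.≤-refl
    perm-boundary-fst ((u , v) ∷ fs) (u<v ∷ ord) = ℚₚ.≤-trans
      (subst (1ℚ ≤_) (sym (trans (cong (_* perm boundary w fs) (boundary-fst u<v)) (ℚₚ.*-identityˡ _)))
        (perm-boundary-fst fs ord))
      (p≤p+q (∑-nonNeg (Allₚ.map⁺ (All.zipWith step (picks-All ord , picks-∑ (toℕ ∘ proj₁) fs)))))
      where
      w = map proj₁ fs
      step : ∀ {p} → (Ordered (proj₁ p) × All Ordered (proj₂ p)) ×
          ℕΣ.∑ fs (toℕ ∘ proj₁) ≡ toℕ (proj₁ (proj₁ p)) ℕ.+ ℕΣ.∑ (proj₂ p) (toℕ ∘ proj₁) →
        0ℚ ≤ boundary u (proj₁ p) * perm boundary w ((u , v) ∷ proj₂ p)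
      step {(u′ , v′) , fs′} ((u′<v′ , ord′) , eq) = by-cases (u Fin.≟ u′) (toℕ u′ ℕₚ.≤? toℕ u)
        where
        ∑w : ℕΣ.∑ w toℕ ≡ toℕ u′ ℕ.+ ℕΣ.∑ fs′ (toℕ ∘ proj₁)
        ∑w = trans (ℕΣ.∑-map proj₁ fs toℕ) eq
        by-cases : Dec (u ≡ u′) → Dec (toℕ u′ ℕ.≤ toℕ u) →
          0ℚ ≤ boundary u (u′ , v′) * perm boundary w ((u , v) ∷ fs′)
        by-cases (yes refl) _ = subst (0ℚ ≤_)
          (sym (trans (cong (_* perm boundary w ((u , v) ∷ fs′)) (boundary-fst u′<v′)) (ℚₚ.*-identityˡ _)))
          (perm-boundary-≡ w ((u , v) ∷ fs′) (u<v ∷ ord′) ∑w)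
        by-cases (no u≢u′) (yes u′≤u) = ℚₚ.≤-reflexive (sym (trans (cong (boundary u (u′ , v′) *_)
          (perm-boundary-< w ((u , v) ∷ fs′) (u<v ∷ ord′) (subst (ℕ._< toℕ u ℕ.+ ℕΣ.∑ fs′ (toℕ ∘ proj₁)) (sym ∑w)
            (ℕₚ.+-monoˡ-< _ (ℕₚ.≤∧≢⇒< u′≤u λ u′≡u → u≢u′ (sym (Finₚ.toℕ-injective u′≡u)))))))
          (ℚₚ.*-zeroʳ (boundary u (u′ , v′)))))
        by-cases (no u≢u′) (no u′≰u) = ℚₚ.≤-reflexive (sym (trans (cong (_* perm boundary w ((u , v) ∷ fs′))
          (boundary-≢ {u} {u′} {v′} u≢u′ (λ {refl → u′≰u (ℕₚ.<⇒≤ u′<v′)}))) (ℚₚ.*-zeroˡ (perm boundary w ((u , v) ∷ fs′)))))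

    perm-gram-≢0 : ∀ fs → All Ordered fs → perm gram fs fs ≢ 0ℚ
    perm-gram-≢0 fs ord eq = ℚₚ.<-irrefl refl (ℚₚ.<-≤-trans (ℚₚ.positive⁻¹ 1ℚ) (begin
      1ℚ                                 ≤⟨ 1≤p ⟩
      perm boundary w fs                 ≡⟨ ℚₚ.*-identityˡ (perm boundary w fs) ⟨
      1ℚ * perm boundary w fs            ≤⟨ ℚₚ.*-monoʳ-≤-nonNeg (perm boundary w fs)
                                             {{ℚ.nonNegative (ℚₚ.≤-trans (ℚₚ.nonNegative⁻¹ 1ℚ) 1≤p)}} 1≤p ⟩
      perm boundary w fs * perm boundary w fs
        ≤⟨ ∑words-≥ (allFin n) {λ w → perm boundary w fs * perm boundary w fs}
             (λ w → 0≤p² (perm boundary w fs)) (All.universal Lₚ.∈-allFin w) ⟩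
      ∑words (allFin n) (length w) (λ w → perm boundary w fs * perm boundary w fs)
        ≡⟨ cauchy-binet (allFin n) boundary boundary (length w) fs fs (sym (Listₚ.length-map proj₁ fs)) ⟩
      factorial (length w) * perm gram fs fs  ≡⟨ cong (factorial (length w) *_) eq ⟩
      factorial (length w) * 0ℚ               ≡⟨ ℚₚ.*-zeroʳ (factorial (length w)) ⟩
      0ℚ                                 ∎))
      where
      open ℚₚ.≤-Reasoning
      w = map proj₁ fs
      1≤p = perm-boundary-fst fs ord

  -- Permanents whose rows are differences

  ∑-≢0 : ∀ (xs : List A) {P : A → Set} {f : A → ℚ} → All P xs → ∑ xs f ≢ 0ℚ → ∃ λ x → P x × f x ≢ 0ℚ
  ∑-≢0 []       ps ≢0 = contradiction refl ≢0
  ∑-≢0 (x ∷ xs) {f = f} (p ∷ ps) ≢0 with f x ℚ.≟ 0ℚ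
  ... | no  fx≢0 = x , p , fx≢0
  ... | yes fx≡0 = ∑-≢0 xs ps λ ∑≡0 → ≢0 (cong₂ _+_ fx≡0 ∑≡0)

  module _ (p : A → B → ℚ) (g h : C → A) where

    private
      choices : List C → List (ℚ × List A)
      choices []       = (1ℚ , []) ∷ []
      choices (t ∷ ts) = map (λ (s , as) → s , g t ∷ as) (choices ts)
                      ++ map (λ (s , as) → - s , h t ∷ as) (choices ts)

      Choice : A → C → Set
      Choice a t = a ≡ g t ⊎ a ≡ h t

      choices-Choice : ∀ ts → All (λ c → Pointwise Choice (proj₂ c) ts) (choices ts)
      choices-Choice []       = [] ∷ []
      choices-Choice (t ∷ ts) = Allₚ.++⁺
        (Allₚ.map⁺ (All.map (inj₁ refl ∷_) (choices-Choice ts)))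
        (Allₚ.map⁺ (All.map (inj₂ refl ∷_) (choices-Choice ts)))

      q : C → B → ℚ
      q t b = p (g t) b - p (h t) b

      term : List B → ℚ × List A → ℚ
      term bs (s , as) = s * perm p as bs

      open ≡-Reasoning

      perm-choices : ∀ ts bs → perm q ts bs ≡ ∑ (choices ts) (term bs)
      perm-choices []       []       = refl
      perm-choices []       (_ ∷ _)  = refl
      perm-choices (t ∷ ts) bs = begin
        ∑ (picks bs) (λ (b , bs′) → q t b * perm q ts bs′)
          ≡⟨ ∑-cong (picks bs) (λ (b , bs′) → begin
            q t b * perm q ts bs′  ≡⟨ cong (q t b *_) (perm-choices ts bs′) ⟩
            q t b * ∑ (choices ts) (term bs′)  ≡⟨ ∑-distribˡ-* (choices ts) (q t b) (term bs′) ⟨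
            ∑ (choices ts) (λ c → q t b * term bs′ c)
              ≡⟨ ∑-cong (choices ts) (λ (s , as) → split (p (g t) b) (p (h t) b) s (perm p as bs′)) ⟩
            ∑ (choices ts) (λ (s , as) → s * (p (g t) b * perm p as bs′) + - s * (p (h t) b * perm p as bs′))
              ∎) ⟩
        ∑ (picks bs) (λ (b , bs′) → ∑ (choices ts) λ (s , as) →
          s * (p (g t) b * perm p as bs′) + - s * (p (h t) b * perm p as bs′))
          ≡⟨ ∑-swap (picks bs) (choices ts) _ ⟩
        ∑ (choices ts) (λ (s , as) → ∑ (picks bs) λ (b , bs′) →
          s * (p (g t) b * perm p as bs′) + - s * (p (h t) b * perm p as bs′))
          ≡⟨ ∑-cong (choices ts) (λ (s , as) → trans (∑-distrib-+ (picks bs) _ _)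
               (cong₂ _+_ (∑-distribˡ-* (picks bs) s _) (∑-distribˡ-* (picks bs) (- s) _))) ⟩
        ∑ (choices ts) (λ (s , as) → s * perm p (g t ∷ as) bs + - s * perm p (h t ∷ as) bs)
          ≡⟨ ∑-distrib-+ (choices ts) _ _ ⟩
        ∑ (choices ts) (λ (s , as) → s * perm p (g t ∷ as) bs) +
        ∑ (choices ts) (λ (s , as) → - s * perm p (h t ∷ as) bs)
          ≡⟨ cong₂ _+_ (∑-map _ (choices ts) (term bs)) (∑-map _ (choices ts) (term bs)) ⟨
        ∑ (map (λ (s , as) → s , g t ∷ as) (choices ts)) (term bs) +
        ∑ (map (λ (s , as) → - s , h t ∷ as) (choices ts)) (term bs)
          ≡⟨ ∑-++ (map (λ (s , as) → s , g t ∷ as) (choices ts)) _ (term bs) ⟨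
        ∑ (choices (t ∷ ts)) (term bs) ∎
        where
        split : ∀ x y s z → (x - y) * (s * z) ≡ s * (x * z) + - s * (y * z)
        split = solve 4 (λ x y s z → (x :- y) :* (s :* z) := s :* (x :* z) :+ (:- s) :* (y :* z)) refl
          where open ℚSolver.+-*-Solver

    -- By linearity in each row the permanent is a signed sum over all choices of one of the two
    -- rows for every `t`, so some choice has a non-zero permanent.
    perm-choose : ∀ ts bs → perm (λ t b → p (g t) b - p (h t) b) ts bs ≢ 0ℚ →
      ∃ λ as → Pointwise (λ a t → a ≡ g t ⊎ a ≡ h t) as ts × perm p as bs ≢ 0ℚ
    perm-choose ts bs ≢0
      with (s , as) , ch , nz ← ∑-≢0 (choices ts) (choices-Choice ts) (≢0 ∘ trans (perm-choices ts bs))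
      = as , ch , λ eq → nz (trans (cong (s *_) eq) (ℚₚ.*-zeroʳ s))

  -- Divided differences

  ι : ℕ → ℚ
  ι zero    = 0ℚ
  ι (suc k) = 1ℚ + ι k

  Points : Set
  Points = Fin 4 → ℚ

  pattern 0F = zero
  pattern 1F = suc zero
  pattern 2F = suc (suc zero)
  pattern 3F = suc (suc (suc zero))

  node : Points → ℕ → ℚ
  node a 0 = a 0F
  node a 1 = a 1F
  node a 2 = a 2F
  node a _ = a 3F

  -- The k-th Newton polynomial at the k-th node. It is the ratio of consecutive Vandermonde
  -- determinants, and the product `newton!` is the determinant itself.
  newton : Points → ℕ → ℚ
  newton a 1 = a 1F - a 0F
  newton a 2 = (a 2F - a 0F) * (a 2F - a 1F)
  newton a 3 = (a 3F - a 0F) * ((a 3F - a 1F) * (a 3F - a 2F))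
  -- This covers order 0 as well; in `diff-*` that value is multiplied by `ι 0`.
  newton a _ = 0ℚ

  -- diff a k is k! times the divided difference at a 0F, …, up to the k-th node,
  -- cleared of denominators; with this scaling the Leibniz rule diff-* needs no
  -- division.  Orders above 3 do not occur, and weight and newton are 0 there.
  weight : Points → ℕ → Fin 4 → ℚ
  weight a 0 0F = 1ℚ
  weight a 1 0F = - 1ℚ
  weight a 1 1F = 1ℚ
  weight a 2 0F = ι 2 * (a 2F - a 1F)
  weight a 2 1F = ι 2 * (a 0F - a 2F)
  weight a 2 2F = ι 2 * (a 1F - a 0F)
  weight a 3 0F = ι 6 * ((a 3F - a 1F) * ((a 3F - a 2F) * (a 1F - a 2F)))
  weight a 3 1F = ι 6 * ((a 3F - a 0F) * ((a 3F - a 2F) * (a 2F - a 0F)))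
  weight a 3 2F = ι 6 * ((a 3F - a 0F) * ((a 3F - a 1F) * (a 0F - a 1F)))
  weight a 3 3F = ι 6 * ((a 1F - a 0F) * ((a 2F - a 0F) * (a 2F - a 1F)))
  weight a _ _  = 0ℚ

  diff : Points → ℕ → (Fin 4 → ℚ) → ℚ
  diff a k h = ∑ (allFin 4) λ t → weight a k t * h t

  module _ where
    open ℚSolver.+-*-Solver

    private
      Diff : ∀ {n} → (w h : Fin 4 → Polynomial n) → Polynomial n
      Diff w h = w 0F :* h 0F :+ (w 1F :* h 1F :+ (w 2F :* h 2F :+ (w 3F :* h 3F :+ con 0ℚ)))
      vec4 : ∀ {n} → (a b c d : Polynomial n) → Fin 4 → Polynomial n
      vec4 a b c d 0F = a
      vec4 a b c d 1F = b
      vec4 a b c d 2F = c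
      vec4 a b c d 3F = d
      :ι : ∀ {n} → ℕ → Polynomial n
      :ι zero = con 0ℚ
      :ι (suc k) = con 1ℚ :+ :ι k
      :0 : ∀ {n} → Polynomial n
      :0 = con 0ℚ
      :1 : ∀ {n} → Polynomial n
      :1 = con 1ℚ
      :weight : ∀ {n} → ℕ → (a b c d : Polynomial n) → Fin 4 → Polynomial n
      :weight 0 a b c d = vec4 :1 :0 :0 :0
      :weight 1 a b c d = vec4 (:- :1) :1 :0 :0
      :weight 2 a b c d = vec4 (:ι 2 :* (c :- b)) (:ι 2 :* (a :- c)) (:ι 2 :* (b :- a)) :0
      :weight 3 a b c d = vec4 (:ι 6 :* ((d :- b) :* ((d :- c) :* (b :- c))))
        (:ι 6 :* ((d :- a) :* ((d :- c) :* (c :- a)))) (:ι 6 :* ((d :- a) :* ((d :- b) :* (a :- b))))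
        (:ι 6 :* ((b :- a) :* ((c :- a) :* (c :- b))))
      :weight _ a b c d _ = :0

    -- The Leibniz rule (x f)[x₀,...,xₖ] = f[x₀,...,xₖ₋₁] + xₖ f[x₀,...,xₖ]. The scaling is by k!
    -- times the Vandermonde determinant of the nodes, and from order k - 1 to order k it grows by
    -- the factor k times `newton a k`.
    diff-* : ∀ a k h → diff a k (λ t → a t * h t) ≡
      ι k * newton a k * diff a (ℕ.pred k) h + node a k * diff a k h
    diff-* a 0 h = solve 8 (λ a b c d x y z w →
      Diff (:weight 0 a b c d) (vec4 (a :* x) (b :* y) (c :* z) (d :* w)) :=
      :ι 0 :* :0 :* Diff (:weight 0 a b c d) (vec4 x y z w) :+ a :* Diff (:weight 0 a b c d) (vec4 x y z w))
      refl (a 0F) (a 1F) (a 2F) (a 3F) (h 0F) (h 1F) (h 2F) (h 3F)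
    diff-* a 1 h = solve 8 (λ a b c d x y z w →
      Diff (:weight 1 a b c d) (vec4 (a :* x) (b :* y) (c :* z) (d :* w)) :=
      :ι 1 :* (b :- a) :* Diff (:weight 0 a b c d) (vec4 x y z w) :+ b :* Diff (:weight 1 a b c d) (vec4 x y z w))
      refl (a 0F) (a 1F) (a 2F) (a 3F) (h 0F) (h 1F) (h 2F) (h 3F)
    diff-* a 2 h = solve 8 (λ a b c d x y z w →
      Diff (:weight 2 a b c d) (vec4 (a :* x) (b :* y) (c :* z) (d :* w)) :=
      :ι 2 :* ((c :- a) :* (c :- b)) :* Diff (:weight 1 a b c d) (vec4 x y z w) :+ c :* Diff (:weight 2 a b c d) (vec4 x y z w))
      refl (a 0F) (a 1F) (a 2F) (a 3F) (h 0F) (h 1F) (h 2F) (h 3F)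
    diff-* a 3 h = solve 8 (λ a b c d x y z w →
      Diff (:weight 3 a b c d) (vec4 (a :* x) (b :* y) (c :* z) (d :* w)) :=
      :ι 3 :* ((d :- a) :* ((d :- b) :* (d :- c))) :* Diff (:weight 2 a b c d) (vec4 x y z w) :+ d :* Diff (:weight 3 a b c d) (vec4 x y z w))
      refl (a 0F) (a 1F) (a 2F) (a 3F) (h 0F) (h 1F) (h 2F) (h 3F)
    diff-* a (suc (suc (suc (suc k)))) h = trans
      (∑-zero (All.universal (λ t → ℚₚ.*-zeroˡ (a t * h t)) (allFin 4)))
      (sym (trans (cong₂ _+_
        (trans (cong (_* diff a (suc (suc (suc k))) h) (ℚₚ.*-zeroʳ (ι (suc (suc (suc (suc k)))))))
          (ℚₚ.*-zeroˡ (diff a (suc (suc (suc k))) h)))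
        (trans (cong (a 3F *_) (∑-zero (All.universal (λ t → ℚₚ.*-zeroˡ (h t)) (allFin 4))))
          (ℚₚ.*-zeroʳ (a 3F)))) (ℚₚ.+-identityˡ 0ℚ)))

    diff-const : ∀ a k c → diff a (suc k) (const c) ≡ 0ℚ
    diff-const a 0 x = solve 5 (λ a b c d x →
      Diff (:weight 1 a b c d) (vec4 x x x x) := :0) refl (a 0F) (a 1F) (a 2F) (a 3F) x
    diff-const a 1 x = solve 5 (λ a b c d x →
      Diff (:weight 2 a b c d) (vec4 x x x x) := :0) refl (a 0F) (a 1F) (a 2F) (a 3F) x
    diff-const a 2 x = solve 5 (λ a b c d x →
      Diff (:weight 3 a b c d) (vec4 x x x x) := :0) refl (a 0F) (a 1F) (a 2F) (a 3F) x
    diff-const a (suc (suc (suc k))) x = ∑-zero (All.universal (λ t → ℚₚ.*-zeroˡ x) (allFin 4))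

  -- Divided differences in several variables

  module _ where

    open ≡-Reasoning

    diffs : (Fin m → Points) → Vec ℕ m → (Vec (Fin 4) m → ℚ) → ℚ
    diffs a []      F = F []
    diffs a (k ∷ K) F = diff (a zero) k λ t → diffs (a ∘ suc) K (F ∘ (t ∷_))

    private
      diff-cong : ∀ a k {g h} → (∀ t → g t ≡ h t) → diff a k g ≡ diff a k h
      diff-cong a k g≗h = ∑-cong (allFin 4) λ t → cong (weight a k t *_) (g≗h t)

      diff-+ : ∀ a k g h → diff a k (λ t → g t + h t) ≡ diff a k g + diff a k h
      diff-+ a k g h = trans (∑-cong (allFin 4) λ t → ℚₚ.*-distribˡ-+ (weight a k t) (g t) (h t))
        (∑-distrib-+ (allFin 4) (λ t → weight a k t * g t) (λ t → weight a k t * h t))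

      diff-scale : ∀ a k c h → diff a k (λ t → c * h t) ≡ c * diff a k h
      diff-scale a k c h = trans (∑-cong (allFin 4) λ t → *-swap (weight a k t) c (h t))
        (∑-distribˡ-* (allFin 4) c (λ t → weight a k t * h t))

    diffs-cong : ∀ (a : Fin m → Points) K {F G} → (∀ τ → F τ ≡ G τ) → diffs a K F ≡ diffs a K G
    diffs-cong a []      F≗G = F≗G []
    diffs-cong a (k ∷ K) F≗G = diff-cong (a zero) k λ t → diffs-cong (a ∘ suc) K (F≗G ∘ (t ∷_))

    diffs-+ : ∀ (a : Fin m → Points) K F G → diffs a K (λ τ → F τ + G τ) ≡ diffs a K F + diffs a K G
    diffs-+ a []      F G = refl
    diffs-+ a (k ∷ K) F G = trans
      (diff-cong (a zero) k λ t → diffs-+ (a ∘ suc) K (F ∘ (t ∷_)) (G ∘ (t ∷_)))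
      (diff-+ (a zero) k (λ t → diffs (a ∘ suc) K (F ∘ (t ∷_))) (λ t → diffs (a ∘ suc) K (G ∘ (t ∷_))))

    diffs-scale : ∀ (a : Fin m → Points) K c F → diffs a K (λ τ → c * F τ) ≡ c * diffs a K F
    diffs-scale a []      c F = refl
    diffs-scale a (k ∷ K) c F = trans
      (diff-cong (a zero) k λ t → diffs-scale (a ∘ suc) K c (F ∘ (t ∷_)))
      (diff-scale (a zero) k c (λ t → diffs (a ∘ suc) K (F ∘ (t ∷_))))

    diffs-∑ : ∀ (a : Fin m → Points) K (xs : List A) (F : A → Vec (Fin 4) m → ℚ) →
      diffs a K (λ τ → ∑ xs (λ x → F x τ)) ≡ ∑ xs (λ x → diffs a K (F x))
    diffs-∑ a K []       F = trans (diffs-cong a K (λ τ → sym (ℚₚ.*-zeroˡ 0ℚ)))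
      (trans (diffs-scale a K 0ℚ (const 0ℚ)) (ℚₚ.*-zeroˡ (diffs a K (const 0ℚ))))
    diffs-∑ a K (x ∷ xs) F = trans (diffs-+ a K (F x) _) (cong (diffs a K (F x) +_) (diffs-∑ a K xs F))

    diffs-* : ∀ (a : Fin m → Points) K e F →
      diffs a K (λ τ → a e (lookup τ e) * F τ) ≡
      ι (lookup K e) * newton (a e) (lookup K e) * diffs a (K [ e ]%= ℕ.pred) F +
      node (a e) (lookup K e) * diffs a K F
    diffs-* a (k ∷ K) zero F = trans
      (diff-cong (a zero) k λ t → diffs-scale (a ∘ suc) K (a zero t) (F ∘ (t ∷_)))
      (diff-* (a zero) k λ t → diffs (a ∘ suc) K (F ∘ (t ∷_)))
    diffs-* a (k ∷ K) (suc e) F = trans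
      (diff-cong (a zero) k λ t → diffs-* (a ∘ suc) K e (F ∘ (t ∷_)))
      (trans (diff-+ (a zero) k (λ t → κ * D⁻ t) (λ t → x * D t))
        (cong₂ _+_ (diff-scale (a zero) k κ D⁻) (diff-scale (a zero) k x D)))
      where
      κ = ι (lookup K e) * newton (a (suc e)) (lookup K e)
      x = node (a (suc e)) (lookup K e)
      D⁻ D : Fin 4 → ℚ
      D⁻ t = diffs (a ∘ suc) (K [ e ]%= ℕ.pred) (F ∘ (t ∷_))
      D  t = diffs (a ∘ suc) K (F ∘ (t ∷_))

    diffs-const : ∀ (a : Fin m → Points) K e c → diffs a (K [ e ]%= suc) (const c) ≡ 0ℚ
    diffs-const a (k ∷ K) zero    c = diff-const (a zero) k (diffs (a ∘ suc) K (const c))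
    diffs-const a (k ∷ K) (suc e) c = ∑-zero (All.universal
      (λ t → trans (cong (weight (a zero) k t *_) (diffs-const (a ∘ suc) K e c)) (ℚₚ.*-zeroʳ (weight (a zero) k t))) (allFin 4))

    newton! : Points → ℕ → ℚ
    newton! a zero    = 1ℚ
    newton! a (suc k) = newton a (suc k) * newton! a k

    newtons : (Fin m → Points) → Vec ℕ m → ℚ
    newtons a []      = 1ℚ
    newtons a (k ∷ K) = newton! (a zero) k * newtons (a ∘ suc) K

    newtons-suc : ∀ (a : Fin m → Points) K e →
      newtons a (K [ e ]%= suc) ≡ newton (a e) (suc (lookup K e)) * newtons a K
    newtons-suc a (k ∷ K) zero    = ℚₚ.*-assoc (newton (a zero) (suc k)) (newton! (a zero) k) (newtons (a ∘ suc) K)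
    newtons-suc a (k ∷ K) (suc e) = trans (cong (newton! (a zero) k *_) (newtons-suc (a ∘ suc) K e))
      (*-swap (newton! (a zero) k) (newton (a (suc e)) (suc (lookup K e))) (newtons (a ∘ suc) K))

    -- The exponent vector of the monomial whose factors are listed.
    count : List (Fin m) → Vec ℕ m
    count []       = Vec.replicate _ 0
    count (d ∷ ds) = count ds [ d ]%= suc

    private
      suc-comm : ∀ (K : Vec ℕ m) d e → K [ d ]%= suc [ e ]%= suc ≡ K [ e ]%= suc [ d ]%= suc
      suc-comm K d e with e Fin.≟ d
      ... | yes refl = refl
      ... | no  e≢d  = Vecₚ.updateAt-commutes e d e≢d K

    picks-count : ∀ (ds : List (Fin m)) → All (λ p → count ds ≡ count (proj₂ p) [ proj₁ p ]%= suc) (picks ds)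
    picks-count []       = []
    picks-count (d ∷ ds) = refl ∷ Allₚ.map⁺ (All.map
      (λ {(e , es)} eq → trans (cong (_[ d ]%= suc) eq) (suc-comm (count es) e d)) (picks-count ds))

    ι-count : ∀ (ds : List (Fin m)) e → ι (lookup (count ds) e) ≡ ∑ ds (λ d → δ d e)
    ι-count {m = m} []       e = cong ι (Vecₚ.lookup-replicate e 0)
    ι-count (d ∷ ds) e with d Fin.≟ e
    ... | yes refl = trans (cong ι (Vecₚ.lookup∘updateAt d (count ds))) (cong (1ℚ +_) (ι-count ds d))
    ... | no  d≢e  = trans (cong ι (Vecₚ.lookup∘updateAt′ e d (d≢e ∘ sym) (count ds)))
      (trans (ι-count ds e) (sym (ℚₚ.+-identityˡ _)))

    ∑-picks : ∀ (xs : List A) (f : A → ℚ) → ∑ (picks xs) (f ∘ proj₁) ≡ ∑ xs f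
    ∑-picks []       f = refl
    ∑-picks (x ∷ xs) f = cong (f x +_) (trans (∑-map (map₂ (x ∷_)) (picks xs) (f ∘ proj₁)) (∑-picks xs f))

    -- A variable of exponent k occurs k times in `ds`. Thus the factor k of the Leibniz rule
    -- becomes k equal columns of a permanent.
    ∑-count : ∀ (ds : List (Fin m)) (f : Fin m → ℚ) → ∑ (allFin m) (λ e → ι (lookup (count ds) e) * f e) ≡ ∑ ds f
    ∑-count {m = m} ds f = begin
      ∑ (allFin m) (λ e → ι (lookup (count ds) e) * f e)
        ≡⟨ ∑-cong (allFin m) (λ e → trans (cong (_* f e) (ι-count ds e)) (sym (∑-distribʳ-* ds (f e) _))) ⟩
      ∑ (allFin m) (λ e → ∑ ds λ d → δ d e * f e)  ≡⟨ ∑-swap (allFin m) ds _ ⟩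
      ∑ ds (λ d → ∑ (allFin m) λ e → δ d e * f e)  ≡⟨ ∑-cong ds (λ d → ∑-δ d f) ⟩
      ∑ ds f ∎

    module _ {m : ℕ} (a : Fin m → Points) (c : B → ℚ) (A : B → Fin m → ℚ) where

      form : B → Vec (Fin 4) m → ℚ
      form b τ = c b + ∑ (allFin m) (λ e → A b e * a e (lookup τ e))

      forms : List B → Vec (Fin 4) m → ℚ
      forms []       τ = 1ℚ
      forms (b ∷ bs) τ = form b τ * forms bs τ

      -- The terms containing diffs a (count ds) F vanish when F has too low a degree.
      diffs-form : ∀ b ds F → diffs a (count ds) F ≡ 0ℚ →
        diffs a (count ds) (λ τ → form b τ * F τ) ≡
        ∑ (picks ds) (λ (d , ds′) → A b d * (newton (a d) (lookup (count ds) d) * diffs a (count ds′) F))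
      diffs-form b ds F vanish = begin
        diffs a K (λ τ → form b τ * F τ)
          ≡⟨ diffs-cong a K (λ τ → trans (ℚₚ.*-distribʳ-+ (F τ) (c b) _) (cong (c b * F τ +_)
               (trans (sym (∑-distribʳ-* (allFin m) (F τ) _)) (∑-cong (allFin m) λ e → ℚₚ.*-assoc (A b e) _ (F τ))))) ⟩
        diffs a K (λ τ → c b * F τ + ∑ (allFin m) (λ e → A b e * (a e (lookup τ e) * F τ)))
          ≡⟨ trans (diffs-+ a K _ _) (cong₂ _+_
               (trans (diffs-scale a K (c b) F) (trans (cong (c b *_) vanish) (ℚₚ.*-zeroʳ (c b))))
               (trans (diffs-∑ a K (allFin m) _) (∑-cong (allFin m) λ e →
                 trans (diffs-scale a K (A b e) _) (cong (A b e *_) (diffs-* a K e F))))) ⟩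
        0ℚ + ∑ (allFin m) (λ e → A b e * (ι (lookup K e) * newton (a e) (lookup K e) * diffs a (K [ e ]%= ℕ.pred) F
          + node (a e) (lookup K e) * diffs a K F))
          ≡⟨ trans (ℚₚ.+-identityˡ _) (∑-cong (allFin m) λ e → begin
               A b e * (ι (lookup K e) * newton (a e) (lookup K e) * diffs a (K [ e ]%= ℕ.pred) F
                 + node (a e) (lookup K e) * diffs a K F)
                 ≡⟨ cong (λ z → A b e * (ι (lookup K e) * newton (a e) (lookup K e) * diffs a (K [ e ]%= ℕ.pred) F
                     + node (a e) (lookup K e) * z)) vanish ⟩
               A b e * (ι (lookup K e) * newton (a e) (lookup K e) * diffs a (K [ e ]%= ℕ.pred) F
                 + node (a e) (lookup K e) * 0ℚ)
                 ≡⟨ rearrange (A b e) (ι (lookup K e)) (newton (a e) (lookup K e))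
                      (diffs a (K [ e ]%= ℕ.pred) F) (node (a e) (lookup K e)) ⟩
               ι (lookup K e) * (A b e * (newton (a e) (lookup K e) * diffs a (K [ e ]%= ℕ.pred) F)) ∎) ⟩
        ∑ (allFin m) (λ e → ι (lookup K e) * φ e)
          ≡⟨ ∑-count ds φ ⟩
        ∑ ds φ
          ≡⟨ ∑-picks ds φ ⟨
        ∑ (picks ds) (φ ∘ proj₁)
          ≡⟨ ∑-congᴬ (All.map (λ {(d , ds′)} eq → cong (λ L → A b d * (newton (a d) (lookup K d) * diffs a L F))
               (trans (cong (_[ d ]%= ℕ.pred) eq) (Vecₚ.updateAt-updateAt d (count ds′) ∙ Vecₚ.updateAt-id d (count ds′))))
               (picks-count ds)) ⟩
        ∑ (picks ds) (λ (d , ds′) → A b d * (newton (a d) (lookup K d) * diffs a (count ds′) F)) ∎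
        where
        infixr 4 _∙_
        _∙_ = trans
        K = count ds
        φ : Fin m → ℚ
        φ e = A b e * (newton (a e) (lookup K e) * diffs a (K [ e ]%= ℕ.pred) F)
        rearrange : ∀ x k p z y → x * (k * p * z + y * 0ℚ) ≡ k * (x * (p * z))
        rearrange = solve 5 (λ x k p z y → x :* (k :* p :* z :+ y :* con 0ℚ) := k :* (x :* (p :* z))) refl
          where open ℚSolver.+-*-Solver

      -- Each form raises the degree by one, and a divided difference of total order above the
      -- degree vanishes.
      diffs-forms-< : ∀ bs ds → length bs ℕ.< length ds → diffs a (count ds) (forms bs) ≡ 0ℚ
      diffs-forms-< []       (d ∷ ds) lt = diffs-const a (count ds) d 1ℚ
      diffs-forms-< (b ∷ bs) ds       lt = trans
        (diffs-form b ds (forms bs) (diffs-forms-< bs ds (ℕₚ.<-trans ℕₚ.≤-refl lt)))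
        (∑-zero (All.map (λ {(d , ds′)} eq → begin
          A b d * (newton (a d) (lookup (count ds) d) * diffs a (count ds′) (forms bs))
            ≡⟨ cong (λ z → A b d * (newton (a d) (lookup (count ds) d) * z))
                 (diffs-forms-< bs ds′ (ℕₚ.≤-pred (ℕₚ.≤-trans lt (ℕₚ.≤-reflexive (sym eq))))) ⟩
          A b d * (newton (a d) (lookup (count ds) d) * 0ℚ)
            ≡⟨ cong (A b d *_) (ℚₚ.*-zeroʳ (newton (a d) (lookup (count ds) d))) ⟩
          A b d * 0ℚ
            ≡⟨ ℚₚ.*-zeroʳ (A b d) ⟩
          0ℚ ∎) (picks-length ds)))

      -- At top order each form contributes through its linear part only: it uses up one variable of
      -- `ds`, which is the row expansion of the permanent. The constants `c` therefore drop out.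
      diffs-forms : ∀ bs ds → length bs ≡ length ds →
        diffs a (count ds) (forms bs) ≡ newtons a (count ds) * perm A bs ds
      diffs-forms []       []       eq = base a
        where
        base : ∀ {m} (a : Fin m → Points) → diffs a (Vec.replicate m 0) (const 1ℚ) ≡ newtons a (Vec.replicate m 0) * 1ℚ
        base {zero}  a = refl
        base {suc m} a = begin
          1ℚ * D + (0ℚ * D + (0ℚ * D + (0ℚ * D + 0ℚ)))  ≡⟨ collapse D ⟩
          1ℚ * D                                        ≡⟨ cong (1ℚ *_) (base (a ∘ suc)) ⟩
          1ℚ * (newtons (a ∘ suc) (Vec.replicate m 0) * 1ℚ)
            ≡⟨ ℚₚ.*-assoc 1ℚ (newtons (a ∘ suc) (Vec.replicate m 0)) 1ℚ ⟨
          newtons a (Vec.replicate (suc m) 0) * 1ℚ ∎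
          where
          D = diffs (a ∘ suc) (Vec.replicate m 0) (const 1ℚ)
          collapse : ∀ x → 1ℚ * x + (0ℚ * x + (0ℚ * x + (0ℚ * x + 0ℚ))) ≡ 1ℚ * x
          collapse = solve 1 (λ x → con 1ℚ :* x :+ (con 0ℚ :* x :+ (con 0ℚ :* x :+ (con 0ℚ :* x :+ con 0ℚ))) := con 1ℚ :* x) refl
            where open ℚSolver.+-*-Solver
      diffs-forms (b ∷ bs) ds       eq = begin
        diffs a (count ds) (λ τ → form b τ * forms bs τ)
          ≡⟨ diffs-form b ds (forms bs) (diffs-forms-< bs ds (ℕₚ.≤-reflexive eq)) ⟩
        ∑ (picks ds) (λ (d , ds′) → A b d * (newton (a d) (lookup (count ds) d) * diffs a (count ds′) (forms bs)))
          ≡⟨ ∑-congᴬ (All.zipWith (λ {p} → step {p}) (picks-length ds , picks-count ds)) ⟩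
        ∑ (picks ds) (λ (d , ds′) → newtons a (count ds) * (A b d * perm A bs ds′))
          ≡⟨ ∑-distribˡ-* (picks ds) (newtons a (count ds)) _ ⟩
        newtons a (count ds) * perm A (b ∷ bs) ds ∎
        where
        step : ∀ {p} → suc (length (proj₂ p)) ≡ length ds × count ds ≡ count (proj₂ p) [ proj₁ p ]%= suc →
          A b (proj₁ p) * (newton (a (proj₁ p)) (lookup (count ds) (proj₁ p)) * diffs a (count (proj₂ p)) (forms bs)) ≡
          newtons a (count ds) * (A b (proj₁ p) * perm A bs (proj₂ p))
        step {d , ds′} (len , cnt) = begin
          A b d * (newton (a d) (lookup (count ds) d) * diffs a (count ds′) (forms bs))
            ≡⟨ cong (λ z → A b d * (newton (a d) (lookup (count ds) d) * z))
                 (diffs-forms bs ds′ (ℕₚ.suc-injective (trans eq (sym len)))) ⟩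
          A b d * (newton (a d) (lookup (count ds) d) * (newtons a (count ds′) * perm A bs ds′))
            ≡⟨ regroup (A b d) (newton (a d) (lookup (count ds) d)) (newtons a (count ds′)) (perm A bs ds′) ⟩
          (newton (a d) (lookup (count ds) d) * newtons a (count ds′)) * (A b d * perm A bs ds′)
            ≡⟨ cong (_* (A b d * perm A bs ds′)) (trans
                 (cong (λ k → newton (a d) k * newtons a (count ds′))
                   (trans (cong (λ L → lookup L d) cnt) (Vecₚ.lookup∘updateAt d (count ds′))))
                 (trans (sym (newtons-suc a (count ds′) d)) (cong (newtons a) (sym cnt)))) ⟩
          newtons a (count ds) * (A b d * perm A bs ds′) ∎
          where
          regroup : ∀ x p w t → x * (p * (w * t)) ≡ (p * w) * (x * t)
          regroup = solve 4 (λ x p w t → x :* (p :* (w :* t)) := (p :* w) :* (x :* t)) refl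
            where open ℚSolver.+-*-Solver

  -- A quantitative Combinatorial Nullstellensatz

  *-mono-≤ : ∀ {p q r s} → 0ℚ ≤ r → 0ℚ ≤ q → p ≤ q → r ≤ s → p * r ≤ q * s
  *-mono-≤ {p} {q} {r} {s} 0≤r 0≤q p≤q r≤s = ℚₚ.≤-trans
    (ℚₚ.*-monoʳ-≤-nonNeg r {{ℚ.nonNegative 0≤r}} p≤q)
    (ℚₚ.*-monoˡ-≤-nonNeg q {{ℚ.nonNegative 0≤q}} r≤s)

  ∣∣-*-≤ : ∀ {x y X Y} → ∣ x ∣ ≤ X → ∣ y ∣ ≤ Y → ∣ x * y ∣ ≤ X * Y
  ∣∣-*-≤ {x} {y} x≤X y≤Y = subst (_≤ _) (sym (ℚₚ.∣p*q∣≡∣p∣*∣q∣ x y))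
    (*-mono-≤ (ℚₚ.0≤∣p∣ y) (ℚₚ.≤-trans (ℚₚ.0≤∣p∣ x) x≤X) x≤X y≤Y)

  ∣∣-+-≤ : ∀ {x y X Y} → ∣ x ∣ ≤ X → ∣ y ∣ ≤ Y → ∣ x + y ∣ ≤ X + Y
  ∣∣-+-≤ {x} {y} x≤X y≤Y = ℚₚ.≤-trans (ℚₚ.∣p+q∣≤∣p∣+∣q∣ x y) (ℚₚ.+-mono-≤ x≤X y≤Y)

  ∣∣-‿-≤ : ∀ {x y X Y} → ∣ x ∣ ≤ X → ∣ y ∣ ≤ Y → ∣ x - y ∣ ≤ X + Y
  ∣∣-‿-≤ {x} {y} x≤X y≤Y = ∣∣-+-≤ x≤X (subst (_≤ _) (sym (ℚₚ.∣-p∣≡∣p∣ y)) y≤Y)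

  ∣∑∣≤ : ∀ (xs : List A) {f g : A → ℚ} → (∀ x → ∣ f x ∣ ≤ g x) → ∣ ∑ xs f ∣ ≤ ∑ xs g
  ∣∑∣≤ []       f≤g = ℚₚ.≤-refl
  ∣∑∣≤ (x ∷ xs) f≤g = ∣∣-+-≤ (f≤g x) (∣∑∣≤ xs f≤g)

  -- The lower bound 1/N for the modulus, written without division.
  Away : ℚ → ℚ → Set
  Away N x = 1ℚ ≤ N * ∣ x ∣

  Away⇒0≤ : ∀ {N x} → Away N x → 0ℚ ≤ N
  Away⇒0≤ {N} {x} aw with ℚₚ.≤-total 0ℚ N
  ... | inj₁ 0≤N = 0≤N
  ... | inj₂ N≤0 = contradiction (ℚₚ.<-≤-trans (ℚₚ.positive⁻¹ 1ℚ) (ℚₚ.≤-trans aw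
    (subst (N * ∣ x ∣ ≤_) (ℚₚ.*-zeroˡ ∣ x ∣)
      (ℚₚ.*-monoʳ-≤-nonNeg ∣ x ∣ {{ℚ.nonNegative (ℚₚ.0≤∣p∣ x)}} N≤0)))) (ℚₚ.<-irrefl refl)

  Away-* : ∀ {N N′ x y} → Away N x → Away N′ y → Away (N * N′) (x * y)
  Away-* {N} {N′} {x} {y} awx awy = subst (1ℚ ≤_) eq
    (*-mono-≤ (ℚₚ.nonNegative⁻¹ 1ℚ) (ℚₚ.≤-trans (ℚₚ.nonNegative⁻¹ 1ℚ) awx) awx awy)
    where
    eq : N * ∣ x ∣ * (N′ * ∣ y ∣) ≡ N * N′ * ∣ x * y ∣
    eq = trans (solve 4 (λ N x N′ y → N :* x :* (N′ :* y) := N :* N′ :* (x :* y)) refl N (∣ x ∣) N′ (∣ y ∣))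
      (cong (N * N′ *_) (sym (ℚₚ.∣p*q∣≡∣p∣*∣q∣ x y)))
      where open ℚSolver.+-*-Solver

  Away-weaken : ∀ {N N′} x → N ≤ N′ → Away N x → Away N′ x
  Away-weaken x N≤N′ aw = ℚₚ.≤-trans aw (ℚₚ.*-monoʳ-≤-nonNeg (∣ x ∣) {{ℚ.nonNegative (ℚₚ.0≤∣p∣ x)}} N≤N′)

  Away-*ʳ : ∀ {N x y Y} → ∣ x ∣ ≤ Y → Away N (x * y) → Away (N * Y) y
  Away-*ʳ {N} {x} {y} {Y} x≤Y aw = ℚₚ.≤-trans aw (begin
    N * ∣ x * y ∣      ≡⟨ cong (N *_) (ℚₚ.∣p*q∣≡∣p∣*∣q∣ x y) ⟩
    N * (∣ x ∣ * ∣ y ∣)  ≤⟨ ℚₚ.*-monoˡ-≤-nonNeg N {{ℚ.nonNegative (Away⇒0≤ {N} {x * y} aw)}}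
                             (ℚₚ.*-monoʳ-≤-nonNeg ∣ y ∣ {{ℚ.nonNegative (ℚₚ.0≤∣p∣ y)}} x≤Y) ⟩
    N * (Y * ∣ y ∣)      ≡⟨ ℚₚ.*-assoc N Y ∣ y ∣ ⟨
    N * Y * ∣ y ∣        ∎)
    where open ℚₚ.≤-Reasoning

  Away-*ˡ : ∀ {N x y Y} → ∣ y ∣ ≤ Y → Away N (x * y) → Away (N * Y) x
  Away-*ˡ {N} {x} {y} y≤Y aw = Away-*ʳ {N} {y} {x} y≤Y (subst (Away N) (ℚₚ.*-comm x y) aw)

  ≢0⇒Away : ∀ {x} → x ≢ 0ℚ → ∃ λ N → Away N x
  ≢0⇒Away {x} x≢0 = ℚ.1/ ∣ x ∣ , ℚₚ.≤-reflexive (sym (ℚₚ.*-inverseˡ ∣ x ∣))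
    where instance _ = ℚ.≢-nonZero (x≢0 ∘ ℚₚ.∣p∣≡0⇒p≡0 x)

  -- The summand of largest modulus is at least the average in modulus.
  Away-∑ : ∀ x (xs : List A) {N} (f : A → ℚ) → Away N (∑ (x ∷ xs) f) →
    ∃ λ y → Away (N * lengthℚ (x ∷ xs)) (f y)
  Away-∑ x xs {N} f aw = y , ℚₚ.≤-trans aw (begin
    N * ∣ ∑ (x ∷ xs) f ∣             ≤⟨ ℚₚ.*-monoˡ-≤-nonNeg N {{ℚ.nonNegative (Away⇒0≤ {N} {∑ (x ∷ xs) f} aw)}} (max-≤ y≥) ⟩
    N * (lengthℚ (x ∷ xs) * ∣ f y ∣)  ≡⟨ ℚₚ.*-assoc N (lengthℚ (x ∷ xs)) ∣ f y ∣ ⟨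
    N * lengthℚ (x ∷ xs) * ∣ f y ∣    ∎)
    where
    open ℚₚ.≤-Reasoning
    max : ∀ x xs → ∃ λ y → All (λ z → ∣ f z ∣ ≤ ∣ f y ∣) (x ∷ xs)
    max x []        = x , ℚₚ.≤-refl ∷ []
    max x (x′ ∷ xs) with y , ys ← max x′ xs | ℚₚ.≤-total ∣ f x ∣ ∣ f y ∣
    ... | inj₁ fx≤fy = y , fx≤fy ∷ ys
    ... | inj₂ fy≤fx = x , ℚₚ.≤-refl ∷ All.map (λ fz≤fy → ℚₚ.≤-trans fz≤fy fy≤fx) ys
    y = proj₁ (max x xs)
    y≥ = proj₂ (max x xs)
    max-≤ : ∀ {zs} → All (λ z → ∣ f z ∣ ≤ ∣ f y ∣) zs → ∣ ∑ zs f ∣ ≤ lengthℚ zs * ∣ f y ∣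
    max-≤ []                 = ℚₚ.≤-reflexive (sym (ℚₚ.*-zeroˡ ∣ f y ∣))
    max-≤ {z ∷ zs} (le ∷ les) = subst (∣ ∑ (z ∷ zs) f ∣ ≤_)
      (trans (cong (_+ lengthℚ zs * ∣ f y ∣) (sym (ℚₚ.*-identityˡ ∣ f y ∣)))
        (sym (ℚₚ.*-distribʳ-+ ∣ f y ∣ 1ℚ (lengthℚ zs))))
      (∣∣-+-≤ le (max-≤ les))

  BoundedPoints SeparatedPoints : ℚ → Points → Set
  BoundedPoints   M a = ∀ t → ∣ a t ∣ ≤ M
  SeparatedPoints D a = ∀ {t t′} → t ≢ t′ → Away D (a t - a t′)

  weight-bound : ℚ → ℚ
  weight-bound M = 1ℚ ⊔ (ι 2 * (M + M) ⊔ ι 6 * ((M + M) * ((M + M) * (M + M))))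

  ∣weight∣≤ : ∀ {M a} → BoundedPoints M a → ∀ k t → ∣ weight a k t ∣ ≤ weight-bound M
  ∣weight∣≤ {M} {a} bd = go
    where
    W₁ = ι 2 * (M + M)
    W₂ = ι 6 * ((M + M) * ((M + M) * (M + M)))
    one : 1ℚ ≤ weight-bound M
    one = ℚₚ.p≤p⊔q 1ℚ (W₁ ⊔ W₂)
    nil : 0ℚ ≤ weight-bound M
    nil = ℚₚ.≤-trans (ℚₚ.nonNegative⁻¹ 1ℚ) one
    d : ∀ i j → ∣ a i - a j ∣ ≤ M + M
    d i j = ∣∣-‿-≤ (bd i) (bd j)
    lin : ∀ i j → ∣ ι 2 * (a i - a j) ∣ ≤ weight-bound M
    lin i j = ℚₚ.≤-trans (∣∣-*-≤ {ι 2} {a i - a j} ℚₚ.≤-refl (d i j))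
      (ℚₚ.≤-trans (ℚₚ.p≤p⊔q W₁ W₂) (ℚₚ.p≤q⊔p 1ℚ (W₁ ⊔ W₂)))
    cub : ∀ i j k l p q → ∣ ι 6 * ((a i - a j) * ((a k - a l) * (a p - a q))) ∣ ≤ weight-bound M
    cub i j k l p q = ℚₚ.≤-trans
      (∣∣-*-≤ {ι 6} {(a i - a j) * ((a k - a l) * (a p - a q))} ℚₚ.≤-refl
        (∣∣-*-≤ {a i - a j} (d i j) (∣∣-*-≤ {a k - a l} (d k l) (d p q))))
      (ℚₚ.≤-trans (ℚₚ.p≤q⊔p W₁ W₂) (ℚₚ.p≤q⊔p 1ℚ (W₁ ⊔ W₂)))
    go : ∀ k t → ∣ weight a k t ∣ ≤ weight-bound M
    go 0 0F = one
    go 0 1F = nil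
    go 0 2F = nil
    go 0 3F = nil
    go 1 0F = one
    go 1 1F = one
    go 1 2F = nil
    go 1 3F = nil
    go 2 0F = lin 2F 1F
    go 2 1F = lin 0F 2F
    go 2 2F = lin 1F 0F
    go 2 3F = nil
    go 3 0F = cub 3F 1F 3F 2F 1F 2F
    go 3 1F = cub 3F 0F 3F 2F 2F 0F
    go 3 2F = cub 3F 0F 3F 1F 0F 1F
    go 3 3F = cub 1F 0F 2F 0F 2F 1F
    go (suc (suc (suc (suc _)))) _ = nil

  newton-Away : ∀ D k → k ℕ.< 3 → ∃ λ N → ∀ {a} → SeparatedPoints D a → Away N (newton a (suc k))
  newton-Away D 0 _ = D , λ sep → sep λ ()
  newton-Away D 1 _ = D * D , λ {a} sep → Away-* {D} {D} {a 2F - a 0F} (sep λ ()) (sep λ ())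
  newton-Away D 2 _ = D * (D * D) , λ {a} sep →
    Away-* {D} {D * D} {a 3F - a 0F} (sep λ ()) (Away-* {D} {D} {a 3F - a 1F} (sep λ ()) (sep λ ()))
  newton-Away D (suc (suc (suc k))) (ℕ.s≤s (ℕ.s≤s (ℕ.s≤s ())))

  newton!-Away : ∀ D k → k ℕ.≤ 3 → ∃ λ N → ∀ {a} → SeparatedPoints D a → Away N (newton! a k)
  newton!-Away D zero    _   = 1ℚ , λ _ → ℚₚ.≤-refl
  newton!-Away D (suc k) k<3
    with N₁ , aw₁ ← newton-Away D k k<3 | N₂ , aw₂ ← newton!-Away D k (ℕₚ.<⇒≤ k<3) =
    N₁ * N₂ , λ {a} sep → Away-* {N₁} {N₂} {newton a (suc k)} (aw₁ sep) (aw₂ sep)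

  newtons-Away : ∀ D (K : Vec ℕ m) → (∀ e → lookup K e ℕ.≤ 3) →
    ∃ λ N → ∀ {a : Fin m → Points} → (∀ e → SeparatedPoints D (a e)) → Away N (newtons a K)
  newtons-Away D []      K≤3 = 1ℚ , λ _ → ℚₚ.≤-refl
  newtons-Away D (k ∷ K) K≤3
    with N₁ , aw₁ ← newton!-Away D k (K≤3 zero) | N₂ , aw₂ ← newtons-Away D K (K≤3 ∘ suc) =
    N₁ * N₂ , λ {a} sep → Away-* {N₁} {N₂} {newton! (a zero) k} (aw₁ (sep zero)) (aw₂ (sep ∘ suc))

  -- In each variable some term of the difference has at least average size, and its weight is
  -- bounded in terms of `M`. Hence `N′` can be fixed before the points and `F`.
  diffs-Away : ∀ M (K : Vec ℕ m) N → ∃ λ N′ → ∀ {a : Fin m → Points} → (∀ e → BoundedPoints M (a e)) →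
    ∀ F → Away N (diffs a K F) → ∃ λ τ → Away N′ (F τ)
  diffs-Away M []      N = N , λ _ F aw → [] , aw
  diffs-Away M (k ∷ K) N with N′ , ih ← diffs-Away M K (N * lengthℚ (allFin 4) * weight-bound M) =
    N′ , λ {a} bd F aw →
      let t , awt = Away-∑ 0F (1F ∷ 2F ∷ 3F ∷ []) {N} (λ t → weight (a zero) k t * diffs (a ∘ suc) K (F ∘ (t ∷_))) aw
          τ , awτ = ih (bd ∘ suc) (F ∘ (t ∷_))
            (Away-*ʳ {N * lengthℚ (allFin 4)} {weight (a zero) k t} (∣weight∣≤ (bd zero) k t) awt)
      in t ∷ τ , awτ

  module _ (A : B → Fin m → ℚ) where

    form-bound : ℚ → B → ℚ
    form-bound M b = (M + M) + ∑ (allFin m) λ e → ∣ A b e ∣ * M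

    ∣form∣≤ : ∀ {M a c} → (∀ e → BoundedPoints M (a e)) → (∀ b → ∣ c b ∣ ≤ M + M) →
      ∀ b τ → ∣ form a c A b τ ∣ ≤ form-bound M b
    ∣form∣≤ bd cbd b τ = ∣∣-+-≤ (cbd b) (∣∑∣≤ (allFin m) λ e → ∣∣-*-≤ {A b e} ℚₚ.≤-refl (bd e (lookup τ e)))

    forms-bound : ∀ M (bs : List B) → ∃ λ C → ∀ {a c} → (∀ e → BoundedPoints M (a e)) → (∀ b → ∣ c b ∣ ≤ M + M) →
      ∀ τ → ∣ forms a c A bs τ ∣ ≤ C
    forms-bound M []       = 1ℚ , λ _ _ _ → ℚₚ.≤-refl
    forms-bound M (b ∷ bs) with C , bound ← forms-bound M bs = form-bound M b * C ,
      λ {a} {c} bd cbd τ → ∣∣-*-≤ {form a c A b τ} (∣form∣≤ {a = a} bd cbd b τ) (bound bd cbd τ)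

    -- If a product is bounded below and the other factors are bounded above, the remaining factor
    -- is bounded below.
    forms-Away : ∀ M N (bs : List B) → ∃ λ N′ → ∀ {a c} → (∀ e → BoundedPoints M (a e)) → (∀ b → ∣ c b ∣ ≤ M + M) →
      ∀ τ → Away N (forms a c A bs τ) → All (λ b → Away N′ (form a c A b τ)) bs
    forms-Away M N []       = N , λ _ _ _ _ → []
    forms-Away M N (b ∷ bs)
      with C , bound ← forms-bound M bs | N₂ , ih ← forms-Away M (N * form-bound M b) bs =
      N₁ ⊔ N₂ , λ {a} {c} bd cbd τ aw →
        Away-weaken (form a c A b τ) (ℚₚ.p≤p⊔q N₁ N₂) (Away-*ˡ {N} {form a c A b τ} (bound bd cbd τ) aw) ∷
        All.map (λ {b′} → Away-weaken (form a c A b′ τ) (ℚₚ.p≤q⊔p N₁ N₂)) (ih bd cbd τ (Away-*ʳ {N} {form a c A b τ} (∣form∣≤ {a = a} bd cbd b τ) aw))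
      where
      N₁ = N * C

    -- `N` precedes `a` and `c` and sees them only through `M` and `D`, so it serves every precision
    -- at once. The top difference is `newtons` times the fixed permanent, and separation of the
    -- points bounds `newtons` below.
    nullstellensatz : ∀ M D bs (ds : List (Fin m)) → length bs ≡ length ds →
      (∀ e → lookup (count ds) e ℕ.≤ 3) → perm A bs ds ≢ 0ℚ →
      ∃ λ N → ∀ {a c} → (∀ e → BoundedPoints M (a e)) → (∀ e → SeparatedPoints D (a e)) → (∀ b → ∣ c b ∣ ≤ M + M) →
      ∃ λ τ → All (λ b → Away N (form a c A b τ)) bs
    nullstellensatz M D bs ds len ds≤3 ≢0
      with N₁ , aw₁ ← newtons-Away D (count ds) ds≤3 | N₂ , aw₂ ← ≢0⇒Away ≢0
      with N₃ , aw₃ ← diffs-Away M (count ds) (N₁ * N₂)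
      with N₄ , aw₄ ← forms-Away M N₃ bs =
      N₄ , λ {a} {c} bd sep cbd →
        let τ , awτ = aw₃ bd (forms a c A bs) (subst (Away (N₁ * N₂)) (sym (diffs-forms a c A bs ds len))
                        (Away-* {N₁} {N₂} {newtons a (count ds)} (aw₁ sep) aw₂))
        in τ , aw₄ bd cbd τ awτ

  -- Rational approximation of real numbers

  module _ where

    open import Data.Integer using (+_; -[1+_])

    private
      toℚᵘ-inv : ∀ n → ℚ.toℚᵘ (inv n) ℚᵘ.≃ ℚᵘ.mkℚᵘ (+ 1) n
      toℚᵘ-inv n = ℚₚ.toℚᵘ-fromℚᵘ (ℚᵘ.mkℚᵘ (+ 1) n)

      toℚᵘ-int : ∀ n → ℚ.toℚᵘ (+ n / 1) ℚᵘ.≃ ℚᵘ.mkℚᵘ (+ n) 0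
      toℚᵘ-int n = ℚₚ.toℚᵘ-fromℚᵘ (ℚᵘ.mkℚᵘ (+ n) 0)

    *-inv : ∀ n → (+ suc n / 1) * inv n ≡ 1ℚ
    *-inv n = ℚₚ.toℚᵘ-injective (ℚᵘₚ.≃-trans (ℚₚ.toℚᵘ-homo-* (+ suc n / 1) (inv n))
      (ℚᵘₚ.≃-trans (ℚᵘₚ.*-cong (toℚᵘ-int (suc n)) (toℚᵘ-inv n)) (ℚᵘ.*≡* eq)))
      where
      eq : + suc n ℤ.* + 1 ℤ.* + 1 ≡ + 1 ℤ.* + (1 ℕ.* suc n)
      eq = trans (ℤₚ.*-identityʳ _) (trans (ℤₚ.*-comm (+ suc n) (+ 1)) (cong (λ k → + 1 ℤ.* + k) (sym (ℕₚ.*-identityˡ (suc n)))))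

    inv-anti : ∀ {m n} → m ℕ.≤ n → inv n ≤ inv m
    inv-anti {m} {n} m≤n = ℚₚ.toℚᵘ-cancel-≤ (ℚᵘₚ.≤-respˡ-≃ (ℚᵘₚ.≃-sym (toℚᵘ-inv n))
      (ℚᵘₚ.≤-respʳ-≃ (ℚᵘₚ.≃-sym (toℚᵘ-inv m)) (ℚᵘ.*≤* (ℤₚ.*-monoˡ-≤-nonNeg (+ 1) (ℤ.+≤+ (ℕ.s≤s m≤n))))))

    0<inv : ∀ n → 0ℚ < inv n
    0<inv n = ℚₚ.toℚᵘ-cancel-< (ℚᵘₚ.<-respʳ-≃ (ℚᵘₚ.≃-sym (toℚᵘ-inv n)) (ℚᵘ.*<* (ℤ.+<+ (ℕ.s≤s ℕ.z≤n))))

    0≤inv : ∀ n → 0ℚ ≤ inv n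
    0≤inv n = ℚₚ.<⇒≤ (0<inv n)

    -- A positive fraction is at least the inverse of its denominator.
    inv-arch : ∀ {q} → 0ℚ < q → ∃ λ n → inv n ≤ q
    inv-arch {mkℚ (+ suc k) d c} _ = d , ℚₚ.toℚᵘ-cancel-≤ (ℚᵘₚ.≤-respˡ-≃ (ℚᵘₚ.≃-sym (toℚᵘ-inv d))
      (ℚᵘ.*≤* (ℤₚ.*-monoʳ-≤-nonNeg (+ suc d) {+ 1} {+ suc k} (ℤ.+≤+ (ℕ.s≤s ℕ.z≤n)))))
    inv-arch {mkℚ (+ zero) d c} (ℚ.*<* lt) = contradiction lt (ℤₚ.<-irrefl (ℤₚ.*-zeroˡ (+ 1)))
    inv-arch {mkℚ -[1+ k ] d c} (ℚ.*<* ())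

    -- The numerator of a non-negative `q` is at least `q`, so it serves as the threshold.
    inv-small : ∀ q → 0ℚ ≤ q → ∃ λ m → ∀ {n} → m ℕ.≤ n → q * inv n < 1ℚ
    inv-small q@(mkℚ (+ k) d c) 0≤q = k , λ {n} k≤n → ℚₚ.≤-<-trans
      (ℚₚ.*-monoˡ-≤-nonNeg q {{ℚ.nonNegative 0≤q}} (inv-anti k≤n)) q*inv<1
      where
      q*inv<1 : q * inv k < 1ℚ
      q*inv<1 = ℚₚ.toℚᵘ-cancel-< (ℚᵘₚ.<-respˡ-≃ (ℚᵘₚ.≃-sym (ℚᵘₚ.≃-trans (ℚₚ.toℚᵘ-homo-* q (inv k))
        (ℚᵘₚ.*-congˡ {ℚ.toℚᵘ q} (toℚᵘ-inv k)))) (ℚᵘ.*<* (subst₂ ℤ._<_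
          (trans (ℤₚ.pos-* (k ℕ.* 1) 1) (cong (ℤ._* + 1) (ℤₚ.pos-* k 1)))
          (ℤₚ.pos-* 1 (suc d ℕ.* suc k))
          (ℤ.+<+ lt))))
        where
        lt : k ℕ.* 1 ℕ.* 1 ℕ.< 1 ℕ.* (suc d ℕ.* suc k)
        lt = subst₂ ℕ._<_ (sym (trans (ℕₚ.*-identityʳ _) (ℕₚ.*-identityʳ k))) (sym (ℕₚ.*-identityˡ _))
          (ℕₚ.m≤m+n (suc k) (d ℕ.* suc k))
    inv-small (mkℚ -[1+ k ] d c) (ℚ.*≤* ())

    +-cancelʳ-≤ : ∀ r {p q} → p + r ≤ q + r → p ≤ q
    +-cancelʳ-≤ r {p} {q} le = subst₂ _≤_ (cancel p r) (cancel q r) (ℚₚ.+-monoˡ-≤ (- r) le)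
      where
      cancel : ∀ p r → p + r + - r ≡ p
      cancel = solve 2 (λ p r → p :+ r :+ (:- r) := p) refl
        where open ℚSolver.+-*-Solver

    ∣∣-triangle : ∀ x y z w → ∣ x - w ∣ ≤ ∣ x - y ∣ + (∣ y - z ∣ + ∣ w - z ∣)
    ∣∣-triangle x y z w = begin
      ∣ x - w ∣                          ≡⟨ cong ∣_∣ (solve 4 (λ x y z w → x :- w := (x :- y) :+ ((y :- z) :- (w :- z))) refl x y z w) ⟩
      ∣ (x - y) + ((y - z) - (w - z)) ∣  ≤⟨ ∣∣-+-≤ {x - y} ℚₚ.≤-refl (∣∣-‿-≤ {y - z} ℚₚ.≤-refl ℚₚ.≤-refl) ⟩
      ∣ x - y ∣ + (∣ y - z ∣ + ∣ w - z ∣) ∎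
      where
      open ℚₚ.≤-Reasoning
      open ℚSolver.+-*-Solver

    ∣-∣-comm : ∀ x y → ∣ x - y ∣ ≡ ∣ y - x ∣
    ∣-∣-comm x y = trans (cong ∣_∣ (solve 2 (λ x y → x :- y := :- (y :- x)) refl x y)) (ℚₚ.∣-p∣≡∣p∣ (y - x))
      where open ℚSolver.+-*-Solver

    ∣seq∣≤ : ∀ x n → ∣ seq x n ∣ ≤ ∣ seq x 0 ∣ + (1ℚ + 1ℚ)
    ∣seq∣≤ x n = begin
      ∣ seq x n ∣                          ≡⟨ cong ∣_∣ (solve 2 (λ p q → p := q :+ (p :- q)) refl (seq x n) (seq x 0)) ⟩
      ∣ seq x 0 + (seq x n - seq x 0) ∣    ≤⟨ ∣∣-+-≤ {seq x 0} ℚₚ.≤-refl (ℚₚ.≤-trans (regular x n 0)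
                                                (ℚₚ.+-mono-≤ {inv n} {1ℚ} {inv 0} (inv-anti {0} {n} ℕ.z≤n) ℚₚ.≤-refl)) ⟩
      ∣ seq x 0 ∣ + (1ℚ + 1ℚ)              ∎
      where
      open ℚₚ.≤-Reasoning
      open ℚSolver.+-*-Solver

    -- At the witnessing index the distance exceeds the tolerance by `g`, which is at least `inv k`.
    -- One half of `inv k`, namely `inv k′`, absorbs the errors of the later terms; the other half
    -- remains as a lower bound for all of them.
    #⇒Away : ∀ {x y} → x # y → ∃₂ λ D m → ∀ {n} → m ℕ.≤ n → Away D (seq x n - seq y n)
    #⇒Away {x} {y} (i , lt) = + suc k′ / 1 , suc (k′ ℕ.+ k′) , λ {n} m≤n → begin
        1ℚ                                         ≡⟨ *-inv k′ ⟨
        (+ suc k′ / 1) * inv k′                    ≤⟨ ℚₚ.*-monoˡ-≤-nonNeg (+ suc k′ / 1) {{ℚₚ.normalize-nonNeg (suc k′) 1}} (bound m≤n) ⟩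
        (+ suc k′ / 1) * ∣ seq x n - seq y n ∣     ∎
      where
      open ℚₚ.≤-Reasoning
      g : ℚ
      g = ∣ seq x i - seq y i ∣ - (inv i + inv i)
      0<g : 0ℚ < g
      0<g = subst (_< g) (ℚₚ.+-inverseʳ (inv i + inv i)) (ℚₚ.+-monoˡ-< (- (inv i + inv i)) lt)
      k = proj₁ (inv-arch 0<g)
      k′ = suc (k ℕ.+ k)
      bound : ∀ {n} → suc (k′ ℕ.+ k′) ℕ.≤ n → inv k′ ≤ ∣ seq x n - seq y n ∣
      bound {n} m≤n = +-cancelʳ-≤ (inv k′ + (inv i + inv i)) (begin
        inv k′ + (inv k′ + (inv i + inv i))   ≡⟨ ℚₚ.+-assoc (inv k′) (inv k′) (inv i + inv i) ⟨
        inv k′ + inv k′ + (inv i + inv i)     ≡⟨ cong (_+ (inv i + inv i)) (inv-double k) ⟩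
        inv k + (inv i + inv i)               ≤⟨ ℚₚ.+-monoˡ-≤ (inv i + inv i) (proj₂ (inv-arch 0<g)) ⟩
        g + (inv i + inv i)                   ≡⟨ solve 2 (λ a b → a :- b :+ b := a) refl (∣ seq x i - seq y i ∣) (inv i + inv i) ⟩
        ∣ seq x i - seq y i ∣                 ≤⟨ ∣∣-triangle (seq x i) (seq x n) (seq y n) (seq y i) ⟩
        ∣ seq x i - seq x n ∣ + (∣ seq x n - seq y n ∣ + ∣ seq y i - seq y n ∣)
          ≤⟨ ℚₚ.+-mono-≤ (regular x i n) (ℚₚ.+-monoʳ-≤ (∣ seq x n - seq y n ∣) (regular y i n)) ⟩
        (inv i + inv n) + (∣ seq x n - seq y n ∣ + (inv i + inv n))
          ≡⟨ solve 3 (λ a b c → (a :+ b) :+ (c :+ (a :+ b)) := c :+ ((b :+ b) :+ (a :+ a))) refl (inv i) (inv n) (∣ seq x n - seq y n ∣) ⟩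
        ∣ seq x n - seq y n ∣ + ((inv n + inv n) + (inv i + inv i))
          ≤⟨ ℚₚ.+-monoʳ-≤ (∣ seq x n - seq y n ∣) (ℚₚ.+-monoˡ-≤ (inv i + inv i)
               (ℚₚ.≤-trans (ℚₚ.+-mono-≤ (inv-anti m≤n) (inv-anti m≤n)) (ℚₚ.≤-reflexive (inv-double k′)))) ⟩
        ∣ seq x n - seq y n ∣ + (inv k′ + (inv i + inv i)) ∎)
        where open ℚSolver.+-*-Solver

    -- Every addition moves its summands to a later index, so the terms of a nested sum are taken at
    -- different indices. All of these are at least `n`, and regularity compares each term with the
    -- `n`-th one; `j` is arbitrary for the sake of the induction.
    ∣seq-sumℝ∣≤ : ∀ (h : A → ℝ) xs {j n} → n ℕ.≤ j →
      ∣ seq (sumℝ (map h xs)) j - ∑ xs (λ x → seq (h x) n) ∣ ≤ lengthℚ xs * (inv n + inv n)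
    ∣seq-sumℝ∣≤ h []       {j} {n} n≤j = ℚₚ.≤-reflexive (sym (ℚₚ.*-zeroˡ (inv n + inv n)))
    ∣seq-sumℝ∣≤ h (x ∷ xs) {j} {n} n≤j = begin
      ∣ (seq (h x) j′ + seq S j′) - (seq (h x) n + T) ∣
        ≡⟨ cong ∣_∣ (solve 4 (λ a b c d → (a :+ b) :- (c :+ d) := (a :- c) :+ (b :- d)) refl (seq (h x) j′) (seq S j′) (seq (h x) n) T) ⟩
      ∣ (seq (h x) j′ - seq (h x) n) + (seq S j′ - T) ∣
        ≤⟨ ∣∣-+-≤ {seq (h x) j′ - seq (h x) n} (ℚₚ.≤-trans (regular (h x) j′ n) (ℚₚ.+-monoˡ-≤ (inv n) (inv-anti n≤j′)))
             (∣seq-sumℝ∣≤ h xs n≤j′) ⟩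
      (inv n + inv n) + lengthℚ xs * (inv n + inv n)
        ≡⟨ solve 2 (λ a l → a :+ l :* a := (con 1ℚ :+ l) :* a) refl (inv n + inv n) (lengthℚ xs) ⟩
      lengthℚ (x ∷ xs) * (inv n + inv n) ∎
      where
      open ℚₚ.≤-Reasoning
      open ℚSolver.+-*-Solver
      S = sumℝ (map h xs)
      T = ∑ xs (λ x → seq (h x) n)
      j′ = suc (j ℕ.+ j)
      n≤j′ : n ℕ.≤ j′
      n≤j′ = ℕₚ.≤-trans n≤j (ℕₚ.≤-trans (ℕₚ.m≤m+n j j) (ℕₚ.n≤1+n (j ℕ.+ j)))

  -- Weightings from triangles

  perm-congᴬ : ∀ {p q : A → B → ℚ} {as} bs → All (λ a → ∀ b → p a b ≡ q a b) as → perm p as bs ≡ perm q as bs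
  perm-congᴬ []       []         = refl
  perm-congᴬ (_ ∷ _)  []         = refl
  perm-congᴬ bs       (eq ∷ eqs) = ∑-cong (picks bs) λ (b , bs′) → cong₂ _*_ (eq b) (perm-congᴬ bs′ eqs)

  perm-map : ∀ (p : A → B → ℚ) (h : C → A) cs bs → perm p (map h cs) bs ≡ perm (p ∘ h) cs bs
  perm-map p h []       []       = refl
  perm-map p h []       (_ ∷ _)  = refl
  perm-map p h (c ∷ cs) bs       = ∑-cong (picks bs) λ (b , bs′) → cong (p (h c) b *_) (perm-map p h cs bs′)

  lookup-count : ∀ {m} (ds : List (Fin m)) e → lookup (count ds) e ≡ ℕΣ.∑ ds (λ d → ℕΣ.δ d e)
  lookup-count []       e = Vecₚ.lookup-replicate e 0
  lookup-count (d ∷ ds) e with d Fin.≟ e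
  ... | yes refl = trans (Vecₚ.lookup∘updateAt d (count ds)) (cong suc (lookup-count ds d))
  ... | no  d≢e  = trans (Vecₚ.lookup∘updateAt′ e d (d≢e ∘ sym) (count ds)) (lookup-count ds e)

  ∑ℕ-∈-≤ : ∀ {x : A} {xs} (f : A → ℕ) → x L.∈ xs → f x ℕ.≤ ℕΣ.∑ xs f
  ∑ℕ-∈-≤ {xs = _ ∷ xs} f (here refl) = ℕₚ.m≤m+n _ _
  ∑ℕ-∈-≤ {xs = y ∷ xs} f (there x∈)  = ℕₚ.≤-trans (∑ℕ-∈-≤ f x∈) (ℕₚ.m≤n+m _ (f y))

  ∑-filter : ∀ {P : A → Set} (P? : ∀ x → Dec (P x)) (χ : A → ℚ) →
    (∀ {x} → P x → χ x ≡ 1ℚ) → (∀ {x} → ¬ P x → χ x ≡ 0ℚ) →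
    ∀ xs (f : A → ℚ) → ∑ (filter P? xs) f ≡ ∑ xs (λ x → χ x * f x)
  ∑-filter P? χ χ1 χ0 []       f = refl
  ∑-filter P? χ χ1 χ0 (x ∷ xs) f with P? x
  ... | yes px = cong₂ _+_ (sym (trans (cong (_* f x) (χ1 px)) (ℚₚ.*-identityˡ (f x)))) (∑-filter P? χ χ1 χ0 xs f)
  ... | no ¬px = trans (∑-filter P? χ χ1 χ0 xs f)
    (trans (sym (ℚₚ.+-identityˡ _)) (cong (_+ ∑ xs (λ x → χ x * f x)) (sym (trans (cong (_* f x) (χ0 ¬px)) (ℚₚ.*-zeroˡ (f x))))))

  δ-sym : ∀ {n} (i j : Fin n) → δ i j ≡ δ j i
  δ-sym i j with i Fin.≟ j
  ... | yes refl = sym (δ-refl i)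
  ... | no  i≢j  = sym (δ-≢ (i≢j ∘ sym))

  module _ {n : ℕ} (G : Graph n) where

    open Graph G

    Joins : Edge G → Vertex G → Vertex G → Set
    Joins e u v = ends e ≡ (u , v) ⊎ ends e ≡ (v , u)

    Triangle : Set
    Triangle = Edge G × Edge G × Edge G

    -- The boundary of e is the difference of the unsigned boundaries of g and h.
    IsTriangle : Triangle → Set
    IsTriangle (e , g , h) = ∃ λ w → Joins g (proj₁ (ends e)) w × Joins h (proj₂ (ends e)) w

    incidence : Vertex G → Edge G → ℚ
    incidence i e = δ (proj₁ (ends e)) i + δ (proj₂ (ends e)) i

    -- The derivative, in the weight of an edge, of the difference between the weight sums at two
    -- vertices.
    coefficient : Vertex G × Vertex G → Edge G → ℚ
    coefficient (u , v) e = incidence u e - incidence v e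

    private
      ends-≢ : ∀ e → proj₁ (ends e) ≢ proj₂ (ends e)
      ends-≢ e eq = ℕₚ.<-irrefl (cong toℕ eq) (ordered e)

      incidence-1 : ∀ {i e} → Incident G i e → incidence i e ≡ 1ℚ
      incidence-1 {e = e} (inj₁ refl) = cong₂ _+_ (δ-refl (proj₁ (ends e))) (δ-≢ {i = proj₂ (ends e)} (ends-≢ e ∘ sym))
      incidence-1 {e = e} (inj₂ refl) = cong₂ _+_ (δ-≢ {i = proj₁ (ends e)} (ends-≢ e)) (δ-refl (proj₂ (ends e)))

      incidence-0 : ∀ {i e} → ¬ Incident G i e → incidence i e ≡ 0ℚ
      incidence-0 {i} {e} ¬inc = cong₂ _+_ (δ-≢ {i = proj₁ (ends e)} {i} (¬inc ∘ inj₁)) (δ-≢ {i = proj₂ (ends e)} {i} (¬inc ∘ inj₂))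

      incidence-Joins : ∀ {e u v} → Joins e u v → ∀ i → incidence i e ≡ δ u i + δ v i
      incidence-Joins (inj₁ eq) i = cong (λ (u , v) → δ u i + δ v i) eq
      incidence-Joins {e} {u} {v} (inj₂ eq) i = trans (cong (λ (u , v) → δ u i + δ v i) eq) (ℚₚ.+-comm (δ v i) (δ u i))

    gram-coefficient : ∀ {t} → IsTriangle t → ∀ f →
      gram (ends (proj₁ t)) f ≡ coefficient f (proj₁ (proj₂ t)) - coefficient f (proj₂ (proj₂ t))
    gram-coefficient {e , g , h} (w , uw , vw) (x , y) = begin
      ∑ (allFin n) (λ z → (δ z u - δ z v) * b z)
        ≡⟨ ∑-cong (allFin n) (λ z → trans (cong₂ (λ p q → (p - q) * b z) (δ-sym z u) (δ-sym z v))
             (solve 3 (λ p q r → (p :- q) :* r := p :* r :+ (q :* (:- r))) refl (δ u z) (δ v z) (b z))) ⟩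
      ∑ (allFin n) (λ z → δ u z * b z + δ v z * - b z)
        ≡⟨ trans (∑-distrib-+ (allFin n) _ _) (cong₂ _+_ (∑-δ u b) (∑-δ v (-_ ∘ b))) ⟩
      (δ u x - δ u y) + - (δ v x - δ v y)
        -- The contributions of the apex are inserted; they are the same for both legs and cancel.
        ≡⟨ solve 6 (λ a b c d p q → (a :- b) :+ (:- (c :- d)) := ((a :+ p) :- (b :+ q)) :- ((c :+ p) :- (d :+ q)))
             refl (δ u x) (δ u y) (δ v x) (δ v y) (δ w x) (δ w y) ⟩
      ((δ u x + δ w x) - (δ u y + δ w y)) - ((δ v x + δ w x) - (δ v y + δ w y))
        ≡⟨ cong₂ _-_ (cong₂ _-_ (incidence-Joins uw x) (incidence-Joins uw y)) (cong₂ _-_ (incidence-Joins vw x) (incidence-Joins vw y)) ⟨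
      coefficient (x , y) g - coefficient (x , y) h ∎
      where
      open ≡-Reasoning
      open ℚSolver.+-*-Solver
      u = proj₁ (ends e)
      v = proj₂ (ends e)
      b : Vertex G → ℚ
      b z = δ z x - δ z y

    -- Both legs are counted although only one is chosen, so a bound on the load bounds the
    -- exponents for every choice.
    load : List Triangle → Edge G → ℕ
    load ts d = ℕΣ.∑ ts λ (_ , g , h) → ℕΣ.δ g d ℕ.+ ℕΣ.δ h d

    coefficient-perm : ∀ ts → All IsTriangle ts → (∀ d → load ts d ℕ.≤ 3) →
      ∃ λ ds → length (map (ends ∘ proj₁) ts) ≡ length ds × (∀ d → lookup (count ds) d ℕ.≤ 3) ×
        perm coefficient (map (ends ∘ proj₁) ts) ds ≢ 0ℚ
    coefficient-perm ts tri load≤3 = legs (perm-choose (flip coefficient) (proj₁ ∘ proj₂) (proj₂ ∘ proj₂) ts fs gram≢0)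
      where
      fs = map (ends ∘ proj₁) ts
      legs-perm : Triangle → Vertex G × Vertex G → ℚ
      legs-perm (_ , g , h) f = coefficient f g - coefficient f h

      gram≡ : perm gram fs fs ≡ perm legs-perm ts fs
      gram≡ = trans (perm-map gram (ends ∘ proj₁) ts fs)
        (perm-congᴬ fs (All.map (λ {t} → gram-coefficient {t}) tri))

      gram≢0 : perm legs-perm ts fs ≢ 0ℚ
      gram≢0 eq = perm-gram-≢0 fs (Allₚ.map⁺ (All.universal (ordered ∘ proj₁) ts)) (trans gram≡ eq)

      chosen : ∀ {ds ts} → Pointwise (λ d (t : Triangle) → d ≡ proj₁ (proj₂ t) ⊎ d ≡ proj₂ (proj₂ t)) ds ts →
        ∀ d → ℕΣ.∑ ds (λ d′ → ℕΣ.δ d′ d) ℕ.≤ load ts d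
      chosen []                _ = ℕ.z≤n
      chosen (inj₁ refl ∷ chs) d = ℕₚ.+-mono-≤ (ℕₚ.m≤m+n _ _) (chosen chs d)
      chosen (inj₂ refl ∷ chs) d = ℕₚ.+-mono-≤ (ℕₚ.m≤n+m _ _) (chosen chs d)

      legs : (∃ λ ds → Pointwise (λ d (t : Triangle) → d ≡ proj₁ (proj₂ t) ⊎ d ≡ proj₂ (proj₂ t)) ds ts ×
          perm (flip coefficient) ds fs ≢ 0ℚ) →
        ∃ λ ds → length fs ≡ length ds × (∀ d → lookup (count ds) d ℕ.≤ 3) × perm coefficient fs ds ≢ 0ℚ
      legs (ds , ch , nz) = ds , trans (Listₚ.length-map (ends ∘ proj₁) ts) (sym (Pointwise.Pointwise-length ch)) ,
        (λ d → ℕₚ.≤-trans (ℕₚ.≤-reflexive (lookup-count ds d)) (ℕₚ.≤-trans (chosen ch d) (load≤3 d))) ,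
        -- `perm-choose` splits rows, so there the legs index the rows; in the Nullstellensatz the
        -- rows are the linear forms.
        λ eq → nz (trans (perm-transpose (flip coefficient) ds fs) eq)

    -- From rational approximations to a proper weighting

    module _ (LV : Vertex G → RealSet 1) (LE : Edge G → RealSet 4) where

      private
        points : ℕ → Edge G → Points
        points k e t = seq (elem (LE e) t) k

        value : ℕ → Vertex G → ℚ
        value k v = seq (elem (LV v) zero) k

        bound₀ : ℝ → ℚ
        bound₀ x = ∣ seq x 0 ∣ + (1ℚ + 1ℚ)

        0≤bound₀ : ∀ x → 0ℚ ≤ bound₀ x
        0≤bound₀ x = ℚₚ.≤-trans (ℚₚ.0≤∣p∣ (seq x 0)) (ℚₚ.≤-trans (ℚₚ.≤-reflexive (sym (ℚₚ.+-identityʳ (∣ seq x 0 ∣))))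
          (ℚₚ.+-monoʳ-≤ (∣ seq x 0 ∣) (ℚₚ.nonNegative⁻¹ (1ℚ + 1ℚ))))

        edge-bound : Edge G → ℚ
        edge-bound e = ∑ (allFin 4) λ t → bound₀ (elem (LE e) t)

        vertex-bound : Vertex G → ℚ
        vertex-bound v = bound₀ (elem (LV v) zero)

        -- Sums of non-negative bounds stand in for maxima, here and in `D`, `threshold` and
        -- `maxDegree`.
        Mₑ Mᵥ M : ℚ
        Mₑ = ∑ (allFin size) edge-bound
        Mᵥ = ∑ (allFin n) vertex-bound
        M  = Mₑ + Mᵥ

        0≤edge-bound : ∀ e → 0ℚ ≤ edge-bound e
        0≤edge-bound e = ∑-nonNeg (All.universal (λ t → 0≤bound₀ (elem (LE e) t)) (allFin 4))

        points-bounded : ∀ k e → BoundedPoints M (points k e)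
        points-bounded k e t = ℚₚ.≤-trans (∣seq∣≤ (elem (LE e) t) k)
          (ℚₚ.≤-trans (∑-∈-≤ (λ t → bound₀ (elem (LE e) t)) (λ t → 0≤bound₀ (elem (LE e) t)) (Lₚ.∈-allFin t))
          (ℚₚ.≤-trans (∑-∈-≤ edge-bound 0≤edge-bound (Lₚ.∈-allFin e))
            (p≤p+q (∑-nonNeg (All.universal (λ v → 0≤bound₀ (elem (LV v) zero)) (allFin n))))))

        value-bounded : ∀ k v → ∣ value k v ∣ ≤ M
        value-bounded k v = ℚₚ.≤-trans (∣seq∣≤ (elem (LV v) zero) k)
          (ℚₚ.≤-trans (∑-∈-≤ vertex-bound (λ v → 0≤bound₀ (elem (LV v) zero)) (Lₚ.∈-allFin v))
            (p≤q+p (∑-nonNeg (All.universal 0≤edge-bound (allFin size)))))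

        -- The sign of `D` is recorded because each constant is later compared with the sum of all
        -- of them. Coinciding indices get the default 0.
        Separation : Edge G → Fin 4 → Fin 4 → Set
        Separation e t t′ = ∃₂ λ D m → 0ℚ ≤ D × (t ≢ t′ → ∀ {k} → m ℕ.≤ k → Away D (points k e t - points k e t′))

        separation : ∀ e t t′ → Separation e t t′
        separation e t t′ = by-cases (t Fin.≟ t′)
          where
          x = elem (LE e) t
          y = elem (LE e) t′
          apart : (∃₂ λ D m → ∀ {k} → m ℕ.≤ k → Away D (seq x k - seq y k)) → Separation e t t′
          apart (D , m , aw) = D , m , Away⇒0≤ {D} {seq x m - seq y m} (aw ℕₚ.≤-refl) , λ _ → aw
          by-cases : Dec (t ≡ t′) → Separation e t t′
          by-cases (yes t≡t′) = 0ℚ , 0 , ℚₚ.≤-refl , λ t≢t′ → contradiction t≡t′ t≢t′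
          by-cases (no  t≢t′) = apart (#⇒Away {x} {y} (distinct (LE e) t≢t′))

        triples : (Edge G → Fin 4 → Fin 4 → ℚ) → ℚ
        triples f = ∑ (allFin size) λ e → ∑ (allFin 4) λ t → ∑ (allFin 4) λ t′ → f e t t′

        triples-≥ : ∀ f → (∀ e t t′ → 0ℚ ≤ f e t t′) → ∀ e t t′ → f e t t′ ≤ triples f
        triples-≥ f 0≤f e t t′ =
          ℚₚ.≤-trans (∑-∈-≤ (f e t) (0≤f e t) (Lₚ.∈-allFin t′))
          (ℚₚ.≤-trans (∑-∈-≤ (λ t → ∑ (allFin 4) (f e t)) (0≤f₁ e) (Lₚ.∈-allFin t))
          (∑-∈-≤ (λ e → ∑ (allFin 4) λ t → ∑ (allFin 4) (f e t))
            (λ e → ∑-nonNeg (All.universal (0≤f₁ e) (allFin 4))) (Lₚ.∈-allFin e)))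
          where
          0≤f₁ : ∀ e t → 0ℚ ≤ ∑ (allFin 4) (f e t)
          0≤f₁ e t = ∑-nonNeg (All.universal (0≤f e t) (allFin 4))

        D : ℚ
        D = triples λ e t t′ → proj₁ (separation e t t′)

        threshold : ℕ
        threshold = ℕΣ.∑ (allFin size) λ e → ℕΣ.∑ (allFin 4) λ t → ℕΣ.∑ (allFin 4) λ t′ → proj₁ (proj₂ (separation e t t′))

        points-separated : ∀ {k} → threshold ℕ.≤ k → ∀ e → SeparatedPoints D (points k e)
        points-separated {k} thr≤k e {t} {t′} t≢t′ = Away-weaken (points k e t - points k e t′)
          (triples-≥ (λ e t t′ → proj₁ (separation e t t′)) (λ e t t′ → proj₁ (proj₂ (proj₂ (separation e t t′)))) e t t′)
          (proj₂ (proj₂ (proj₂ (separation e t t′))) t≢t′ (ℕₚ.≤-trans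
            (ℕₚ.≤-trans (∑ℕ-∈-≤ (λ t′ → proj₁ (proj₂ (separation e t t′))) (Lₚ.∈-allFin t′))
              (ℕₚ.≤-trans (∑ℕ-∈-≤ (λ t → ℕΣ.∑ (allFin 4) λ t′ → proj₁ (proj₂ (separation e t t′))) (Lₚ.∈-allFin t))
                (∑ℕ-∈-≤ (λ e → ℕΣ.∑ (allFin 4) λ t → ℕΣ.∑ (allFin 4) λ t′ → proj₁ (proj₂ (separation e t t′))) (Lₚ.∈-allFin e))))
            thr≤k))

        maxDegree : ℚ
        maxDegree = ∑ (allFin n) λ v → lengthℚ (incidentEdges G v)

        0≤lengthℚ : ∀ (xs : List A) → 0ℚ ≤ lengthℚ xs
        0≤lengthℚ xs = ∑-nonNeg (All.universal (λ _ → ℚₚ.nonNegative⁻¹ 1ℚ) xs)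

        lengthℚ≤maxDegree : ∀ v → lengthℚ (incidentEdges G v) ≤ maxDegree
        lengthℚ≤maxDegree v = ∑-∈-≤ (λ v → lengthℚ (incidentEdges G v)) (λ v → 0≤lengthℚ (incidentEdges G v)) (Lₚ.∈-allFin v)

        weighting : Vec (Fin 4) size → TotalWeighting G
        weighting τ (inj₁ v) = elem (LV v) zero
        weighting τ (inj₂ e) = elem (LE e) (lookup τ e)

        S : ℕ → Vec (Fin 4) size → Vertex G → ℚ
        S k τ v = ∑ (incidentEdges G v) (λ e → points k e (lookup τ e)) + value k v

        error : ℕ → ℚ
        error k = (maxDegree + 1ℚ) * (inv k + inv k)

        weightAt-error : ∀ k τ v → ∣ seq (weightAt G (weighting τ) v) k - S k τ v ∣ ≤ error k
        weightAt-error k τ v = begin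
          ∣ (seq s k′ + seq x k′) - (T + seq x k) ∣
            ≡⟨ cong ∣_∣ (solve 4 (λ a b c d → (a :+ b) :- (c :+ d) := (a :- c) :+ (b :- d)) refl (seq s k′) (seq x k′) T (seq x k)) ⟩
          ∣ (seq s k′ - T) + (seq x k′ - seq x k) ∣
            ≤⟨ ∣∣-+-≤ {seq s k′ - T} (∣seq-sumℝ∣≤ (weighting τ ∘ inj₂) (incidentEdges G v) k≤k′)
                 (ℚₚ.≤-trans (regular x k′ k) (ℚₚ.+-monoˡ-≤ (inv k) (inv-anti k≤k′))) ⟩
          lengthℚ (incidentEdges G v) * (inv k + inv k) + (inv k + inv k)
            ≡⟨ solve 2 (λ l a → l :* a :+ a := (l :+ con 1ℚ) :* a) refl (lengthℚ (incidentEdges G v)) (inv k + inv k) ⟩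
          (lengthℚ (incidentEdges G v) + 1ℚ) * (inv k + inv k)
            ≤⟨ ℚₚ.*-monoʳ-≤-nonNeg (inv k + inv k) {{ℚ.nonNegative (ℚₚ.+-mono-≤ (0≤inv k) (0≤inv k))}}
                 (ℚₚ.+-monoˡ-≤ 1ℚ (lengthℚ≤maxDegree v)) ⟩
          error k ∎
          where
          open ℚₚ.≤-Reasoning
          open ℚSolver.+-*-Solver
          s = sumℝ (map (weighting τ ∘ inj₂) (incidentEdges G v))
          T = ∑ (incidentEdges G v) (λ e → points k e (lookup τ e))
          x = elem (LV v) zero
          k′ = suc (k ℕ.+ k)
          k≤k′ : k ℕ.≤ k′
          k≤k′ = ℕₚ.≤-trans (ℕₚ.m≤m+n k k) (ℕₚ.n≤1+n (k ℕ.+ k))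

        difference : ℕ → Vertex G × Vertex G → ℚ
        difference k (u , v) = value k u - value k v

        form-S : ∀ k τ u v → form (points k) (difference k) coefficient (u , v) τ ≡ S k τ u - S k τ v
        form-S k τ u v = begin
          (value k u - value k v) + ∑ (allFin size) (λ e → (incidence u e - incidence v e) * x e)
            ≡⟨ cong (λ r → (value k u - value k v) + r) (trans (∑-cong (allFin size) (λ e → split (incidence u e) (incidence v e) (x e)))
                 (trans (∑-distrib-+ (allFin size) (λ e → incidence u e * x e) (λ e → - 1ℚ * (incidence v e * x e)))
                   (cong (λ r → X u + r) (∑-distribˡ-* (allFin size) (- 1ℚ) (λ e → incidence v e * x e))))) ⟩
          (value k u - value k v) + (X u + - 1ℚ * X v)
            ≡⟨ solve 4 (λ a b c d → (a :- b) :+ (c :+ con (- 1ℚ) :* d) := (c :+ a) :- (d :+ b)) refl (value k u) (value k v) (X u) (X v) ⟩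
          (X u + value k u) - (X v + value k v)
            ≡⟨ cong₂ (λ p q → (p + value k u) - (q + value k v)) (filtered u) (filtered v) ⟨
          S k τ u - S k τ v ∎
          where
          open ≡-Reasoning
          open ℚSolver.+-*-Solver
          x : Edge G → ℚ
          x e = points k e (lookup τ e)
          split : ∀ i j x → (i - j) * x ≡ i * x + - 1ℚ * (j * x)
          split = solve 3 (λ i j x → (i :- j) :* x := i :* x :+ con (- 1ℚ) :* (j :* x)) refl
          X : Vertex G → ℚ
          X v = ∑ (allFin size) (λ e → incidence v e * x e)
          filtered : ∀ v → ∑ (incidentEdges G v) x ≡ X v
          filtered v = ∑-filter (incident? G v) (incidence v) (incidence-1 {v}) (incidence-0 {v}) (allFin size) x

        -- `q N * inv k` is `N` times the sum of two approximation errors and the tolerance of `_#_`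
        -- at index `k`.
        q : ℚ → ℚ
        q N = N * (ι 2 + (ι 2 * (maxDegree + 1ℚ) * ι 2))

        0≤maxDegree : 0ℚ ≤ maxDegree
        0≤maxDegree = ∑-nonNeg (All.universal (λ v → 0≤lengthℚ (incidentEdges G v)) (allFin n))

        0≤q : ∀ {N} → 0ℚ ≤ N → 0ℚ ≤ q N
        0≤q {N} 0≤N = 0≤* 0≤N (ℚₚ.+-mono-≤ (ℚₚ.nonNegative⁻¹ (ι 2))
          (0≤* (0≤* (ℚₚ.nonNegative⁻¹ (ι 2)) (ℚₚ.+-mono-≤ 0≤maxDegree (ℚₚ.nonNegative⁻¹ 1ℚ))) (ℚₚ.nonNegative⁻¹ (ι 2))))
          where
          0≤* : ∀ {x y} → 0ℚ ≤ x → 0ℚ ≤ y → 0ℚ ≤ x * y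
          0≤* {x} {y} 0≤x 0≤y = subst (_≤ x * y) (ℚₚ.*-zeroˡ y) (ℚₚ.*-monoʳ-≤-nonNeg y {{ℚ.nonNegative 0≤y}} 0≤x)

        Away⇒# : ∀ {N} → 0ℚ ≤ N → ∀ k τ u v → q N * inv k < 1ℚ → Away N (S k τ u - S k τ v) →
          weightAt G (weighting τ) u # weightAt G (weighting τ) v
        -- The witness of apartness is the precision at which the search takes place.
        Away⇒# {N} 0≤N k τ u v small aw = k , ℚₚ.≰⇒> λ close → ℚₚ.<-irrefl refl (ℚₚ.≤-<-trans aw (ℚₚ.≤-<-trans (begin
          N * ∣ S k τ u - S k τ v ∣
            ≤⟨ ℚₚ.*-monoˡ-≤-nonNeg N {{ℚ.nonNegative 0≤N}} (ℚₚ.≤-trans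
                 (∣∣-triangle (S k τ u) (seq wu k) (seq wv k) (S k τ v))
                 (ℚₚ.+-mono-≤ (subst (_≤ error k) (∣-∣-comm (seq wu k) (S k τ u)) (weightAt-error k τ u))
                   (ℚₚ.+-mono-≤ close (subst (_≤ error k) (∣-∣-comm (seq wv k) (S k τ v)) (weightAt-error k τ v))))) ⟩
          N * (error k + ((inv k + inv k) + error k))
            ≡⟨ solve 3 (λ N d i → N :* ((d :+ con 1ℚ) :* (i :+ i) :+ ((i :+ i) :+ (d :+ con 1ℚ) :* (i :+ i)))
                 := N :* (con (ι 2) :+ (con (ι 2) :* (d :+ con 1ℚ) :* con (ι 2))) :* i) refl N maxDegree (inv k) ⟩
          q N * inv k ∎) small))
          where
          open ℚₚ.≤-Reasoning
          open ℚSolver.+-*-Solver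
          wu = weightAt G (weighting τ) u
          wv = weightAt G (weighting τ) v

      choose : ∀ ts → All IsTriangle ts → (∀ d → load ts d ℕ.≤ 3) → (∀ e → e L.∈ map proj₁ ts) →
        ∃ λ (φ : TotalWeighting G) → Proper G φ × (∀ v → φ (inj₁ v) ∈ LV v) × (∀ e → φ (inj₂ e) ∈ LE e)
      choose ts tri load≤3 all∈ts =
        weighting τ , proper , (λ v → zero , ≃-refl (elem (LV v) zero)) , (λ e → lookup τ e , ≃-refl (elem (LE e) (lookup τ e)))
        where
        chosen : ∃ λ ds → length (map (ends ∘ proj₁) ts) ≡ length ds × (∀ d → lookup (count ds) d ℕ.≤ 3) ×
          perm coefficient (map (ends ∘ proj₁) ts) ds ≢ 0ℚ
        chosen = coefficient-perm ts tri load≤3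

        Solution : ℚ → Set
        Solution N = ∀ {a c} → (∀ e → BoundedPoints M (a e)) → (∀ e → SeparatedPoints D (a e)) → (∀ b → ∣ c b ∣ ≤ M + M) →
          ∃ λ τ → All (λ b → Away N (form a c coefficient b τ)) (map (ends ∘ proj₁) ts)

        solution : ∃ Solution
        solution = nullstellensatz coefficient M D (map (ends ∘ proj₁) ts) (proj₁ chosen)
          (proj₁ (proj₂ chosen)) (proj₁ (proj₂ (proj₂ chosen))) (proj₂ (proj₂ (proj₂ chosen)))

        N N₊ : ℚ
        N  = proj₁ solution
        -- `Solution N` says nothing about the sign of `N`, whereas `inv-small` is applied to a
        -- non-negative constant.
        N₊ = N ℚ.⊔ 0ℚ

        0≤N₊ : 0ℚ ≤ N₊
        0≤N₊ = ℚₚ.p≤q⊔p N 0ℚ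

        small : ∃ λ m → ∀ {j} → m ℕ.≤ j → q N₊ * inv j < 1ℚ
        small = inv-small (q N₊) (0≤q {N₊} 0≤N₊)

        k : ℕ
        -- At this precision the points of every edge are separated and the errors are small against
        -- `N₊`, which was fixed without reference to `k`.
        k = proj₁ small ℕ.⊔ threshold

        solved : ∃ λ τ → All (λ b → Away N (form (points k) (difference k) coefficient b τ)) (map (ends ∘ proj₁) ts)
        solved = proj₂ solution {points k} {difference k} (points-bounded k)
          (points-separated (ℕₚ.m≤n⊔m (proj₁ small) threshold))
          (λ (u , v) → ∣∣-‿-≤ {value k u} (value-bounded k u) (value-bounded k v))

        τ : Vec (Fin 4) size
        τ = proj₁ solved

        ≃-refl : ∀ x → x ≃ x
        ≃-refl x j = subst (λ z → ∣ z ∣ ≤ inv j + inv j) (sym (ℚₚ.+-inverseʳ (seq x j)))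
          (ℚₚ.+-mono-≤ (0≤inv j) (0≤inv j))

        away-at : ∀ {e ts} → e L.∈ map proj₁ ts →
          All (λ p → Away N (form (points k) (difference k) coefficient p τ)) (map (ends ∘ proj₁) ts) →
          Away N (form (points k) (difference k) coefficient (ends e) τ)
        away-at {ts = _ ∷ _}  (here refl) (a ∷ _)  = a
        away-at {ts = _ ∷ _}  (there e∈)  (_ ∷ as) = away-at e∈ as

        proper : Proper G (weighting τ)
        proper e = Away⇒# {N₊} 0≤N₊ k τ u v (proj₂ small (ℕₚ.m≤m⊔n (proj₁ small) threshold))
          (Away-weaken (S k τ u - S k τ v) (ℚₚ.p≤p⊔q N 0ℚ) (subst (Away N) (form-S k τ u v) (away-at (all∈ts e) (proj₂ solved))))
          where
          u = proj₁ (ends e)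
          v = proj₂ (ends e)

    triangles⇒choosable : ∀ ts → All IsTriangle ts → (∀ d → load ts d ℕ.≤ 3) → (∀ e → e L.∈ map proj₁ ts) →
      TotalWeightChoosable G 1 4
    triangles⇒choosable ts tri load≤3 all∈ts LV LE = choose LV LE ts tri load≤3 all∈ts

module Combinatorial where

  open import Data.Nat using (_+_; _*_; _∸_; _≤_; _<_; z≤n; s≤s)
  open Algebraic using (Joins; IsTriangle; Triangle; ∑ℕ-∈-≤; load; triangles⇒choosable)
  open ℕΣ

  private variable
    A : Set
    P : Set
    n : ℕ

  -- Sums of natural numbers and the cyclic triangle system

  ∑-mono : ∀ (xs : List A) {f g : A → ℕ} → (∀ x → f x ≤ g x) → ∑ xs f ≤ ∑ xs g
  ∑-mono []       f≤g = z≤n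
  ∑-mono (x ∷ xs) f≤g = ℕₚ.+-mono-≤ (f≤g x) (∑-mono xs f≤g)

  ∑-filter-≤ : ∀ {Q : A → Set} (Q? : ∀ x → Dec (Q x)) xs (f : A → ℕ) → ∑ (filter Q? xs) f ≤ ∑ xs f
  ∑-filter-≤ Q? []       f = z≤n
  ∑-filter-≤ Q? (x ∷ xs) f with Q? x
  ... | yes _ = ℕₚ.+-monoʳ-≤ (f x) (∑-filter-≤ Q? xs f)
  ... | no  _ = ℕₚ.≤-trans (∑-filter-≤ Q? xs f) (ℕₚ.m≤n+m _ (f x))

  ∑-const : ∀ n → ∑ (allFin n) (const 1) ≡ n
  ∑-const zero    = refl
  ∑-const (suc n) = trans (∑-allFin-suc n (const 1)) (cong suc (∑-const n))

  indicator : Dec P → ℕ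
  indicator (yes _) = 1
  indicator (no  _) = 0

  -- Pigeonhole principle for the choice of an apex: `f` will count the obstructions at each
  -- candidate.
  ∑<⇒∃0 : ∀ (f : Fin n → ℕ) → ∑ (allFin n) f < n → ∃ λ i → f i ≡ 0
  ∑<⇒∃0 {n} f lt with Finₚ.any? (λ i → f i ℕ.≟ 0)
  ... | yes found = found
  ... | no  none  = contradiction lt (ℕₚ.≤⇒≯ (ℕₚ.≤-trans (ℕₚ.≤-reflexive (sym (∑-const n)))
    (∑-mono (allFin n) λ i → ℕₚ.n≢0⇒n>0 λ fi≡0 → none (i , fi≡0))))

  ∑-unique : ∀ (f : Fin n → ℕ) → (∀ i → f i ≤ 1) → (∀ {i j} → f i ≢ 0 → f j ≢ 0 → i ≡ j) → ∑ (allFin n) f ≤ 1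
  ∑-unique {n} f f≤1 unique with Finₚ.any? (λ i → ¬? (f i ℕ.≟ 0))
  ... | yes (i , fi≢0) = ℕₚ.≤-trans (ℕₚ.≤-reflexive (trans (∑-cong (allFin n) only) (∑-δ i f))) (f≤1 i)
    where
    only : ∀ j → f j ≡ δ i j * f j
    only j with i Fin.≟ j
    ... | yes _   = sym (ℕₚ.*-identityˡ (f j))
    ... | no  i≢j with f j ℕ.≟ 0
    ...   | yes fj≡0 = fj≡0
    ...   | no  fj≢0 = contradiction (unique fi≢0 fj≢0) i≢j
  ... | no  none = ℕₚ.≤-trans (ℕₚ.≤-reflexive (∑-zero (All.universal zero-at (allFin n)))) z≤n
    where
    zero-at : ∀ i → f i ≡ 0
    zero-at i with f i ℕ.≟ 0
    ... | yes fi≡0 = fi≡0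
    ... | no  fi≢0 = contradiction (i , fi≢0) none

  ∑≢0 : ∀ (f : Fin n → ℕ) → ∑ (allFin n) f ≢ 0 → ∃ λ i → f i ≢ 0
  ∑≢0 {n} f ≢0 with Finₚ.any? (λ i → ¬? (f i ℕ.≟ 0))
  ... | yes found = found
  ... | no  none  = contradiction (∑-zero (All.universal zero-at (allFin n))) ≢0
    where
    zero-at : ∀ i → f i ≡ 0
    zero-at i with f i ℕ.≟ 0
    ... | yes fi≡0 = fi≡0
    ... | no  fi≢0 = contradiction (i , fi≢0) none

  ∑-involution : ∀ (σ : Fin n → Fin n) → (∀ i → σ (σ i) ≡ i) → ∀ f → ∑ (allFin n) (f ∘ σ) ≡ ∑ (allFin n) f
  ∑-involution {n} σ σσ f = begin
    ∑ (allFin n) (f ∘ σ)                                       ≡⟨ ∑-cong (allFin n) (λ i → ∑-δ (σ i) f) ⟨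
    ∑ (allFin n) (λ i → ∑ (allFin n) λ j → δ (σ i) j * f j)    ≡⟨ ∑-swap (allFin n) (allFin n) _ ⟩
    ∑ (allFin n) (λ j → ∑ (allFin n) λ i → δ (σ i) j * f j)
      ≡⟨ ∑-cong (allFin n) (λ j → ∑-cong (allFin n) λ i → cong (_* f j) (δ-σ i j)) ⟩
    ∑ (allFin n) (λ j → ∑ (allFin n) λ i → δ (σ j) i * f j)    ≡⟨ ∑-cong (allFin n) (λ j → ∑-δ (σ j) (const (f j))) ⟩
    ∑ (allFin n) f                                             ∎
    where
    open ≡-Reasoning
    δ-σ : ∀ i j → δ (σ i) j ≡ δ (σ j) i
    δ-σ i j with σ i Fin.≟ j | σ j Fin.≟ i
    ... | yes _    | yes _    = refl
    ... | yes refl | no  ≢i   = contradiction (σσ i) ≢i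
    ... | no  ≢j   | yes refl = contradiction (σσ j) ≢j
    ... | no  _    | no  _    = refl

  -- The third vertex of the triangle through i and j in the decomposition {i + j + k ≡ 0 mod n}.
  third : Fin n → Fin n → Fin n
  third {suc n} i j = ((suc n ∸ toℕ i) + (suc n ∸ toℕ j)) DivMod.mod suc n

  ZeroSum : Fin n → Fin n → Fin n → Set
  ZeroSum {n} i j k = n ∣ toℕ i + toℕ j + toℕ k

  third-ZeroSum : ∀ (i j : Fin n) → ZeroSum i j (third i j)
  third-ZeroSum {suc n} i j = ∣.∣m+n∣m⇒∣n {m = a ℕ./ N * N} (subst (N ∣_) eq (∣.divides 2 refl)) (∣.n∣m*n (a ℕ./ N))
    where
    N = suc n
    a = (N ∸ toℕ i) + (N ∸ toℕ j)
    open ≡-Reasoning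
    open ℕSolver.+-*-Solver
    rearrange : ∀ x y p q → (x + p) + (y + q) ≡ x + y + (p + q)
    rearrange = solve 4 (λ x y p q → (x :+ p) :+ (y :+ q) := x :+ y :+ (p :+ q)) refl
    rearrange′ : ∀ x y r q → x + y + (r + q) ≡ q + (x + y + r)
    rearrange′ = solve 4 (λ x y r q → x :+ y :+ (r :+ q) := q :+ (x :+ y :+ r)) refl
    eq : 2 * N ≡ a ℕ./ N * N + (toℕ i + toℕ j + toℕ (third i j))
    eq = begin
      2 * N                                        ≡⟨ cong (N +_) (ℕₚ.+-identityʳ N) ⟩
      N + N                                        ≡⟨ cong₂ _+_ (ℕₚ.m+[n∸m]≡n (ℕₚ.<⇒≤ (Finₚ.toℕ<n i))) (ℕₚ.m+[n∸m]≡n (ℕₚ.<⇒≤ (Finₚ.toℕ<n j))) ⟨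
      (toℕ i + (N ∸ toℕ i)) + (toℕ j + (N ∸ toℕ j)) ≡⟨ rearrange (toℕ i) (toℕ j) (N ∸ toℕ i) (N ∸ toℕ j) ⟩
      toℕ i + toℕ j + a                            ≡⟨ cong (toℕ i + toℕ j +_) (DivMod.m≡m%n+[m/n]*n a N) ⟩
      toℕ i + toℕ j + (a ℕ.% N + a ℕ./ N * N)      ≡⟨ rearrange′ (toℕ i) (toℕ j) (a ℕ.% N) (a ℕ./ N * N) ⟩
      a ℕ./ N * N + (toℕ i + toℕ j + a ℕ.% N)      ≡⟨ cong (λ r → a ℕ./ N * N + (toℕ i + toℕ j + r)) (Finₚ.toℕ-fromℕ< (DivMod.m%n<n a N)) ⟨
      a ℕ./ N * N + (toℕ i + toℕ j + toℕ (third i j)) ∎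

  -- Two solutions differ by a multiple of `n` that is smaller than `n`.
  ZeroSum-unique : ∀ {i j k l : Fin n} → ZeroSum i j k → ZeroSum i j l → k ≡ l
  ZeroSum-unique {n} {i} {j} {k} {l} zk zl = by-cases (ℕₚ.≤-total (toℕ k) (toℕ l))
    where
    small : ∀ d → d < n → n ∣ d → d ≡ 0
    small zero    _   _   = refl
    small (suc d) d<n n∣d = contradiction (∣.∣⇒≤ n∣d) (ℕₚ.<⇒≱ d<n)
    ordered : ∀ {k l : Fin n} → toℕ k ≤ toℕ l → ZeroSum i j k → ZeroSum i j l → k ≡ l
    ordered {k} {l} k≤l zk zl = Finₚ.toℕ-injective (ℕₚ.≤-antisym k≤l (ℕₚ.m∸n≡0⇒m≤n (small (toℕ l ∸ toℕ k)
      (ℕₚ.≤-<-trans (ℕₚ.m∸n≤m (toℕ l) (toℕ k)) (Finₚ.toℕ<n l))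
      (∣.∣m+n∣m⇒∣n (subst (n ∣_) (trans (cong (toℕ i + toℕ j +_) (sym (ℕₚ.m+[n∸m]≡n k≤l)))
        (sym (ℕₚ.+-assoc (toℕ i + toℕ j) (toℕ k) (toℕ l ∸ toℕ k)))) zl) zk))))
    by-cases : toℕ k ≤ toℕ l ⊎ toℕ l ≤ toℕ k → k ≡ l
    by-cases (inj₁ k≤l) = ordered k≤l zk zl
    by-cases (inj₂ l≤k) = sym (ordered l≤k zl zk)

  third-comm : ∀ (i j : Fin n) → third i j ≡ third j i
  third-comm {n} i j = ZeroSum-unique {i = j} {i}
    (subst (λ s → n ∣ s + toℕ (third i j)) (ℕₚ.+-comm (toℕ i) (toℕ j)) (third-ZeroSum i j)) (third-ZeroSum j i)

  third-involutive : ∀ (i j : Fin n) → third i (third i j) ≡ j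
  third-involutive {n} i j = ZeroSum-unique {i = i} {third i j} (third-ZeroSum i (third i j))
    (subst (n ∣_) (swap (toℕ i) (toℕ j) (toℕ (third i j))) (third-ZeroSum i j))
    where
    swap : ∀ x y z → x + y + z ≡ x + z + y
    swap = solve 3 (λ x y z → x :+ y :+ z := x :+ z :+ y) refl
      where open ℕSolver.+-*-Solver

  -- Adjacency and regular pairs

  -- For distinct u and w, the indicator that uw and ik are the same unordered pair. Written with
  -- products of deltas, it can be summed over vertices by `∑-δ`.
  leg : Fin n → Fin n → Fin n → Fin n → ℕ
  leg u w i k = δ u i * δ w k + δ u k * δ w i

  leg-sym : ∀ (u w i k : Fin n) → leg u w i k ≡ leg u w k i
  leg-sym u w i k = ℕₚ.+-comm (δ u i * δ w k) (δ u k * δ w i)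

  ∑-leg : ∀ (u w i : Fin n) → ∑ (allFin n) (leg u w i) ≡ δ u i + δ w i
  ∑-leg {n} u w i = trans (∑-distrib-+ (allFin n) _ _) (cong₂ _+_
    (trans (∑-cong (allFin n) λ k → ℕₚ.*-comm (δ u i) (δ w k)) (∑-δ w (const (δ u i))))
    (∑-δ u (const (δ w i))))

  leg≢0 : ∀ {u w i k : Fin n} → leg u w i k ≢ 0 → (u ≡ i × w ≡ k) ⊎ (u ≡ k × w ≡ i)
  leg≢0 {u = u} {w} {i} {k} ≢0 with u Fin.≟ i | w Fin.≟ k | u Fin.≟ k | w Fin.≟ i
  ... | yes u≡i | yes w≡k | _       | _       = inj₁ (u≡i , w≡k)
  ... | yes _   | no  _   | yes u≡k | yes w≡i = inj₂ (u≡k , w≡i)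
  ... | no  _   | _       | yes u≡k | yes w≡i = inj₂ (u≡k , w≡i)
  ... | yes _   | no  _   | yes _   | no  _   = contradiction refl ≢0
  ... | yes _   | no  _   | no  _   | _       = contradiction refl ≢0
  ... | no  _   | _       | yes _   | no  _   = contradiction refl ≢0
  ... | no  _   | _       | no  _   | _       = contradiction refl ≢0

  leg≤1 : ∀ {u w : Fin n} i k → u ≢ w → leg u w i k ≤ 1
  leg≤1 {u = u} {w} i k u≢w with u Fin.≟ i | w Fin.≟ k | u Fin.≟ k | w Fin.≟ i
  ... | yes refl | _        | _        | yes refl = contradiction refl u≢w
  ... | _        | yes refl | yes refl | _        = contradiction refl u≢w
  ... | yes _ | yes _ | no  _ | no _  = ℕₚ.≤-refl
  ... | yes _ | no  _ | yes _ | no _  = z≤n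
  ... | yes _ | no  _ | no  _ | no _  = z≤n
  ... | no  _ | yes _ | no  _ | _     = z≤n
  ... | no  _ | no  _ | yes _ | yes _ = ℕₚ.≤-refl
  ... | no  _ | no  _ | yes _ | no  _ = z≤n
  ... | no  _ | no  _ | no  _ | _     = z≤n

  1≤leg : ∀ (u w : Fin n) → 1 ≤ leg u w u w
  1≤leg u w = ℕₚ.≤-trans (ℕₚ.≤-reflexive (sym (cong₂ _*_ (δ-refl u) (δ-refl w)))) (ℕₚ.m≤m+n _ _)

  module Adjacency {n : ℕ} (G : Graph n) where

    open Graph G

    source target : Edge G → Vertex G
    source e = proj₁ (ends e)
    target e = proj₂ (ends e)

    source≢target : ∀ e → source e ≢ target e
    source≢target e eq = ℕₚ.<-irrefl (cong toℕ eq) (ordered e)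

    link : Edge G → Vertex G → Vertex G → ℕ
    link e = leg (source e) (target e)

    link≢0⇒Joins : ∀ {e i k} → link e i k ≢ 0 → Joins G e i k
    link≢0⇒Joins {e} {i} {k} ≢0 with leg≢0 {u = source e} {target e} ≢0
    ... | inj₁ (refl , refl) = inj₁ refl
    ... | inj₂ (refl , refl) = inj₂ refl

    adj : Vertex G → Vertex G → ℕ
    adj i k = ∑ (allFin size) λ e → link e i k

    adj-sym : ∀ i k → adj i k ≡ adj k i
    adj-sym i k = ∑-cong (allFin size) λ e → leg-sym (source e) (target e) i k

    Joins-unique : ∀ {e f i k} → Joins G e i k → Joins G f i k → e ≡ f
    Joins-unique (inj₁ p) (inj₁ q) = injective (trans p (sym q))
    Joins-unique (inj₂ p) (inj₂ q) = injective (trans p (sym q))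
    Joins-unique {e} {f} (inj₁ p) (inj₂ q) = contradiction
      (subst₂ Fin._<_ (cong proj₁ p) (cong proj₂ p) (ordered e)) (ℕₚ.<-asym (subst₂ Fin._<_ (cong proj₁ q) (cong proj₂ q) (ordered f)))
    Joins-unique {e} {f} (inj₂ p) (inj₁ q) = contradiction
      (subst₂ Fin._<_ (cong proj₁ p) (cong proj₂ p) (ordered e)) (ℕₚ.<-asym (subst₂ Fin._<_ (cong proj₁ q) (cong proj₂ q) (ordered f)))

    adj≤1 : ∀ i k → adj i k ≤ 1
    adj≤1 i k = ∑-unique (λ e → link e i k) (λ e → leg≤1 i k (source≢target e))
      λ {e} {f} p q → Joins-unique {i = i} {k} (link≢0⇒Joins {e} p) (link≢0⇒Joins {f} q)

    adj⇒Joins : ∀ {i k} → adj i k ≡ 1 → ∃ λ e → Joins G e i k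
    adj⇒Joins {i} {k} eq = found (∑≢0 (λ e → link e i k) λ ≡0 → contradiction (trans (sym eq) ≡0) λ ())
      where
      found : (∃ λ e → link e i k ≢ 0) → ∃ λ e → Joins G e i k
      found (e , ≢0) = e , link≢0⇒Joins {e} ≢0

    adj-irrefl : ∀ i → adj i i ≡ 0
    adj-irrefl i = ∑-zero (All.universal loopless (allFin size))
      where
      loopless : ∀ e → link e i i ≡ 0
      loopless e with link e i i ℕ.≟ 0
      ... | yes ≡0 = ≡0
      ... | no  ≢0 with link≢0⇒Joins {e} ≢0
      ...   | inj₁ p = contradiction (trans (cong proj₁ p) (sym (cong proj₂ p))) (source≢target e)
      ...   | inj₂ p = contradiction (trans (cong proj₁ p) (sym (cong proj₂ p))) (source≢target e)

    adj-≢ : ∀ {i k} → adj i k ≡ 1 → i ≢ k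
    adj-≢ {i} eq refl = contradiction (trans (sym eq) (adj-irrefl i)) λ ()

    ends-at : List (Edge G) → Vertex G → ℕ
    ends-at es i = ∑ es λ e → δ (source e) i + δ (target e) i

    ∑-link : ∀ es i → ∑ (allFin n) (λ k → ∑ es λ e → link e i k) ≡ ends-at es i
    ∑-link es i = trans (∑-swap (allFin n) es _) (∑-cong es λ e → ∑-leg (source e) (target e) i)

    nonadj : Vertex G → Vertex G → ℕ
    nonadj i k = 1 ∸ adj i k

    nonadj≡0⇒adj : ∀ {i k} → nonadj i k ≡ 0 → adj i k ≡ 1
    nonadj≡0⇒adj {i} {k} eq = ℕₚ.≤-antisym (adj≤1 i k) (ℕₚ.m∸n≡0⇒m≤n eq)

    -- The vertex itself is counted, so the value is never 0; in a dense graph with a vertex this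
    -- forces n to be at least 1000.
    codegree : Vertex G → ℕ
    codegree i = ∑ (allFin n) (nonadj i)

    ends-at≡degree : ∀ i → ends-at (allFin size) i ≡ degree G i
    ends-at≡degree i = count-filter (allFin size)
      where
      count-filter : ∀ es → ends-at es i ≡ length (filter (incident? G i) es)
      count-filter []       = refl
      count-filter (e ∷ es) with source e Fin.≟ i | target e Fin.≟ i
      ... | yes p | yes q = contradiction (trans p (sym q)) (source≢target e)
      ... | yes _ | no  _ = cong suc (count-filter es)
      ... | no  _ | yes _ = cong suc (count-filter es)
      ... | no  _ | no  _ = count-filter es

    degree+codegree : ∀ i → degree G i + codegree i ≡ n
    degree+codegree i = begin
      degree G i + codegree i                             ≡⟨ cong (_+ codegree i) (trans (∑-link (allFin size) i) (ends-at≡degree i)) ⟨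
      ∑ (allFin n) (adj i) + ∑ (allFin n) (nonadj i)      ≡⟨ ∑-distrib-+ (allFin n) (adj i) (nonadj i) ⟨
      ∑ (allFin n) (λ k → adj i k + nonadj i k)           ≡⟨ ∑-cong (allFin n) (λ k → ℕₚ.m+[n∸m]≡n (adj≤1 i k)) ⟩
      ∑ (allFin n) (const 1)                              ≡⟨ ∑-const n ⟩
      n                                                   ∎
      where open ≡-Reasoning

    1≤codegree : ∀ i → 1 ≤ codegree i
    1≤codegree i = ℕₚ.≤-trans (ℕₚ.≤-reflexive (sym (cong (1 ∸_) (adj-irrefl i)))) (∑ℕ-∈-≤ (nonadj i) (Lₚ.∈-allFin i))

    -- Degenerate triples, where `third i k` is i or k, are excluded as well, since `adj` vanishes
    -- on the diagonal.
    Regular : Vertex G → Vertex G → Set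
    Regular i k = adj i k ≡ 1 × adj i (third i k) ≡ 1 × adj k (third i k) ≡ 1

    regular? : ∀ i k → Dec (Regular i k)
    regular? i k = (adj i k ℕ.≟ 1) ×-dec ((adj i (third i k) ℕ.≟ 1) ×-dec (adj k (third i k) ℕ.≟ 1))

    Regular-sym : ∀ {i k} → Regular i k → Regular k i
    Regular-sym {i} {k} (ik , ij , kj) = trans (adj-sym k i) ik ,
      trans (cong (adj k) (third-comm k i)) kj , trans (cong (adj i) (third-comm k i)) ij

    RegularEdge : Edge G → Set
    RegularEdge e = Regular (source e) (target e)

    regularEdge? : ∀ e → Dec (RegularEdge e)
    regularEdge? e = regular? (source e) (target e)

    regularEdges irregularEdges : List (Edge G)
    regularEdges   = filter regularEdge? (allFin size)
    irregularEdges = filter (¬? ∘ regularEdge?) (allFin size)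

    Joins-Regular : ∀ {e i k} → Joins G e i k → Regular i k → RegularEdge e
    Joins-Regular (inj₁ eq) = subst (λ (u , v) → Regular u v) (sym eq)
    Joins-Regular (inj₂ eq) = subst (λ (u , v) → Regular u v) (sym eq) ∘ Regular-sym

    irregular : Vertex G → Vertex G → ℕ
    irregular i k = ∑ irregularEdges λ e → link e i k

    irregular≤1 : ∀ i k → irregular i k ≤ 1
    irregular≤1 i k = ℕₚ.≤-trans (∑-filter-≤ (¬? ∘ regularEdge?) (allFin size) _) (adj≤1 i k)

    Regular⇒irregular≡0 : ∀ {i k} → Regular i k → irregular i k ≡ 0
    Regular⇒irregular≡0 {i} {k} reg = ∑-zero (All.map no-link (Allₚ.all-filter (¬? ∘ regularEdge?) (allFin size)))
      where
      no-link : ∀ {e} → ¬ RegularEdge e → link e i k ≡ 0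
      no-link {e} ¬reg with link e i k ℕ.≟ 0
      ... | yes ≡0 = ≡0
      ... | no  ≢0 = contradiction (Joins-Regular (link≢0⇒Joins {e} ≢0) reg) ¬reg

    -- An edge ik fails to be regular only if its third vertex is not adjacent to i or not adjacent
    -- to k.
    irregular≤nonadj : ∀ i k → irregular i k ≤ nonadj i (third i k) + nonadj k (third i k)
    irregular≤nonadj i k with adj i k ℕ.≟ 1 | nonadj i (third i k) ℕ.≟ 0 | nonadj k (third i k) ℕ.≟ 0
    ... | yes p | yes q | yes r = ℕₚ.≤-trans (ℕₚ.≤-reflexive (Regular⇒irregular≡0 (p , nonadj≡0⇒adj q , nonadj≡0⇒adj {k} r))) z≤n
    ... | no  p | _     | _     = ℕₚ.≤-trans (ℕₚ.≤-pred (ℕₚ.≤∧≢⇒< (ℕₚ.≤-trans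
        (∑-filter-≤ (¬? ∘ regularEdge?) (allFin size) _) (adj≤1 i k)) λ eq →
          p (ℕₚ.≤-antisym (adj≤1 i k) (subst (_≤ adj i k) eq (∑-filter-≤ (¬? ∘ regularEdge?) (allFin size) _))))) z≤n
    ... | yes _ | no  q | _     = ℕₚ.≤-trans (irregular≤1 i k) (ℕₚ.≤-trans (ℕₚ.n≢0⇒n>0 q) (ℕₚ.m≤m+n _ _))
    ... | yes _ | yes _ | no  r = ℕₚ.≤-trans (irregular≤1 i k) (ℕₚ.≤-trans (ℕₚ.n≢0⇒n>0 r) (ℕₚ.m≤n+m _ _))

    -- With i fixed, k ↦ `third i k` is an involution, so the missing sides at i add up to the
    -- codegree of i. The missing sides at k are treated in the same way with k fixed.
    ∑-irregular : ∑ (allFin n) (ends-at irregularEdges) ≤ ∑ (allFin n) codegree + ∑ (allFin n) codegree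
    ∑-irregular = begin
      ∑ (allFin n) (ends-at irregularEdges)
        ≡⟨ ∑-cong (allFin n) (∑-link irregularEdges) ⟨
      ∑ (allFin n) (λ i → ∑ (allFin n) (irregular i))
        ≤⟨ ∑-mono (allFin n) (λ i → ∑-mono (allFin n) (irregular≤nonadj i)) ⟩
      ∑ (allFin n) (λ i → ∑ (allFin n) λ k → nonadj i (third i k) + nonadj k (third i k))
        ≡⟨ trans (∑-cong (allFin n) λ i → ∑-distrib-+ (allFin n) _ _) (∑-distrib-+ (allFin n) _ _) ⟩
      ∑ (allFin n) (λ i → ∑ (allFin n) λ k → nonadj i (third i k)) +
      ∑ (allFin n) (λ i → ∑ (allFin n) λ k → nonadj k (third i k))
        ≡⟨ cong₂ _+_
             (∑-cong (allFin n) λ i → ∑-involution (third i) (third-involutive i) (nonadj i))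
             (trans (∑-swap (allFin n) (allFin n) _) (∑-cong (allFin n) λ k →
               trans (∑-cong (allFin n) λ i → cong (nonadj k) (third-comm i k)) (∑-involution (third k) (third-involutive k) (nonadj k)))) ⟩
      ∑ (allFin n) codegree + ∑ (allFin n) codegree ∎
      where open ℕₚ.≤-Reasoning

  -- Greedy choice of triangles

  indicator≡0 : ∀ {P : Set} (P? : Dec P) → indicator P? ≡ 0 → ¬ P
  indicator≡0 (no ¬p) _ = ¬p

  leg-exclusive : ∀ {n} {u v w i k : Fin n} → u ≢ w → leg u w i k ≢ 0 → leg v w i k ≢ 0 → u ≡ v
  leg-exclusive {u = u} {v} {w} u≢w p q with leg≢0 {u = u} {w} p | leg≢0 {u = v} {w} q
  ... | inj₁ (u≡i , _) | inj₁ (v≡i , _) = trans u≡i (sym v≡i)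
  ... | inj₂ (u≡k , _) | inj₂ (v≡k , _) = trans u≡k (sym v≡k)
  ... | inj₁ (u≡i , _) | inj₂ (_ , w≡i) = contradiction (trans u≡i (sym w≡i)) u≢w
  ... | inj₂ (u≡k , _) | inj₁ (_ , w≡k) = contradiction (trans u≡k (sym w≡k)) u≢w

  module Greedy {n : ℕ} (G : Graph n) (maxApex : ℕ) where

    open Graph G
    open Adjacency G

    Apex : Set
    Apex = Edge G × Vertex G

    IsApex : Apex → Set
    IsApex (e , w) = adj (source e) w ≡ 1 × adj (target e) w ≡ 1

    legs : Apex → Vertex G → Vertex G → ℕ
    legs (e , w) i k = leg (source e) w i k + leg (target e) w i k

    uses : List Apex → Vertex G → Vertex G → ℕ
    uses S i k = ∑ S λ a → legs a i k

    apexes : List Apex → Vertex G → ℕ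
    apexes S i = ∑ S λ (_ , w) → δ w i

    legs-sym : ∀ a i k → legs a i k ≡ legs a k i
    legs-sym (e , w) i k = cong₂ _+_ (leg-sym (source e) w i k) (leg-sym (target e) w i k)

    uses-sym : ∀ S i k → uses S i k ≡ uses S k i
    uses-sym S i k = ∑-cong S λ a → legs-sym a i k

    -- A triangle brings one use to each end of its edge and two uses to its apex.
    ∑-uses : ∀ S i → ∑ (allFin n) (uses S i) ≡
      ∑ S (λ (e , _) → δ (source e) i + δ (target e) i) + (apexes S i + apexes S i)
    ∑-uses S i = begin
      ∑ (allFin n) (uses S i)
        ≡⟨ ∑-swap (allFin n) S (λ k a → legs a i k) ⟩
      ∑ S (λ a → ∑ (allFin n) (legs a i))
        ≡⟨ ∑-cong S (λ (e , w) → trans (∑-distrib-+ (allFin n) (leg (source e) w i) (leg (target e) w i))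
             (trans (cong₂ _+_ (∑-leg (source e) w i) (∑-leg (target e) w i))
               (interchange (δ (source e) i) (δ w i) (δ (target e) i) (δ w i)))) ⟩
      ∑ S (λ (e , w) → (δ (source e) i + δ (target e) i) + (δ w i + δ w i))
        ≡⟨ trans (∑-distrib-+ S _ _) (cong (∑ S (λ (e , _) → δ (source e) i + δ (target e) i) +_) (∑-distrib-+ S _ _)) ⟩
      ∑ S (λ (e , _) → δ (source e) i + δ (target e) i) + (apexes S i + apexes S i) ∎
      where open ≡-Reasoning

    -- A regular pair is already used twice by the triangles of the decomposition.
    capacity : Vertex G → Vertex G → ℕ
    capacity i k = bound (regular? i k)
      where
      bound : Dec (Regular i k) → ℕ
      bound (yes _) = 1
      bound (no  _) = 3

    capacity-sym : ∀ i k → capacity i k ≡ capacity k i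
    capacity-sym i k with regular? i k | regular? k i
    ... | yes _ | yes _ = refl
    ... | no  _ | no  _ = refl
    ... | yes p | no ¬q = contradiction (Regular-sym p) ¬q
    ... | no ¬p | yes q = contradiction (Regular-sym q) ¬p

    1≤capacity : ∀ i k → 1 ≤ capacity i k
    1≤capacity i k with regular? i k
    ... | yes _ = ℕₚ.≤-refl
    ... | no  _ = s≤s z≤n

    full : List Apex → Vertex G → Vertex G → ℕ
    full S i k = indicator (capacity i k ℕ.≤? uses S i k)

    full≤uses : ∀ S i k → full S i k ≤ uses S i k
    full≤uses S i k with capacity i k ℕ.≤? uses S i k
    ... | yes cap≤ = ℕₚ.≤-trans (1≤capacity i k) cap≤
    ... | no  _    = z≤n

    capacity-regular : ∀ {i k} → Regular i k → capacity i k ≡ 1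
    capacity-regular {i} {k} reg with regular? i k
    ... | yes _    = refl
    ... | no  ¬reg = contradiction reg ¬reg

    capacity-irregular : ∀ {i k} → ¬ Regular i k → capacity i k ≡ 3
    capacity-irregular {i} {k} ¬reg with regular? i k
    ... | yes reg = contradiction reg ¬reg
    ... | no  _   = refl

    -- A full regular pair has at least one use and carries no irregular edge; a full irregular pair
    -- has three uses; a pair that is not full carries at most one irregular edge. Counting the
    -- irregular edges on the left is what later keeps the full pairs near n/2.
    2full≤ : ∀ S i k → 2 * full S i k + irregular i k ≤ 1 + uses S i k
    2full≤ S i k = by-cases (regular? i k) (capacity i k ℕ.≤? uses S i k)
      where
      by-cases : Dec (Regular i k) → (P? : Dec (capacity i k ≤ uses S i k)) →
        2 * indicator P? + irregular i k ≤ 1 + uses S i k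
      by-cases _ (no _) = ℕₚ.≤-trans (irregular≤1 i k) (ℕₚ.m≤m+n 1 (uses S i k))
      by-cases (yes reg) (yes cap≤) = ℕₚ.≤-trans (ℕₚ.≤-reflexive (cong (2 +_) (Regular⇒irregular≡0 reg)))
        (s≤s (ℕₚ.≤-trans (1≤capacity i k) cap≤))
      by-cases (no ¬reg) (yes cap≤) = ℕₚ.≤-trans (ℕₚ.+-monoʳ-≤ 2 (irregular≤1 i k))
        (s≤s (ℕₚ.≤-trans (ℕₚ.n≤1+n 2) (subst (_≤ uses S i k) (capacity-irregular ¬reg) cap≤)))

    exhausted : List Apex → Vertex G → ℕ
    exhausted S w = indicator (maxApex ℕ.≤? apexes S w)

    maxApex*exhausted≤ : ∀ S → maxApex * ∑ (allFin n) (exhausted S) ≤ ∑ S (const 1)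
    maxApex*exhausted≤ S = begin
      maxApex * ∑ (allFin n) (exhausted S)            ≡⟨ ∑-distribˡ-* (allFin n) maxApex (exhausted S) ⟨
      ∑ (allFin n) (λ w → maxApex * exhausted S w)    ≤⟨ ∑-mono (allFin n) pointwise ⟩
      ∑ (allFin n) (apexes S)                         ≡⟨ ∑-swap (allFin n) S (λ i a → δ (proj₂ a) i) ⟩
      ∑ S (λ a → ∑ (allFin n) (δ (proj₂ a)))          ≡⟨ ∑-cong S (λ (_ , w) → trans (∑-cong (allFin n) λ i → sym (ℕₚ.*-identityʳ (δ w i))) (∑-δ w (const 1))) ⟩
      ∑ S (const 1)                                   ∎
      where
      open ℕₚ.≤-Reasoning
      pointwise : ∀ w → maxApex * exhausted S w ≤ apexes S w
      pointwise w with maxApex ℕ.≤? apexes S w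
      ... | yes le = ℕₚ.≤-trans (ℕₚ.≤-reflexive (ℕₚ.*-identityʳ maxApex)) le
      ... | no  _  = ℕₚ.≤-trans (ℕₚ.≤-reflexive (ℕₚ.*-zeroʳ maxApex)) z≤n

    module _ (total : List (Edge G)) where

      -- `conservation` says that the treated edges and `rest` form `total` as a multiset. Testing
      -- against every `h` gives degrees, cardinalities and membership by specialisation.
      record Invariant (S : List Apex) (rest : List (Edge G)) : Set where
        field
          apex         : All IsApex S
          uses≤        : ∀ i k → uses S i k ≤ capacity i k
          apexes≤      : ∀ i → apexes S i ≤ maxApex
          conservation : ∀ (h : Edge G → ℕ) → ∑ S (h ∘ proj₁) + ∑ rest h ≡ ∑ total h

      open Invariant

      -- s stands for the number of full pairs at i.
      FullBound : Vertex G → ℕ → Set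
      FullBound i s = s ≤ ends-at total i + (maxApex + maxApex) ×
        2 * s + ends-at irregularEdges i ≤ n + (ends-at total i + (maxApex + maxApex))

      -- A condition on numbers only, not on the state `S`, so that it can be verified for all edges
      -- before the greedy choice begins.
      Enough : Edge G → Set
      Enough e = ∀ {s t f} → FullBound (source e) s → FullBound (target e) t → maxApex * f ≤ ∑ total (const 1) →
        (codegree (source e) + codegree (target e)) + ((s + t) + f) < n

      module _ {S rest} (inv : Invariant S rest) where

        ∑-uses≤ : ∀ i → ∑ (allFin n) (uses S i) ≤ ends-at total i + (maxApex + maxApex)
        ∑-uses≤ i = ℕₚ.≤-trans (ℕₚ.≤-reflexive (∑-uses S i)) (ℕₚ.+-mono-≤
          (ℕₚ.≤-trans (ℕₚ.m≤m+n (∑ S (d ∘ proj₁)) (∑ rest d)) (ℕₚ.≤-reflexive (conservation inv d)))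
          (ℕₚ.+-mono-≤ (apexes≤ inv i) (apexes≤ inv i)))
          where
          d : Edge G → ℕ
          d e = δ (source e) i + δ (target e) i

        fullBound : ∀ i → FullBound i (∑ (allFin n) (full S i))
        fullBound i = ℕₚ.≤-trans (∑-mono (allFin n) (full≤uses S i)) (∑-uses≤ i) , (begin
          2 * ∑ (allFin n) (full S i) + ends-at irregularEdges i
            ≡⟨ cong₂ _+_ (∑-distribˡ-* (allFin n) 2 (full S i)) (∑-link irregularEdges i) ⟨
          ∑ (allFin n) (λ k → 2 * full S i k) + ∑ (allFin n) (irregular i)
            ≡⟨ ∑-distrib-+ (allFin n) (λ k → 2 * full S i k) (irregular i) ⟨
          ∑ (allFin n) (λ k → 2 * full S i k + irregular i k)
            ≤⟨ ∑-mono (allFin n) (2full≤ S i) ⟩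
          ∑ (allFin n) (λ k → 1 + uses S i k)
            ≡⟨ trans (∑-distrib-+ (allFin n) (const 1) (uses S i)) (cong (_+ ∑ (allFin n) (uses S i)) (∑-const n)) ⟩
          n + ∑ (allFin n) (uses S i)
            ≤⟨ ℕₚ.+-monoʳ-≤ n (∑-uses≤ i) ⟩
          n + (ends-at total i + (maxApex + maxApex)) ∎)
          where open ℕₚ.≤-Reasoning

        Available : Edge G → Vertex G → Set
        Available e w = IsApex (e , w) × uses S (source e) w < capacity (source e) w ×
          uses S (target e) w < capacity (target e) w × apexes S w < maxApex

        available : ∀ e → Enough e → ∃ (Available e)
        available e enough = found (∑<⇒∃0 bad (ℕₚ.≤-<-trans (ℕₚ.≤-reflexive ∑-bad)
          (enough (fullBound u) (fullBound v) (ℕₚ.≤-trans (maxApex*exhausted≤ S)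
            (ℕₚ.≤-trans (ℕₚ.m≤m+n _ _) (ℕₚ.≤-reflexive (conservation inv (const 1))))))))
          where
          u = source e
          v = target e
          bad : Vertex G → ℕ
          -- Each summand is a reason to reject `w`; if all vanish, `w` is adjacent to both ends and
          -- has room on both legs and as an apex.
          bad w = (nonadj u w + nonadj v w) + ((full S u w + full S v w) + exhausted S w)
          ∑-bad : ∑ (allFin n) bad ≡ (codegree u + codegree v) +
            ((∑ (allFin n) (full S u) + ∑ (allFin n) (full S v)) + ∑ (allFin n) (exhausted S))
          ∑-bad = trans (∑-distrib-+ (allFin n) (λ w → nonadj u w + nonadj v w) (λ w → (full S u w + full S v w) + exhausted S w))
            (cong₂ _+_ (∑-distrib-+ (allFin n) (nonadj u) (nonadj v))
              (trans (∑-distrib-+ (allFin n) (λ w → full S u w + full S v w) (exhausted S))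
                (cong (_+ ∑ (allFin n) (exhausted S)) (∑-distrib-+ (allFin n) (full S u) (full S v)))))
          found : (∃ λ w → bad w ≡ 0) → ∃ (Available e)
          found (w , bad≡0) = w ,
            (nonadj≡0⇒adj (ℕₚ.m+n≡0⇒m≡0 (nonadj u w) non) , nonadj≡0⇒adj (ℕₚ.m+n≡0⇒n≡0 (nonadj u w) non)) ,
            ℕₚ.≰⇒> (indicator≡0 (capacity u w ℕ.≤? uses S u w) (ℕₚ.m+n≡0⇒m≡0 (full S u w) fulls)) ,
            ℕₚ.≰⇒> (indicator≡0 (capacity v w ℕ.≤? uses S v w) (ℕₚ.m+n≡0⇒n≡0 (full S u w) fulls)) ,
            ℕₚ.≰⇒> (indicator≡0 (maxApex ℕ.≤? apexes S w) (ℕₚ.m+n≡0⇒n≡0 (full S u w + full S v w) other))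
            where
            non   = ℕₚ.m+n≡0⇒m≡0 (nonadj u w + nonadj v w) bad≡0
            other = ℕₚ.m+n≡0⇒n≡0 (nonadj u w + nonadj v w) bad≡0
            fulls = ℕₚ.m+n≡0⇒m≡0 (full S u w + full S v w) other

      extend : ∀ {S e rest w} (inv : Invariant S (e ∷ rest)) → Available inv e w → Invariant ((e , w) ∷ S) rest
      extend {S} {e} {rest} {w} inv ((uw , vw) , room-u , room-v , room-w) = record
        { apex         = (uw , vw) ∷ apex inv
        ; uses≤        = uses≤′
        ; apexes≤      = apexes≤′
        ; conservation = λ h → trans (shift (h e) (∑ S (h ∘ proj₁)) (∑ rest h)) (conservation inv h)
        }
        where
        u = source e
        v = target e
        shift : ∀ x y z → (x + y) + z ≡ y + (x + z)
        shift = solve 3 (λ x y z → (x :+ y) :+ z := y :+ (x :+ z)) refl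
          where open ℕSolver.+-*-Solver

        apexes≤′ : ∀ i → δ w i + apexes S i ≤ maxApex
        apexes≤′ i with w Fin.≟ i
        ... | yes refl = room-w
        ... | no  _    = apexes≤ inv i

        room : ∀ {x} i k → uses S x w < capacity x w → leg x w i k ≢ 0 → uses S i k < capacity i k
        room {x} i k lt ≢0 with leg≢0 {u = x} {w} ≢0
        ... | inj₁ (refl , refl) = lt
        ... | inj₂ (refl , refl) = subst₂ _<_ (uses-sym S x w) (capacity-sym x w) lt

        -- The two legs end at different vertices u and v, so at most one of them is the pair ik,
        -- and that one takes a single unit of room.
        uses≤′ : ∀ i k → legs (e , w) i k + uses S i k ≤ capacity i k
        uses≤′ i k = by-cases (leg u w i k ℕ.≟ 0) (leg v w i k ℕ.≟ 0)
          where
          one : ∀ {l l′} → l ≤ 1 → l′ ≡ 0 → uses S i k < capacity i k → l + l′ + uses S i k ≤ capacity i k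
          one {l} l≤1 refl lt = ℕₚ.≤-trans (ℕₚ.+-monoˡ-≤ (uses S i k)
            (ℕₚ.≤-trans (ℕₚ.≤-reflexive (ℕₚ.+-identityʳ l)) l≤1)) lt
          by-cases : Dec (leg u w i k ≡ 0) → Dec (leg v w i k ≡ 0) → legs (e , w) i k + uses S i k ≤ capacity i k
          by-cases (yes p) (yes q) = subst (λ l → l + uses S i k ≤ capacity i k) (sym (cong₂ _+_ p q)) (uses≤ inv i k)
          by-cases (no  p) (yes q) = one (leg≤1 i k (adj-≢ uw)) q (room i k room-u p)
          by-cases (yes p) (no  q) = subst (λ l → l + uses S i k ≤ capacity i k) (ℕₚ.+-comm (leg v w i k) (leg u w i k))
            (one (leg≤1 i k (adj-≢ vw)) p (room i k room-v q))
          by-cases (no  p) (no  q) = contradiction (leg-exclusive (adj-≢ uw) p q) (source≢target e)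

      greedy : ∀ rest {S} → All Enough rest → Invariant S rest → ∃ λ S′ → Invariant S′ []
      greedy []         []               inv = _ , inv
      greedy (e ∷ rest) (enough ∷ enoughs) inv = step (available inv e enough)
        where
        step : ∃ (Available inv e) → ∃ λ S′ → Invariant S′ []
        step (w , av) = greedy rest enoughs (extend inv av)

  -- Dense graphs

  ∑-filter-split : ∀ {A : Set} {P : A → Set} (P? : ∀ x → Dec (P x)) xs (h : A → ℕ) →
    ∑ (filter P? xs) h + ∑ (filter (¬? ∘ P?) xs) h ≡ ∑ xs h
  ∑-filter-split P? []       h = refl
  ∑-filter-split P? (x ∷ xs) h with P? x
  ... | yes _ = trans (ℕₚ.+-assoc (h x) _ _) (cong (h x +_) (∑-filter-split P? xs h))
  ... | no  _ = trans (move (∑ (filter P? xs) h) (h x) _) (cong (h x +_) (∑-filter-split P? xs h))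
    where
    move : ∀ a b c → a + (b + c) ≡ b + (a + c)
    move = solve 3 (λ a b c → a :+ (b :+ c) := b :+ (a :+ c)) refl
      where open ℕSolver.+-*-Solver

  ∑-pos⇒∈ : ∀ {A : Set} {m} (xs : List A) (f : A → Fin m) e → 1 ≤ ∑ xs (λ x → δ e (f x)) → e L.∈ map f xs
  ∑-pos⇒∈ []       f e ()
  ∑-pos⇒∈ (x ∷ xs) f e le with e Fin.≟ f x
  ... | yes e≡fx = here e≡fx
  ... | no  _    = there (∑-pos⇒∈ xs f e le)

  record AtMost‰ (a n x : ℕ) : Set where
    constructor atMost‰
    field
      bound : 1000 * x ≤ a * n

  open AtMost‰

  ‰-+ : ∀ {a b n x y} → AtMost‰ a n x → AtMost‰ b n y → AtMost‰ (a + b) n (x + y)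
  ‰-+ {a} {b} {n} {x} {y} (atMost‰ p) (atMost‰ q) =
    atMost‰ (subst₂ _≤_ (sym (ℕₚ.*-distribˡ-+ 1000 x y)) (sym (ℕₚ.*-distribʳ-+ n a b)) (ℕₚ.+-mono-≤ p q))

  ‰-mono : ∀ {a n x y} → x ≤ y → AtMost‰ a n y → AtMost‰ a n x
  ‰-mono x≤y (atMost‰ p) = atMost‰ (ℕₚ.≤-trans (ℕₚ.*-monoʳ-≤ 1000 x≤y) p)

  ‰⇒< : ∀ {a n x} → a < 1000 → 0 < n → AtMost‰ a n x → x < n
  ‰⇒< {a} {suc n} {x} a<1000 _ (atMost‰ p) =
    ℕₚ.*-cancelˡ-< 1000 x (suc n) (ℕₚ.≤-<-trans p (ℕₚ.*-monoˡ-< (suc n) a<1000))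

  module Dense {n : ℕ} (G : Graph n) (dense : ∀ i → AtMost‰ 1 n (Adjacency.codegree G i)) where

    open Graph G
    open Adjacency G

    -- A larger cap would allow more full pairs, each apex making two uses; a smaller one would
    -- exhaust more vertices. The successor rounds up, so that 20 times the cap is at least n.
    maxApex : ℕ
    maxApex = suc (n ℕ./ 20)

    open Greedy G maxApex

    private
      C m-total : ℕ
      C = ∑ (allFin n) codegree
      m-total = ∑ (allFin n) (ends-at irregularEdges)

      1000≤n : Vertex G → 1000 ≤ n
      1000≤n i = ℕₚ.≤-trans (ℕₚ.*-monoʳ-≤ 1000 (1≤codegree i)) (ℕₚ.≤-trans (bound (dense i)) (ℕₚ.≤-reflexive (ℕₚ.*-identityˡ n)))

      n≤20maxApex : n ≤ 20 * maxApex
      n≤20maxApex = begin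
        n                          ≡⟨ DivMod.m≡m%n+[m/n]*n n 20 ⟩
        n ℕ.% 20 + n ℕ./ 20 * 20   ≤⟨ ℕₚ.+-monoˡ-≤ (n ℕ./ 20 * 20) (ℕₚ.<⇒≤ (DivMod.m%n<n n 20)) ⟩
        20 + n ℕ./ 20 * 20         ≡⟨ ℕₚ.*-comm maxApex 20 ⟩
        20 * maxApex               ∎
        where open ℕₚ.≤-Reasoning

      20maxApex≤ : 20 * maxApex ≤ n + 20
      20maxApex≤ = begin
        20 * maxApex        ≡⟨ ℕₚ.*-comm 20 maxApex ⟩
        20 + n ℕ./ 20 * 20  ≤⟨ ℕₚ.+-monoʳ-≤ 20 (DivMod.m/n*n≤m n 20) ⟩
        20 + n              ≡⟨ ℕₚ.+-comm 20 n ⟩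
        n + 20              ∎
        where open ℕₚ.≤-Reasoning

      2maxApex : Vertex G → AtMost‰ 102 n (maxApex + maxApex)
      2maxApex i = atMost‰ (begin
        1000 * (maxApex + maxApex)  ≡⟨ solve 1 (λ x → con 1000 :* (x :+ x) := con 100 :* (con 20 :* x)) refl maxApex ⟩
        100 * (20 * maxApex)        ≤⟨ ℕₚ.*-monoʳ-≤ 100 20maxApex≤ ⟩
        100 * (n + 20)              ≡⟨ solve 1 (λ x → con 100 :* (x :+ con 20) := con 100 :* x :+ con 2 :* con 1000) refl n ⟩
        -- As n is at least 1000, the rounding costs at most 2 thousandths of n.
        100 * n + 2 * 1000          ≤⟨ ℕₚ.+-monoʳ-≤ (100 * n) (ℕₚ.*-monoʳ-≤ 2 (1000≤n i)) ⟩
        100 * n + 2 * n             ≡⟨ ℕₚ.*-distribʳ-+ n 100 2 ⟨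
        102 * n                     ∎)
        where
        open ℕₚ.≤-Reasoning
        open ℕSolver.+-*-Solver

      C≤ : 1000 * C ≤ n * n
      C≤ = begin
        1000 * C                             ≡⟨ ∑-distribˡ-* (allFin n) 1000 codegree ⟨
        ∑ (allFin n) (λ i → 1000 * codegree i) ≤⟨ ∑-mono (allFin n) (bound ∘ dense) ⟩
        ∑ (allFin n) (λ i → 1 * n)           ≡⟨ ∑-distribʳ-* (allFin n) n (const 1) ⟩
        ∑ (allFin n) (const 1) * n           ≡⟨ cong (_* n) (∑-const n) ⟩
        n * n                                ∎
        where open ℕₚ.≤-Reasoning

      irregularEdges≤ : ∑ irregularEdges (const 1) ≤ C
      irregularEdges≤ = ℕₚ.*-cancelˡ-≤ 2 (begin
        2 * ∑ irregularEdges (const 1)         ≡⟨ ∑-distribˡ-* irregularEdges 2 (const 1) ⟨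
        ∑ irregularEdges (const 2)             ≡⟨ ∑-cong irregularEdges (λ e → trans (∑-distrib-+ (allFin n) _ _) (cong₂ _+_ (∑δ (source e)) (∑δ (target e)))) ⟨
        ∑ irregularEdges (λ e → ∑ (allFin n) λ i → δ (source e) i + δ (target e) i)  ≡⟨ ∑-swap irregularEdges (allFin n) _ ⟩
        m-total                                ≤⟨ ∑-irregular ⟩
        C + C                                  ≡⟨ cong (C +_) (ℕₚ.+-identityʳ C) ⟨
        2 * C                                  ∎)
        where
        open ℕₚ.≤-Reasoning
        ∑δ : ∀ u → ∑ (allFin n) (δ u) ≡ 1
        ∑δ u = trans (∑-cong (allFin n) λ i → sym (ℕₚ.*-identityʳ (δ u i))) (∑-δ u (const 1))

      -- There are at most `C` irregular edges and each exhausted vertex accounts for `maxApex` of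
      -- them. As `C` is at most n²/1000 and `maxApex` at least n/20, this leaves 20 thousandths of
      -- n.
      exhausted≤ : ∀ {f} → Vertex G → maxApex * f ≤ ∑ irregularEdges (const 1) → AtMost‰ 20 n f
      exhausted≤ {f} i le = atMost‰ (ℕₚ.*-cancelˡ-≤ n {{ℕ.>-nonZero (ℕₚ.≤-trans (s≤s z≤n) (1000≤n i))}} (begin
        n * (1000 * f)                ≤⟨ ℕₚ.*-monoˡ-≤ (1000 * f) n≤20maxApex ⟩
        20 * maxApex * (1000 * f)     ≡⟨ solve 2 (λ A f → con 20 :* A :* (con 1000 :* f) := con 20 :* (con 1000 :* (A :* f))) refl maxApex f ⟩
        20 * (1000 * (maxApex * f))   ≤⟨ ℕₚ.*-monoʳ-≤ 20 (ℕₚ.*-monoʳ-≤ 1000 (ℕₚ.≤-trans le irregularEdges≤)) ⟩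
        20 * (1000 * C)               ≤⟨ ℕₚ.*-monoʳ-≤ 20 C≤ ⟩
        20 * (n * n)                  ≡⟨ solve 1 (λ x → con 20 :* (x :* x) := x :* (con 20 :* x)) refl n ⟩
        n * (20 * n)                  ∎))
        where
        open ℕₚ.≤-Reasoning
        open ℕSolver.+-*-Solver

      -- With the threshold n/4, a light end has at most 250 + 102 thousandths of n as full pairs.
      -- Added to the 551 thousandths possible at any end, this leaves room for the other
      -- obstructions.
      Heavy : Vertex G → Set
      Heavy i = n ≤ 4 * ends-at irregularEdges i

      heavy? : ∀ i → Dec (Heavy i)
      heavy? i = n ℕ.≤? 4 * ends-at irregularEdges i

      β : ℕ
      β = ∑ (allFin n) (indicator ∘ heavy?)

      -- The irregular edges have at most 2C ends, that is n²/500, and every heavy vertex takes n/4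
      -- of them.
      β≤ : Vertex G → AtMost‰ 8 n β
      β≤ i = atMost‰ (ℕₚ.*-cancelˡ-≤ n {{ℕ.>-nonZero (ℕₚ.≤-trans (s≤s z≤n) (1000≤n i))}} (begin
        n * (1000 * β)                     ≡⟨ solve 2 (λ n b → n :* (con 1000 :* b) := con 1000 :* (n :* b)) refl n β ⟩
        1000 * (n * β)                     ≡⟨ cong (1000 *_) (∑-distribˡ-* (allFin n) n (indicator ∘ heavy?)) ⟨
        1000 * ∑ (allFin n) (λ i → n * indicator (heavy? i))  ≤⟨ ℕₚ.*-monoʳ-≤ 1000 (∑-mono (allFin n) λ i → pointwise i (heavy? i)) ⟩
        1000 * ∑ (allFin n) (λ i → 4 * ends-at irregularEdges i)  ≡⟨ cong (1000 *_) (∑-distribˡ-* (allFin n) 4 (ends-at irregularEdges)) ⟩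
        1000 * (4 * m-total)               ≤⟨ ℕₚ.*-monoʳ-≤ 1000 (ℕₚ.*-monoʳ-≤ 4 ∑-irregular) ⟩
        1000 * (4 * (C + C))               ≡⟨ solve 1 (λ c → con 1000 :* (con 4 :* (c :+ c)) := con 8 :* (con 1000 :* c)) refl C ⟩
        8 * (1000 * C)                     ≤⟨ ℕₚ.*-monoʳ-≤ 8 C≤ ⟩
        8 * (n * n)                        ≡⟨ solve 1 (λ x → con 8 :* (x :* x) := x :* (con 8 :* x)) refl n ⟩
        n * (8 * n)                        ∎))
        where
        open ℕₚ.≤-Reasoning
        open ℕSolver.+-*-Solver
        pointwise : ∀ i (h : Dec (Heavy i)) → n * indicator h ≤ 4 * ends-at irregularEdges i
        pointwise i (yes h) = ℕₚ.≤-trans (ℕₚ.≤-reflexive (ℕₚ.*-identityʳ n)) h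
        pointwise i (no  _) = ℕₚ.≤-trans (ℕₚ.≤-reflexive (ℕₚ.*-zeroʳ n)) z≤n

      HeavyEdge : Edge G → Set
      HeavyEdge e = Heavy (source e) × Heavy (target e)

      heavyEdge? : ∀ e → Dec (HeavyEdge e)
      heavyEdge? e = heavy? (source e) ×-dec heavy? (target e)

      I₁ I₂ : List (Edge G)
      I₁ = filter heavyEdge? irregularEdges
      I₂ = filter (¬? ∘ heavyEdge?) irregularEdges

      -- The edges of `I₁` at a vertex lead to distinct vertices, all of them heavy.
      ends-at-I₁ : ∀ i → ends-at I₁ i ≤ β
      ends-at-I₁ i = ℕₚ.≤-trans (ℕₚ.≤-reflexive (sym (∑-link I₁ i))) (∑-mono (allFin n) λ k → pointwise k (heavy? k))
        where
        pointwise : ∀ k (h : Dec (Heavy k)) → ∑ I₁ (λ e → link e i k) ≤ indicator h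
        pointwise k (yes _) = ℕₚ.≤-trans (∑-filter-≤ heavyEdge? irregularEdges _) (irregular≤1 i k)
        pointwise k (no ¬h) = ℕₚ.≤-reflexive (∑-zero (All.map (λ {e} → no-link e) (Allₚ.all-filter heavyEdge? irregularEdges)))
          where
          no-link : ∀ e → HeavyEdge e → link e i k ≡ 0
          no-link e (hs , ht) = by-cases (link e i k ℕ.≟ 0)
            where
            by-cases : Dec (link e i k ≡ 0) → link e i k ≡ 0
            by-cases (yes ≡0) = ≡0
            by-cases (no  ≢0) = light (link≢0⇒Joins {e} ≢0)
              where
              light : Joins G e i k → link e i k ≡ 0
              light (inj₁ eq) = contradiction (subst Heavy (cong proj₂ eq) ht) ¬h
              light (inj₂ eq) = contradiction (subst Heavy (cong proj₁ eq) hs) ¬h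

      -- As long as only `I₁` is treated, full pairs are bounded by uses alone: 8 thousandths of n
      -- from the edges and 102 from the apexes, at either end.
      enough₁ : ∀ e → Enough I₁ e
      enough₁ e {s} {t} {f} (s≤ , _) (t≤ , _) f≤ = ‰⇒< {a = (1 + 1) + ((110 + 110) + 20)} (ℕₚ.≤ᵇ⇒≤ 243 1000 _) (ℕₚ.≤-trans (s≤s z≤n) (1000≤n i))
        (‰-+ {1 + 1} {(110 + 110) + 20} (‰-+ {1} {1} (dense i) (dense (target e)))
          (‰-+ {110 + 110} {20} (‰-+ {110} {110} (end i s≤) (end (target e) t≤))
            (exhausted≤ i (ℕₚ.≤-trans f≤ (∑-filter-≤ heavyEdge? irregularEdges (const 1))))))
        where
        i = source e
        end : ∀ j {s} → s ≤ ends-at I₁ j + (maxApex + maxApex) → AtMost‰ 110 n s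
        end j s≤ = ‰-mono {110} (ℕₚ.≤-trans s≤ (ℕₚ.+-monoˡ-≤ (maxApex + maxApex) (ends-at-I₁ j)))
          (‰-+ {8} {102} (β≤ i) (2maxApex i))

      -- One end is light and is bounded by its uses; the other may be heavy and is bounded by
      -- `half`. Two applications of `half` would exceed n.
      enough₂ : ∀ e → ¬ HeavyEdge e → Enough irregularEdges e
      enough₂ e ¬heavy {s} {t} {f} bs bt f≤ = by-cases (heavy? (source e)) (heavy? (target e))
        where
        i = source e
        half : ∀ j {s} → FullBound irregularEdges j s → AtMost‰ 551 n s
        half j {s} (_ , s≤) = atMost‰ (begin
          1000 * s                             ≡⟨ solve 1 (λ s → con 1000 :* s := con 500 :* (con 2 :* s)) refl s ⟩
          500 * (2 * s)                        ≤⟨ ℕₚ.*-monoʳ-≤ 500 2s≤ ⟩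
          500 * (n + (maxApex + maxApex))      ≡⟨ ℕₚ.*-distribˡ-+ 500 n (maxApex + maxApex) ⟩
          500 * n + 500 * (maxApex + maxApex)  ≤⟨ ℕₚ.+-monoʳ-≤ (500 * n) (ℕₚ.*-cancelˡ-≤ 2 (begin
              2 * (500 * (maxApex + maxApex))  ≡⟨ ℕₚ.*-assoc 2 500 (maxApex + maxApex) ⟨
              1000 * (maxApex + maxApex)       ≤⟨ bound (2maxApex i) ⟩
              102 * n                          ≡⟨ ℕₚ.*-assoc 2 51 n ⟩
              2 * (51 * n)                     ∎)) ⟩
          500 * n + 51 * n                     ≡⟨ ℕₚ.*-distribʳ-+ n 500 51 ⟨
          551 * n                              ∎)
          where
          open ℕₚ.≤-Reasoning
          open ℕSolver.+-*-Solver
          m = ends-at irregularEdges j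
          -- The irregular edges at `j` occur on both sides and cancel, so the bound is the same
          -- however many there are.
          2s≤ : 2 * s ≤ n + (maxApex + maxApex)
          2s≤ = ℕₚ.+-cancelʳ-≤ m (2 * s) (n + (maxApex + maxApex)) (ℕₚ.≤-trans s≤ (ℕₚ.≤-reflexive
            (solve 3 (λ n m a → n :+ (m :+ a) := n :+ a :+ m) refl n m (maxApex + maxApex))))
        light : ∀ j {s} → ¬ Heavy j → FullBound irregularEdges j s → AtMost‰ 352 n s
        light j ¬h (s≤ , _) = ‰-mono {352} s≤ (‰-+ {250} {102} (atMost‰ (begin
          1000 * m        ≡⟨ ℕₚ.*-assoc 250 4 m ⟩
          250 * (4 * m)   ≤⟨ ℕₚ.*-monoʳ-≤ 250 (ℕₚ.<⇒≤ (ℕₚ.≰⇒> ¬h)) ⟩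
          250 * n         ∎)) (2maxApex i))
          where
          open ℕₚ.≤-Reasoning
          m = ends-at irregularEdges j
        finish : ∀ {a b} → (1 + 1) + ((a + b) + 20) < 1000 → AtMost‰ a n s → AtMost‰ b n t →
          (codegree (source e) + codegree (target e)) + ((s + t) + f) < n
        finish {a} {b} lt ps pt = ‰⇒< lt (ℕₚ.≤-trans (s≤s z≤n) (1000≤n i))
          (‰-+ {1 + 1} {(a + b) + 20} (‰-+ {1} {1} (dense i) (dense (target e)))
            (‰-+ {a + b} {20} (‰-+ {a} {b} ps pt) (exhausted≤ i f≤)))
        by-cases : Dec (Heavy (source e)) → Dec (Heavy (target e)) →
          (codegree (source e) + codegree (target e)) + ((s + t) + f) < n
        by-cases (no ¬h) _       = finish {352} {551} (ℕₚ.≤ᵇ⇒≤ 926 1000 _) (light (source e) ¬h bs) (half (target e) bt)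
        by-cases (yes _) (no ¬h) = finish {551} {352} (ℕₚ.≤ᵇ⇒≤ 926 1000 _) (half (source e) bs) (light (target e) ¬h bt)
        by-cases (yes p) (yes q) = contradiction (p , q) ¬heavy

      phase₁ : ∃ λ S → Invariant I₁ S []
      phase₁ = greedy I₁ I₁ (All.universal (λ e {s} {t} {f} → enough₁ e {s} {t} {f}) I₁) record
        { apex         = []
        ; uses≤        = λ _ _ → z≤n
        ; apexes≤      = λ _ → z≤n
        ; conservation = λ _ → refl
        }

      -- The final state of the first phase is an initial state for all irregular edges with `I₂`
      -- remaining: only `conservation` refers to the total list.
      phase₂ : ∃ λ S → Invariant irregularEdges S []
      phase₂ = greedy irregularEdges I₂
        (All.map (λ {e} ¬h {s} {t} {f} → enough₂ e ¬h {s} {t} {f}) (Allₚ.all-filter (¬? ∘ heavyEdge?) irregularEdges)) record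
        { apex         = Invariant.apex inv₁
        ; uses≤        = Invariant.uses≤ inv₁
        ; apexes≤      = Invariant.apexes≤ inv₁
        ; conservation = λ h → trans (cong (_+ ∑ I₂ h) (trans (sym (ℕₚ.+-identityʳ _)) (Invariant.conservation inv₁ h)))
                                 (∑-filter-split heavyEdge? irregularEdges h)
        }
        where inv₁ = proj₂ phase₁

      -- The triangles of the cyclic system and the combined load

      regularApex : Edge G → Apex
      regularApex e = e , third (source e) (target e)

      R S : List Apex
      R = map regularApex regularEdges
      S = proj₁ phase₂

      Regular-third : ∀ {i k} → Regular i k → Regular i (third i k)
      Regular-third {i} {k} (ik , ij , kj) = ij ,
        trans (cong (adj i) (third-involutive i k)) ik ,
        trans (cong (adj (third i k)) (third-involutive i k)) (trans (adj-sym (third i k) k) kj)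

      Regular-leg : ∀ {u v i k} → Regular u v → leg u (third u v) i k ≢ 0 → Regular i k
      Regular-leg {u} {v} reg ≢0 = by-cases (leg≢0 {u = u} {third u v} ≢0)
        where
        by-cases : ∀ {i k} → (u ≡ i × third u v ≡ k) ⊎ (u ≡ k × third u v ≡ i) → Regular i k
        by-cases (inj₁ (refl , refl)) = Regular-third reg
        by-cases (inj₂ (refl , refl)) = Regular-sym (Regular-third reg)

      -- If the leg at u is the pair ik, then the remaining vertex v of the triangle is `third i k`.
      leg-third : ∀ u v i k → leg u (third u v) i k ≤ δ u i * δ v (third i k) + δ u k * δ v (third i k)
      leg-third u v i k = ℕₚ.+-mono-≤
        (term (u Fin.≟ i) (third u v Fin.≟ k) λ {refl refl → sym (third-involutive u v)})
        (term (u Fin.≟ k) (third u v Fin.≟ i) λ {refl refl → sym (trans (third-comm (third u v) u) (third-involutive u v))})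
        where
        term : ∀ {u i w k v j : Vertex G} → Dec (u ≡ i) → Dec (w ≡ k) → (u ≡ i → w ≡ k → v ≡ j) → δ u i * δ w k ≤ δ u i * δ v j
        term {u} {i} {w} {k} {v} {j} (yes p) (yes q) eq = ℕₚ.*-monoʳ-≤ (δ u i) (ℕₚ.≤-reflexive
          (trans (cong (λ x → δ x k) q) (trans (δ-refl k) (sym (trans (cong (λ x → δ x j) (eq p q)) (δ-refl j))))))
        term {u} {i} {w} {k} (yes p) (no ≢) eq = ℕₚ.≤-trans (ℕₚ.≤-reflexive (trans (cong (δ u i *_) (δ-≢ {i = w} ≢)) (ℕₚ.*-zeroʳ (δ u i)))) z≤n
        term {u} {i} {w} {k} (no ≢) _ eq = ℕₚ.≤-trans (ℕₚ.≤-reflexive (cong (_* δ w k) (δ-≢ {i = u} ≢))) z≤n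

      -- An edge with ik as a leg must be one of the other two sides of the triangle through ik.
      -- Since each of these pairs is joined by at most one edge, ik is a leg at most twice.
      legs-regular : ∀ e i k → legs (regularApex e) i k ≤ link e i (third i k) + link e k (third i k)
      legs-regular e i k = ℕₚ.≤-trans
        (ℕₚ.+-mono-≤ (leg-third u v i k)
          (subst (λ w → leg v w i k ≤ δ v i * δ u j + δ v k * δ u j) (third-comm v u) (leg-third v u i k)))
        (ℕₚ.≤-reflexive (solve 6 (λ ui uk uj vi vk vj → (ui :* vj :+ uk :* vj) :+ (vi :* uj :+ vk :* uj)
          := (ui :* vj :+ uj :* vi) :+ (uk :* vj :+ uj :* vk)) refl (δ u i) (δ u k) (δ u j) (δ v i) (δ v k) (δ v j)))
        where
        open ℕSolver.+-*-Solver
        u = source e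
        v = target e
        j = third i k

      uses-R≤2 : ∀ i k → uses R i k ≤ 2
      uses-R≤2 i k = begin
        uses R i k                                              ≡⟨ ∑-map regularApex regularEdges (λ a → legs a i k) ⟩
        ∑ regularEdges (λ e → legs (regularApex e) i k)         ≤⟨ ∑-filter-≤ regularEdge? (allFin size) _ ⟩
        ∑ (allFin size) (λ e → legs (regularApex e) i k)        ≤⟨ ∑-mono (allFin size) (λ e → legs-regular e i k) ⟩
        ∑ (allFin size) (λ e → link e i j + link e k j)         ≡⟨ ∑-distrib-+ (allFin size) (λ e → link e i j) (λ e → link e k j) ⟩
        adj i j + adj k j                                       ≤⟨ ℕₚ.+-mono-≤ (adj≤1 i j) (adj≤1 k j) ⟩
        2                                                       ∎
        where
        open ℕₚ.≤-Reasoning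
        j = third i k

      uses-R≡0 : ∀ {i k} → ¬ Regular i k → uses R i k ≡ 0
      uses-R≡0 {i} {k} ¬reg = trans (∑-map regularApex regularEdges (λ a → legs a i k))
        (∑-zero (All.map (λ {e} reg → cong₂ _+_
          (unused reg)
          (trans (cong (λ w → leg (target e) w i k) (third-comm (source e) (target e))) (unused (Regular-sym reg))))
          (Allₚ.all-filter regularEdge? (allFin size))))
        where
        unused : ∀ {u v} → Regular u v → leg u (third u v) i k ≡ 0
        unused {u} {v} reg = by-cases (leg u (third u v) i k ℕ.≟ 0)
          where
          by-cases : Dec (leg u (third u v) i k ≡ 0) → leg u (third u v) i k ≡ 0
          by-cases (yes ≡0) = ≡0
          by-cases (no  ≢0) = contradiction (Regular-leg reg ≢0) ¬reg

      uses≤3 : ∀ i k → uses (R ++ S) i k ≤ 3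
      uses≤3 i k = ℕₚ.≤-trans (ℕₚ.≤-reflexive (∑-++ R S (λ a → legs a i k))) (by-cases (regular? i k))
        where
        uses-S≤ = Invariant.uses≤ (proj₂ phase₂) i k
        by-cases : Dec (Regular i k) → uses R i k + uses S i k ≤ 3
        by-cases (yes reg) = ℕₚ.+-mono-≤ (uses-R≤2 i k) (subst (uses S i k ≤_) (capacity-regular reg) uses-S≤)
        by-cases (no ¬reg) = subst₂ _≤_ (cong (_+ uses S i k) (sym (uses-R≡0 ¬reg))) (capacity-irregular ¬reg) uses-S≤

      IsApex-R : All IsApex R
      IsApex-R = Allₚ.map⁺ (All.map proj₂ (Allₚ.all-filter regularEdge? (allFin size)))

      covers : ∀ e → e L.∈ map proj₁ (R ++ S)
      covers e = ∑-pos⇒∈ (R ++ S) proj₁ e (begin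
        1                                                   ≡⟨ δ-refl e ⟨
        δ e e                                               ≤⟨ ∑ℕ-∈-≤ (δ e) (Lₚ.∈-allFin e) ⟩
        ∑ (allFin size) (δ e)                               ≡⟨ ∑-filter-split regularEdge? (allFin size) (δ e) ⟨
        ∑ regularEdges (δ e) + ∑ irregularEdges (δ e)
          ≡⟨ cong₂ _+_ (∑-map regularApex regularEdges (δ e ∘ proj₁))
               (trans (sym (ℕₚ.+-identityʳ _)) (Invariant.conservation (proj₂ phase₂) (δ e))) ⟨
        ∑ R (δ e ∘ proj₁) + ∑ S (δ e ∘ proj₁)               ≡⟨ ∑-++ R S (δ e ∘ proj₁) ⟨
        ∑ (R ++ S) (δ e ∘ proj₁)                            ∎)
        where open ℕₚ.≤-Reasoning

      triangle : ∀ {a} → IsApex a → Triangle G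
      triangle {e , w} (uw , vw) = e , proj₁ (adj⇒Joins uw) , proj₁ (adj⇒Joins vw)

      isTriangle : ∀ {a} (p : IsApex a) → IsTriangle G (triangle {a} p)
      isTriangle {e , w} (uw , vw) = w , proj₂ (adj⇒Joins uw) , proj₂ (adj⇒Joins vw)

      triangles : ∀ {as} → All IsApex as → List (Triangle G)
      triangles = All.reduce λ {a} → triangle {a}

      triangles-IsTriangle : ∀ {as} (ps : All IsApex as) → All (IsTriangle G) (triangles ps)
      triangles-IsTriangle []               = []
      triangles-IsTriangle {a ∷ _} (p ∷ ps) = isTriangle {a} p ∷ triangles-IsTriangle ps

      map-triangles : ∀ {as} (ps : All IsApex as) → map proj₁ (triangles ps) ≡ map proj₁ as
      map-triangles []       = refl
      map-triangles (p ∷ ps) = cong (_ ∷_) (map-triangles ps)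

      Joins-leg : ∀ {g u w} → Joins G g u w → ∀ d → δ g d ≤ leg u w (source d) (target d)
      Joins-leg {g} {u} {w} j d = by-cases j (g Fin.≟ d)
        where
        by-cases : Joins G g u w → Dec (g ≡ d) → δ g d ≤ leg u w (source d) (target d)
        by-cases _         (no g≢d)   = ℕₚ.≤-trans (ℕₚ.≤-reflexive (δ-≢ {i = g} g≢d)) z≤n
        by-cases (inj₁ eq) (yes refl) = ℕₚ.≤-trans (ℕₚ.≤-reflexive (δ-refl g))
          (subst (λ (x , y) → 1 ≤ leg u w x y) (sym eq) (1≤leg u w))
        by-cases (inj₂ eq) (yes refl) = ℕₚ.≤-trans (ℕₚ.≤-reflexive (δ-refl g))
          (subst (λ (x , y) → 1 ≤ leg u w x y) (sym eq) (ℕₚ.≤-trans (1≤leg u w) (ℕₚ.≤-reflexive (leg-sym u w u w))))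

      load-triangles : ∀ {as} (ps : All IsApex as) d → load G (triangles ps) d ≤ uses as (source d) (target d)
      load-triangles []                               d = z≤n
      load-triangles {(e , w) ∷ _} ((uw , vw) ∷ ps) d = ℕₚ.+-mono-≤
        (ℕₚ.+-mono-≤ (Joins-leg (proj₂ (adj⇒Joins uw)) d) (Joins-leg (proj₂ (adj⇒Joins vw)) d)) (load-triangles ps d)

    choosable : TotalWeightChoosable G 1 4
    choosable = triangles⇒choosable G (triangles apex) (triangles-IsTriangle apex)
      (λ d → ℕₚ.≤-trans (load-triangles apex d) (uses≤3 (source d) (target d)))
      (λ e → subst (e L.∈_) (sym (map-triangles apex)) (covers e))
      where
      apex : All IsApex (R ++ S)
      apex = Allₚ.++⁺ IsApex-R (Invariant.apex (proj₂ phase₂))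

-- From the minimum degree to codegrees

open import Data.Nat using (ℕ)
open import Data.Integer using (+_)
open import Data.Rational using (_/_; _*_)
open Combinatorial

-- Degree and codegree add up to n, so the codegree is at most n/1000; the denominators are cleared
-- to pass from rationals to natural numbers.
minDegree⇒codegree : ∀ {n} (G : Graph n) i → (+ 999 / 1000) * (+ n / 1) ℚ.≤ + degree G i / 1 →
  AtMost‰ 1 n (Adjacency.codegree G i)
minDegree⇒codegree {n} G i le = atMost‰ (ℕₚ.+-cancelˡ-≤ (999 ℕ.* n) _ _ (begin
  999 ℕ.* n ℕ.+ 1000 ℕ.* codegree i       ≤⟨ ℕₚ.+-monoˡ-≤ (1000 ℕ.* codegree i) 999n≤1000d ⟩
  1000 ℕ.* degree G i ℕ.+ 1000 ℕ.* codegree i ≡⟨ ℕₚ.*-distribˡ-+ 1000 (degree G i) (codegree i) ⟨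
  1000 ℕ.* (degree G i ℕ.+ codegree i)    ≡⟨ cong (1000 ℕ.*_) (degree+codegree i) ⟩
  1000 ℕ.* n                              ≡⟨ ℕₚ.*-distribʳ-+ n 999 1 ⟩
  999 ℕ.* n ℕ.+ 1 ℕ.* n                   ∎))
  where
  open ℕₚ.≤-Reasoning
  open Adjacency G using (codegree; degree+codegree)

  unnormalised : ℚᵘ.mkℚᵘ (+ 999) 999 ℚᵘ.* ℚᵘ.mkℚᵘ (+ n) 0 ℚᵘ.≤ ℚᵘ.mkℚᵘ (+ degree G i) 0
  unnormalised = ℚᵘₚ.≤-respˡ-≃
    (ℚᵘₚ.≃-trans (ℚₚ.toℚᵘ-homo-* (+ 999 / 1000) (+ n / 1))
      (ℚᵘₚ.*-cong (ℚₚ.toℚᵘ-fromℚᵘ (ℚᵘ.mkℚᵘ (+ 999) 999)) (ℚₚ.toℚᵘ-fromℚᵘ (ℚᵘ.mkℚᵘ (+ n) 0))))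
    (ℚᵘₚ.≤-respʳ-≃ (ℚₚ.toℚᵘ-fromℚᵘ (ℚᵘ.mkℚᵘ (+ degree G i) 0)) (ℚₚ.toℚᵘ-mono-≤ le))

  999n≤1000d : 999 ℕ.* n ℕ.≤ 1000 ℕ.* degree G i
  999n≤1000d = ℤₚ.drop‿+≤+ (subst₂ ℤ._≤_
    (trans (ℤₚ.*-identityʳ (+ 999 ℤ.* + n)) (sym (ℤₚ.pos-* 999 n)))
    (trans (sym (ℤₚ.pos-* (degree G i) 1000)) (cong +_ (ℕₚ.*-comm (degree G i) 1000)))
    (ℚᵘₚ.drop-*≤* unnormalised))

theorem1p3 : ∀ (n : ℕ) (G : Graph n) →
    MinDegreeAtLeast G ((+ 999 / 1000) * (+ n / 1)) →
    TotalWeightChoosable G 1 4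
theorem1p3 n G minDegree = Dense.choosable G (λ i → minDegree⇒codegree G i (minDegree i))
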